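{- Let $K$ be a field of characteristic zero. The basis elements $p_M$ for the space $P(H)$ of primitive elements of the matroid-minor Hopf algebra $H$ are given by $$p_M=\sum_{N\in\mathcal R_M}\mu_{\mathcal R}(M,N)\,e_N,$$ for all irreducible matroids $M\in\mathcal W$.
   Context: Fix an infinite set and let $\mathcal U$ be the set of its finite subsets. $M(S)$ means that $M$ is a matroid with ground set $S$. $\mathcal W$ is the set of all (labeled) matroids $M(S)$ with $S\in\mathcal U$. $M|A$ and $M/A$ denote restriction to $A$ and contraction by $A$ (a matroid on $S\setminus A$); $\rho(M)$ is the rank of $M$. Free product: for matroids $M(S)$, $N(T)$ on disjoint sets, $M\mathbin{\Box}N$ is the matroid on $S\cup T$ whose bases are the sets $B\subseteq S\cup T$ with $|B|=\rho(M)+\rho(N)$ such that $B\cap S$ is independent in $M$ and $B\cap T$ spans $N$; this operation is associative. A matroid is irreducible if it is nonempty (has nonempty ground set) and is not a free product of two nonempty matroids; otherwise it is reducible. $\mathcal R$ is the set of reducible matroids in $\mathcal W$. Weak order on $\mathcal W$: $M\le N$ means that $M$ and $N$ have the same ground set and every basis of $M$ is a basis of $N$. For $M\in\mathcal W$, $\mathcal R_M=\{N\in\mathcal R: N\ge M\}\cup\{M\}$ with the induced order, and $\mu_{\mathcal R}(M,N)$, for $N\in\mathcal R_M$, is the value at $(M,N)$ of the Möbius function of the poset $\mathcal R_M$ (given by $\mu(x,x)=1$, $\mu(x,z)=-\sum_{x\le y<z}\mu(x,y)$ for $x<z$). $e_M$ is the isomorphism class of $M$, and $\mathcal M=\{e_M: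 M\in\mathcal W\}$. The matroid-minor Hopf algebra $H$ is the $K$-vector space with basis $\mathcal M$, product $e_Me_N=e_{M\oplus N}$, coproduct $\delta_H(e_M)=\sum_{A\subseteq S}e_{M|A}\otimes e_{M/A}$, and counit $\epsilon(e_M)=1$ if $S=\emptyset$, $0$ otherwise, for $M=M(S)$. $P(H)=\{x\in H:\delta_H(x)=1\otimes x+x\otimes1\}$, where $1$ is the class of the empty matroid. For a matroid $M(S)$ and $A\subseteq B\subseteq S$, let $M(A,B)=(M|B)/A$. An $M$-irreducible chain is a sequence $D=(S_0,\dots,S_k)$ with $\emptyset=S_0\subsetneq S_1\subsetneq\cdots\subsetneq S_k=S$ such that each minor $M(S_{i-1},S_i)$ is irreducible; $\mathrm{IC}(M)$ is the set of these, and $M(D)=M(S_0,S_1)\mathbin{\Box}\cdots\mathbin{\Box}M(S_{k-1},S_k)$ (for $S=\emptyset$, $\mathrm{IC}(M)$ consists of the single chain $(\emptyset)$ and $M(D)$ is the empty matroid). Let $\varphi$ be the linear endomorphism of the vector space with basis $\mathcal M$ given by $\varphi(e_M)=\sum_{D\in\mathrm{IC}(M)}e_{M(D)}$. In characteristic zero $\varphi$ is known to be bijective; set $p_M=\varphi^{ -1}(e_M)\in H$. It is known that $p_M$ depends only on $e_M$ and that the $p_M$, over isomorphism classes of irreducible $M$, form a basis for $P(H)$. -}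

module Defs where

open import Level using (0ℓ; _⊔_)
open import Algebra.Bundles using (CommutativeRing)
open import Algebra.Apartness.Bundles using (HeytingField; HeytingCommutativeRing)
open import Data.Bool.Base using (Bool; true; false; T)
open import Data.Empty using (⊥-elim)
open import Data.Fin.Base using (Fin; zero; suc)
open import Data.Fin.Induction using (spo-wellFounded)
open import Data.Fin.Properties using (all?; any?)
open import Data.Fin.Subset
  using (Subset; inside; outside; ⊥; ⁅_⁆; _∈_; _∉_; _⊆_; _⊂_; _∩_; _∪_; _─_; _-_; ∣_∣; Nonempty; Empty)
open import Data.Fin.Subset.Induction using (⊂-wellFounded; ⊃-wellFounded)
open import Data.Fin.Subset.Properties
import Data.Integer.Base as ℤ
open import Data.Integer.Base using (ℤ; 0ℤ; 1ℤ)
import Data.Integer.Properties as ℤ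
open import Data.List.Base as List
  using (List; []; _∷_; length; lookup; concatMap; filter; mapMaybe; cartesianProduct; cartesianProductWith; tabulate)
open import Data.List.Relation.Unary.Any as Any using (Any; here; there)
import Data.List.Relation.Unary.Any.Properties as Any
open import Data.List.Relation.Unary.Linked using (Linked; linked?)
open import Data.Maybe.Base using (Maybe; just; nothing)
import Data.Maybe.Properties as Maybe
import Data.Maybe.Relation.Unary.Any as MAny
open import Data.Nat.Base as ℕ using (ℕ; zero; suc; _+_; _≤_; _<_)
import Data.Nat.Properties as ℕ
open import Data.Product.Base using (∃; ∃₂; _×_; _,_; proj₁; proj₂)
open import Data.Sum.Base using (_⊎_; inj₁; inj₂; [_,_]′)
open import Data.Vec.Base using ([]; _∷_; there)
import Data.Vec.Properties as Vec
import Data.Bool.Properties as Bool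
open import Function.Base using (_∘_; id)
open import Function.Bundles using (_⇔_; mk⇔; _↔_; Equivalence; Inverse)
open import Induction.WellFounded using (Acc; acc)
open import Relation.Binary.Core using (Rel)
open import Relation.Binary.Definitions using () renaming (Decidable to Decidable₂)
open import Relation.Binary.PropositionalEquality
  using (_≡_; refl; sym; trans; cong; cong₂; subst)
open import Relation.Binary.Structures using (IsDecPartialOrder)
import Relation.Binary.Construct.NonStrictToStrict as ToStrict
import Relation.Binary.Construct.On as On
open import Relation.Nullary using (¬_; Dec; yes; no; contradiction)
open import Relation.Nullary.Decidable
  using (isYes; _×-dec_; _→-dec_; ¬?; map′; decidable-stable; toWitness; fromWitness)
open import Relation.Unary using (Pred; Decidable)
open import Algebra.Properties.Monoid.Sum ℤ.+-0-monoid using (sum)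

private
  variable
    n : ℕ

swap : Subset n → Fin n → Fin n → Subset n
swap A x y = (A - x) ∪ ⁅ y ⁆

record IsMatroid {n : ℕ} (S : Subset n) (Basis : Pred (Subset n) 0ℓ) : Set where
  field
    basis⊆   : ∀ B → Basis B → B ⊆ S
    nonempty : ∃ Basis
    exchange : ∀ A B → Basis A → Basis B → ∀ x → x ∈ A → x ∉ B →
               ∃ λ y → y ∈ B × y ∉ A × Basis (swap A x y)

-- The fixed infinite set is ℕ.  A finite subset of it is given as a subset of
-- an initial segment Fin n; the matroid's ground set need not be all of Fin n.
record Matroid (n : ℕ) : Set₁ where
  field
    ground    : Subset n
    Basis     : Pred (Subset n) 0ℓ
    Basis?    : Decidable Basis
    isMatroid : IsMatroid ground Basis

  open IsMatroid isMatroid public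

  -- All bases are equinumerous: see equicardinal below.
  ρ : ℕ
  ρ = ∣ proj₁ nonempty ∣

  Indep : Pred (Subset n) 0ℓ
  Indep I = ∃ λ B → Basis B × I ⊆ B

  Spanning : Pred (Subset n) 0ℓ
  Spanning X = ∃ λ B → Basis B × B ⊆ X

  Indep? : Decidable Indep
  Indep? I = anySubset? λ B → Basis? B ×-dec (I ⊆? B)

  Spanning? : Decidable Spanning
  Spanning? X = anySubset? λ B → Basis? B ×-dec (B ⊆? X)

open Matroid public using (ground; Basis; Basis?; isMatroid; ρ; Indep; Spanning)

infix 4 _≋_ _≤ʷ_

_≋_ : Rel (Matroid n) 0ℓ
M ≋ N = ground M ≡ ground N × (∀ B → Basis M B ⇔ Basis N B)

_≤ʷ_ : Rel (Matroid n) 0ℓ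
M ≤ʷ N = ground M ≡ ground N × (∀ B → Basis M B → Basis N B)

module _ where
  open ℕ.≤-Reasoning

  ∣∣-split : ∀ (p q : Subset n) → ∣ p ∣ ≡ ∣ p ∩ q ∣ + ∣ p ─ q ∣
  ∣∣-split []            []            = refl
  ∣∣-split (inside ∷ p)  (inside ∷ q)  = cong suc (∣∣-split p q)
  ∣∣-split (inside ∷ p)  (outside ∷ q) =
    trans (cong suc (∣∣-split p q)) (sym (ℕ.+-suc _ _))
  ∣∣-split (outside ∷ p) (inside ∷ q)  = ∣∣-split p q
  ∣∣-split (outside ∷ p) (outside ∷ q) = ∣∣-split p q

  x∉p─q : ∀ {p q : Subset n} {x} → x ∈ p ─ q → x ∉ q
  x∉p─q {p = _ ∷ p} {inside ∷ q}  {suc x} (there h) (there k) = x∉p─q {p = p} {q} h k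
  x∉p─q {p = _ ∷ p} {outside ∷ q} {suc x} (there h) (there k) = x∉p─q {p = p} {q} h k

  ∈-swap⁻ : ∀ (A : Subset n) {x y z} → z ∈ swap A x y → (z ∈ A × ¬ z ≡ x) ⊎ z ≡ y
  ∈-swap⁻ A {x} {y} h with x∈p∪q⁻ (A - x) ⁅ y ⁆ h
  ... | inj₁ k = inj₁ (p─q⊆p A ⁅ x ⁆ k , x∉⁅y⁆⇒x≢y (x∉p─q {p = A} k))
  ... | inj₂ k = inj₂ (x∈⁅y⁆⇒x≡y y k)

  ∈-swapˡ : ∀ {A : Subset n} {x y z} → z ∈ A → ¬ z ≡ x → z ∈ swap A x y
  ∈-swapˡ z∈A z≢x = p⊆p∪q _ (x∈p∧x≢y⇒x∈p-y z∈A z≢x)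

  ∈-swapʳ : ∀ (A : Subset n) {x y} → y ∈ swap A x y
  ∈-swapʳ A {x} {y} = q⊆p∪q (A - x) ⁅ y ⁆ (x∈⁅x⁆ y)

  ∈-add⁻ : ∀ {A : Subset n} {y z} → z ∈ A ∪ ⁅ y ⁆ → z ∈ A ⊎ z ≡ y
  ∈-add⁻ {A = A} {y} h with x∈p∪q⁻ A ⁅ y ⁆ h
  ... | inj₁ k = inj₁ k
  ... | inj₂ k = inj₂ (x∈⁅y⁆⇒x≡y y k)

  y∈A∪y : ∀ (A : Subset n) {y} → y ∈ A ∪ ⁅ y ⁆
  y∈A∪y A {y} = q⊆p∪q A ⁅ y ⁆ (x∈⁅x⁆ y)

  ≢-by : ∀ {A : Subset n} {y z} → y ∉ A → z ∈ A → ¬ z ≡ y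
  ≢-by y∉A z∈A refl = y∉A z∈A

  ∈-≡ : ∀ {A : Subset n} {y z} → y ∈ A → z ≡ y → z ∈ A
  ∈-≡ y∈A refl = y∈A

  ∣-∣ : ∀ {A : Subset n} {x} → x ∈ A → ∣ A ∣ ≡ suc ∣ A - x ∣
  ∣-∣ {A = A} {x} x∈A = trans (∣∣-split A ⁅ x ⁆) (cong (_+ ∣ A - x ∣) (trans (cong ∣_∣ eq) (∣⁅x⁆∣≡1 x)))
    where
    eq : A ∩ ⁅ x ⁆ ≡ ⁅ x ⁆
    eq = ⊆-antisym (p∩q⊆q A ⁅ x ⁆)
      λ h → x∈p∩q⁺ (subst (_∈ A) (sym (x∈⁅y⁆⇒x≡y x h)) x∈A , h)

  ∣add∣ : ∀ {A : Subset n} {y} → y ∉ A → ∣ A ∪ ⁅ y ⁆ ∣ ≡ suc ∣ A ∣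
  ∣add∣ {A = A} {y} y∉A = trans (∣-∣ (y∈A∪y A)) (cong (suc ∘ ∣_∣) (⊆-antisym to from))
    where
    to : (A ∪ ⁅ y ⁆) - y ⊆ A
    to h with ∈-add⁻ {A = A} (p─q⊆p (A ∪ ⁅ y ⁆) ⁅ y ⁆ h)
    ... | inj₁ k = k
    ... | inj₂ refl = contradiction (x∈⁅x⁆ y) (x∉p─q {p = A ∪ ⁅ y ⁆} h)
    from : A ⊆ (A ∪ ⁅ y ⁆) - y
    from h = x∈p∧x≢y⇒x∈p-y (p⊆p∪q _ h) (≢-by y∉A h)

  ∣swap∣ : ∀ {A : Subset n} {x y} → x ∈ A → y ∉ A → ∣ swap A x y ∣ ≡ ∣ A ∣
  ∣swap∣ {A = A} {x} x∈A y∉A =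
    trans (∣add∣ (y∉A ∘ p─q⊆p A ⁅ x ⁆)) (sym (∣-∣ x∈A))

  ⊆∧∣∣⇒⊇ : ∀ {p q : Subset n} → p ⊆ q → ∣ q ∣ ≤ ∣ p ∣ → q ⊆ p
  ⊆∧∣∣⇒⊇ {p = p} p⊆q le {x} x∈q with x ∈? p
  ... | yes x∈p = x∈p
  ... | no  x∉p = contradiction (p⊂q⇒∣p∣<∣q∣ (p⊆q , x , x∈q , x∉p)) (ℕ.≤⇒≯ le)

  ─-⊂ : ∀ {A B : Subset n} {x y} → x ∈ A → x ∉ B → y ∈ B → swap A x y ─ B ⊂ A ─ B
  ─-⊂ {A = A} {B} {x} {y} x∈A x∉B y∈B = sub , x , x∈p∧x∉q⇒x∈p─q x∈A x∉B , out
    where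
    sub : swap A x y ─ B ⊆ A ─ B
    sub h with ∈-swap⁻ A (p─q⊆p (swap A x y) B h)
    ... | inj₁ (z∈A , _) = x∈p∧x∉q⇒x∈p─q z∈A (x∉p─q {p = swap A x y} h)
    ... | inj₂ refl      = contradiction y∈B (x∉p─q {p = swap A x y} h)
    out : x ∉ swap A x y ─ B
    out h with ∈-swap⁻ A (p─q⊆p (swap A x y) B h)
    ... | inj₁ (_ , x≢x) = x≢x refl
    ... | inj₂ refl      = x∉B y∈B

  module MatroidLemmas {S : Subset n} {𝓑 : Pred (Subset n) 0ℓ} (isM : IsMatroid S 𝓑) where
    open IsMatroid isM

    Ind Span : Pred (Subset n) 0ℓ
    Ind I = ∃ λ B → 𝓑 B × I ⊆ B
    Span X = ∃ λ B → 𝓑 B × B ⊆ X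

    equicard≤ : ∀ {A B} → 𝓑 A → 𝓑 B → ∣ A ∣ ≤ ∣ B ∣
    equicard≤ {A₀} {B} bA₀ bB = go A₀ bA₀ (⊂-wellFounded _)
      where
      go : ∀ A → 𝓑 A → Acc _⊂_ (A ─ B) → ∣ A ∣ ≤ ∣ B ∣
      go A bA (acc rs) with nonempty? (A ─ B)
      ... | no  e = p⊆q⇒∣p∣≤∣q∣ λ {x} x∈A → decidable-stable (x ∈? B)
                      λ x∉B → e (x , x∈p∧x∉q⇒x∈p─q x∈A x∉B)
      ... | yes (x , h) =
        let x∈A = p─q⊆p A B h
            x∉B = x∉p─q {p = A} h
            y , y∈B , y∉A , b = exchange A B bA bB x x∈A x∉B
        in subst (_≤ ∣ B ∣) (∣swap∣ x∈A y∉A) (go _ b (rs (─-⊂ x∈A x∉B y∈B)))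

    equicard : ∀ {A B} → 𝓑 A → 𝓑 B → ∣ A ∣ ≡ ∣ B ∣
    equicard bA bB = ℕ.≤-antisym (equicard≤ bA bB) (equicard≤ bB bA)

    max-indep : ∀ {X B} → Ind X → 𝓑 B → ∣ B ∣ ≤ ∣ X ∣ → 𝓑 X
    max-indep {X} (C , bC , X⊆C) bB le =
      subst 𝓑 (⊆-antisym (⊆∧∣∣⇒⊇ X⊆C (ℕ.≤-trans (equicard≤ bC bB) le)) X⊆C) bC

    augment : ∀ {I J} → Ind I → Ind J → ∣ I ∣ < ∣ J ∣ →
              ∃ λ y → y ∈ J × y ∉ I × Ind (I ∪ ⁅ y ⁆)
    augment {I} {J} (B , bB , I⊆B) (C₀ , bC₀ , J⊆C₀) lt = go C₀ bC₀ J⊆C₀ (⊂-wellFounded _)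
      where
      Goal = ∃ λ y → y ∈ J × y ∉ I × Ind (I ∪ ⁅ y ⁆)
      go : ∀ C → 𝓑 C → J ⊆ C → Acc _⊂_ (C ─ B) → Goal
      go C bC J⊆C (acc rs) with nonempty? ((C ─ B) ─ J)
      ... | yes (x , h) =
        let x∈C─B = p─q⊆p (C ─ B) J h
            x∉J = x∉p─q {p = C ─ B} h
            x∈C = p─q⊆p C B x∈C─B
            x∉B = x∉p─q {p = C} x∈C─B
            y , y∈B , y∉C , b = exchange C B bC bB x x∈C x∉B
        in go _ b (λ z∈J → ∈-swapˡ (J⊆C z∈J) (≢-by x∉J z∈J)) (rs (─-⊂ x∈C x∉B y∈B))
      ... | no C─B⊆J with nonempty? ((J ∩ B) ─ I)
      ...   | yes (y , h) =
        let y∈J , y∈B = x∈p∩q⁻ J B (p─q⊆p (J ∩ B) I h)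
        in y , y∈J , x∉p─q {p = J ∩ B} h , B , bB ,
           λ k → [ I⊆B , ∈-≡ y∈B ]′ (∈-add⁻ {A = I} k)
      ...   | no J∩B⊆I with nonempty? ((B ─ C) ─ I)
      ...     | yes (x , h) =
        let x∈B─C = p─q⊆p (B ─ C) I h
            x∉I = x∉p─q {p = B ─ C} h
            x∈B = p─q⊆p B C x∈B─C
            x∉C = x∉p─q {p = B} x∈B─C
            y , y∈C , y∉B , b = exchange B C bB bC x x∈B x∉C
            y∈J = decidable-stable (y ∈? J)
                    λ y∉J → C─B⊆J (y , x∈p∧x∉q⇒x∈p─q (x∈p∧x∉q⇒x∈p─q y∈C y∉B) y∉J)
        in y , y∈J , (λ y∈I → y∉B (I⊆B y∈I)) , swap B x y , b ,
           λ k → [ (λ z∈I → ∈-swapˡ (I⊆B z∈I) (≢-by x∉I z∈I))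
                 , ∈-≡ (∈-swapʳ B) ]′ (∈-add⁻ {A = I} k)
      ...     | no B─C⊆I = contradiction lt (ℕ.≤⇒≯ le)
        where
        same : ∣ C ─ B ∣ ≡ ∣ B ─ C ∣
        same = ℕ.+-cancelˡ-≡ ∣ C ∩ B ∣ _ _ (trans (sym (∣∣-split C B)) (trans (equicard bC bB)
          (trans (∣∣-split B C) (cong (λ p → ∣ p ∣ + ∣ B ─ C ∣) (∩-comm B C)))))
        s₁ : J ∩ B ⊆ I ∩ C
        s₁ {x} h = let x∈J , x∈B = x∈p∩q⁻ J B h in
          x∈p∩q⁺ (decidable-stable (x ∈? I) (λ x∉I → J∩B⊆I (x , x∈p∧x∉q⇒x∈p─q h x∉I)) , J⊆C x∈J)
        s₂ : J ─ B ⊆ C ─ B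
        s₂ h = x∈p∧x∉q⇒x∈p─q (J⊆C (p─q⊆p J B h)) (x∉p─q {p = J} h)
        s₃ : B ─ C ⊆ I ─ C
        s₃ {x} h = x∈p∧x∉q⇒x∈p─q (decidable-stable (x ∈? I) λ x∉I → B─C⊆I (x , x∈p∧x∉q⇒x∈p─q h x∉I))
                     (x∉p─q {p = B} h)
        le : ∣ J ∣ ≤ ∣ I ∣
        le = begin
          ∣ J ∣                   ≡⟨ ∣∣-split J B ⟩
          ∣ J ∩ B ∣ + ∣ J ─ B ∣   ≤⟨ ℕ.+-mono-≤ (p⊆q⇒∣p∣≤∣q∣ s₁) (p⊆q⇒∣p∣≤∣q∣ s₂) ⟩
          ∣ I ∩ C ∣ + ∣ C ─ B ∣   ≡⟨ cong (∣ I ∩ C ∣ +_) same ⟩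
          ∣ I ∩ C ∣ + ∣ B ─ C ∣   ≤⟨ ℕ.+-monoʳ-≤ ∣ I ∩ C ∣ (p⊆q⇒∣p∣≤∣q∣ s₃) ⟩
          ∣ I ∩ C ∣ + ∣ I ─ C ∣   ≡⟨ ∣∣-split I C ⟨
          ∣ I ∣                   ∎

    span-exchange : ∀ {Y Z x} → Span Y → Span Z → x ∉ Z →
                    Span (Y - x) ⊎ (∃ λ y → y ∈ Z × y ∉ Y × Span (swap Y x y))
    span-exchange {Y} {Z} {x} (B , bB , B⊆Y) (C , bC , C⊆Z) x∉Z with x ∈? B
    ... | no x∉B = inj₁ (B , bB , λ h → x∈p∧x≢y⇒x∈p-y (B⊆Y h) (≢-by x∉B h))
    ... | yes x∈B with exchange B C bB bC x x∈B (x∉Z ∘ C⊆Z)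
    ...   | y , y∈C , y∉B , b with y ∈? Y
    ...     | yes y∈Y = inj₁ (_ , b , λ h →
                [ (λ (z∈B , z≢x) → x∈p∧x≢y⇒x∈p-y (B⊆Y z∈B) z≢x)
                , ∈-≡ (x∈p∧x≢y⇒x∈p-y y∈Y (≢-by x∉Z (C⊆Z y∈C))) ]′ (∈-swap⁻ B h))
    ...     | no  y∉Y = inj₂ (y , C⊆Z y∈C , y∉Y , _ , b , λ h →
                [ (λ (z∈B , z≢x) → ∈-swapˡ (B⊆Y z∈B) z≢x)
                , ∈-≡ (∈-swapʳ Y) ]′ (∈-swap⁻ B h))

equicardinal : (M : Matroid n) → ∀ {B} → Basis M B → ∣ B ∣ ≡ ρ M
equicardinal M b = MatroidLemmas.equicard (isMatroid M) b (proj₂ (Matroid.nonempty M))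

allSubset? : ∀ {ℓ} {P : Pred (Subset n) ℓ} → Decidable P → Dec (∀ p → P p)
allSubset? P? = map′ (λ h p → decidable-stable (P? p) λ ¬p → h (p , ¬p)) (λ h (p , ¬p) → ¬p (h p))
                     (¬? (anySubset? (¬? ∘ P?)))

module _ {n : ℕ} where

  ∅ : Matroid n
  ∅ = record
    { ground    = ⊥
    ; Basis     = _≡ ⊥
    ; Basis?    = λ B → Vec.≡-dec Bool._≟_ B ⊥
    ; isMatroid = record
      { basis⊆   = λ { _ refl → id }
      ; nonempty = ⊥ , refl
      ; exchange = λ { _ _ refl _ _ x∈⊥ → contradiction x∈⊥ ∉⊥ }
      }
    }

module _ {n : ℕ} (M : Matroid n) (A : Subset n) where
  open Matroid M using (basis⊆; nonempty; exchange; Indep?)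
  open MatroidLemmas (isMatroid M)

  RestrictBasis : Pred (Subset n) 0ℓ
  RestrictBasis B = Indep M B × B ⊆ A × (∀ y → y ∈ A → y ∉ B → ¬ Indep M (B ∪ ⁅ y ⁆))

  RestrictBasis? : Decidable RestrictBasis
  RestrictBasis? B = Indep? B ×-dec (B ⊆? A) ×-dec
    all? λ y → (y ∈? A) →-dec ¬? (y ∈? B) →-dec ¬? (Indep? (B ∪ ⁅ y ⁆))

  restrict-card : ∀ {B I} → RestrictBasis B → Indep M I → I ⊆ A → ∣ I ∣ ≤ ∣ B ∣
  restrict-card {B} {I} (iB , B⊆A , max) iI I⊆A with ∣ I ∣ ℕ.≤? ∣ B ∣
  ... | yes le = le
  ... | no  gt = let y , y∈I , y∉B , i = augment iB iI (ℕ.≰⇒> gt)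
                 in contradiction i (max y (I⊆A y∈I) y∉B)

  restrict-max : ∀ {B I} → RestrictBasis B → Indep M I → I ⊆ A → ∣ B ∣ ≤ ∣ I ∣ → RestrictBasis I
  restrict-max r iI I⊆A le = iI , I⊆A , λ y y∈A y∉I i →
    contradiction (restrict-card r i λ h → [ I⊆A , ∈-≡ y∈A ]′ (∈-add⁻ h))
      (ℕ.<⇒≱ (ℕ.≤-<-trans le (ℕ.≤-reflexive (sym (∣add∣ y∉I)))))

  restrict-nonempty : ∃ RestrictBasis
  restrict-nonempty = go ⊥ (_ , proj₂ nonempty , λ h → contradiction h ∉⊥)
                         (λ h → contradiction h ∉⊥) (⊃-wellFounded ⊥)
    where
    go : ∀ I → Indep M I → I ⊆ A → Acc (λ p q → q ⊂ p) I → ∃ RestrictBasis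
    go I iI I⊆A (acc rs) with any? (λ y → (y ∈? A) ×-dec ¬? (y ∈? I) ×-dec Indep? (I ∪ ⁅ y ⁆))
    ... | yes (y , y∈A , y∉I , i) =
      go (I ∪ ⁅ y ⁆) i (λ h → [ I⊆A , ∈-≡ y∈A ]′ (∈-add⁻ h))
         (rs (p⊆p∪q _ , y , y∈A∪y I , y∉I))
    ... | no  none = I , iI , I⊆A , λ y y∈A y∉I i → none (y , y∈A , y∉I , i)

  restrict-exchange : ∀ B C → RestrictBasis B → RestrictBasis C → ∀ x → x ∈ B → x ∉ C →
                      ∃ λ y → y ∈ C × y ∉ B × RestrictBasis (swap B x y)
  restrict-exchange B C rB@((B′ , bB′ , B⊆B′) , B⊆A , _) rC@(iC , C⊆A , _) x x∈B x∉C =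
    let y , y∈C , y∉B-x , i = augment (B′ , bB′ , B⊆B′ ∘ p─q⊆p B ⁅ x ⁆) iC
          (ℕ.<-≤-trans (x∈p⇒∣p-x∣<∣p∣ x∈B) (restrict-card rC (proj₁ rB) B⊆A))
        y∉B = λ y∈B → y∉B-x (x∈p∧x≢y⇒x∈p-y y∈B (≢-by x∉C y∈C))
    in y , y∈C , y∉B , restrict-max rB i
         (λ h → [ B⊆A ∘ proj₁ , ∈-≡ (C⊆A y∈C) ]′ (∈-swap⁻ B h))
         (ℕ.≤-reflexive (sym (∣swap∣ x∈B y∉B)))

  infix 8 _↾_ _/_

  -- For A not contained in the ground set these are M ↾ (A ∩ S) and M / (A ∩ S).
  _↾_ : Matroid n
  _↾_ = record
    { ground    = ground M ∩ A
    ; Basis     = RestrictBasis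
    ; Basis?    = RestrictBasis?
    ; isMatroid = record
      { basis⊆   = λ { B ((C , bC , B⊆C) , B⊆A , _) h → x∈p∩q⁺ (basis⊆ C bC (B⊆C h) , B⊆A h) }
      ; nonempty = restrict-nonempty
      ; exchange = restrict-exchange
      }
    }

  ContractBasis : Pred (Subset n) 0ℓ
  ContractBasis B = B ⊆ ground M ─ A × ∃ λ J → RestrictBasis J × Basis M (B ∪ J)

  contract-nonempty : ∃ ContractBasis
  contract-nonempty with restrict-nonempty
  ... | J , r@((C , bC , J⊆C) , J⊆A , max) = C ─ J , sub , J , r , subst (Basis M) eq bC
    where
    sub : C ─ J ⊆ ground M ─ A
    sub {y} h = x∈p∧x∉q⇒x∈p─q (basis⊆ C bC y∈C) λ y∈A →
      max y y∈A (x∉p─q {p = C} h) (C , bC , λ k → [ J⊆C , ∈-≡ y∈C ]′ (∈-add⁻ k))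
      where y∈C = p─q⊆p C J h
    to : C ⊆ (C ─ J) ∪ J
    to {x} h with x ∈? J
    ... | yes x∈J = q⊆p∪q (C ─ J) J x∈J
    ... | no  x∉J = p⊆p∪q J (x∈p∧x∉q⇒x∈p─q h x∉J)
    eq : C ≡ (C ─ J) ∪ J
    eq = ⊆-antisym to (λ h → [ p─q⊆p C J , J⊆C ]′ (x∈p∪q⁻ (C ─ J) J h))

  contract-exchange : ∀ B C → ContractBasis B → ContractBasis C → ∀ x → x ∈ B → x ∉ C →
                      ∃ λ y → y ∈ C × y ∉ B × ContractBasis (swap B x y)
  contract-exchange B C (B⊆ , J , rJ@(_ , J⊆A , max) , bJ) (C⊆ , K , (_ , K⊆A , _) , bK) x x∈B x∉C =
    finish (augment {I = (B - x) ∪ J} (B ∪ J , bJ , I⊆) (C ∪ K , bK , id) lt)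
    where
    x∉J : x ∉ J
    x∉J x∈J = x∉p─q {p = ground M} (B⊆ x∈B) (J⊆A x∈J)
    I⊆ : (B - x) ∪ J ⊆ B ∪ J
    I⊆ h = x∈p∪q⁺ ([ inj₁ ∘ p─q⊆p B ⁅ x ⁆ , inj₂ ]′ (x∈p∪q⁻ (B - x) J h))
    lt : ∣ (B - x) ∪ J ∣ < ∣ C ∪ K ∣
    lt = ℕ.<-≤-trans (p⊂q⇒∣p∣<∣q∣ (I⊆ , x , p⊆p∪q J x∈B ,
           λ h → [ (λ k → x∉p─q {p = B} k (x∈⁅x⁆ x)) , x∉J ]′ (x∈p∪q⁻ (B - x) J h)))
           (equicard≤ bJ bK)
    finish : (∃ λ y → y ∈ C ∪ K × y ∉ (B - x) ∪ J × Indep M (((B - x) ∪ J) ∪ ⁅ y ⁆)) →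
             ∃ λ y → y ∈ C × y ∉ B × ContractBasis (swap B x y)
    finish (y , y∈ , y∉ , D , bD , ⊆D) with x∈p∪q⁻ C K y∈
    ... | inj₂ y∈K = ⊥-elim (max y (K⊆A y∈K) (y∉ ∘ q⊆p∪q (B - x) J)
      (D , bD , λ h → ⊆D (x∈p∪q⁺ ([ inj₁ ∘ q⊆p∪q (B - x) J , inj₂ ∘ ∈-≡ (x∈⁅x⁆ y) ]′ (∈-add⁻ h)))))
    ... | inj₁ y∈C = y , y∈C , y∉B , sw⊆ , J , rJ , max-indep (D , bD , ⊆D ∘ s₁) bJ
            (subst (_≤ ∣ swap B x y ∪ J ∣) (∣swap∣ (p⊆p∪q J x∈B) y∉BJ) (p⊆q⇒∣p∣≤∣q∣ s₂))
      where
      y∉B : y ∉ B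
      y∉B y∈B = y∉ (p⊆p∪q J (x∈p∧x≢y⇒x∈p-y y∈B (≢-by x∉C y∈C)))
      y∉BJ : y ∉ B ∪ J
      y∉BJ h = [ y∉B , y∉ ∘ q⊆p∪q (B - x) J ]′ (x∈p∪q⁻ B J h)
      sw⊆ : swap B x y ⊆ ground M ─ A
      sw⊆ h = [ B⊆ ∘ proj₁ , ∈-≡ (C⊆ y∈C) ]′ (∈-swap⁻ B h)
      s₁ : swap B x y ∪ J ⊆ ((B - x) ∪ J) ∪ ⁅ y ⁆
      s₁ h with x∈p∪q⁻ (swap B x y) J h
      ... | inj₂ k = x∈p∪q⁺ (inj₁ (q⊆p∪q (B - x) J k))
      ... | inj₁ k = x∈p∪q⁺ ([ inj₁ ∘ p⊆p∪q J , inj₂ ]′ (x∈p∪q⁻ (B - x) ⁅ y ⁆ k))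
      s₂ : swap (B ∪ J) x y ⊆ swap B x y ∪ J
      s₂ h with ∈-swap⁻ (B ∪ J) h
      ... | inj₂ refl = p⊆p∪q J (∈-swapʳ B)
      ... | inj₁ (k , z≢x) = x∈p∪q⁺ ([ (λ z∈B → inj₁ (∈-swapˡ z∈B z≢x)) , inj₂ ]′ (x∈p∪q⁻ B J k))

  _/_ : Matroid n
  _/_ = record
    { ground    = ground M ─ A
    ; Basis     = ContractBasis
    ; Basis?    = λ B → (B ⊆? (ground M ─ A)) ×-dec
                        anySubset? λ J → RestrictBasis? J ×-dec Basis? M (B ∪ J)
    ; isMatroid = record
      { basis⊆   = λ _ → proj₁
      ; nonempty = contract-nonempty
      ; exchange = contract-exchange
      }
    }

minor : Matroid n → Subset n → Subset n → Matroid n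
minor M A B = (M ↾ B) / A

Disjoint : Rel (Subset n) 0ℓ
Disjoint S T = Empty (S ∩ T)

module _ {n : ℕ} (M N : Matroid n) where

  FreeBasis : Pred (Subset n) 0ℓ
  FreeBasis B = B ⊆ ground M ∪ ground N × ∣ B ∣ ≡ ρ M + ρ N
              × Indep M (B ∩ ground M) × Spanning N (B ∩ ground N)

  module _ (disjoint : Disjoint (ground M) (ground N)) where
    private
      S = ground M
      T′ = ground N
      module M = MatroidLemmas (isMatroid M)
      module N = MatroidLemmas (isMatroid N)

      S∌ : ∀ {x} → x ∈ T′ → x ∉ S
      S∌ x∈T x∈S = disjoint (_ , x∈p∩q⁺ (x∈S , x∈T))

      split : ∀ {A} → A ⊆ S ∪ T′ → ∣ A ∣ ≡ ∣ A ∩ S ∣ + ∣ A ∩ T′ ∣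
      split {A} A⊆ = trans (∣∣-split A S) (cong (λ p → ∣ A ∩ S ∣ + ∣ p ∣) (⊆-antisym to from))
        where
        to : A ─ S ⊆ A ∩ T′
        to h = let k = p─q⊆p A S h in
          [ (λ x∈S → contradiction x∈S (x∉p─q {p = A} h)) , (λ x∈T → x∈p∩q⁺ (k , x∈T)) ]′
            (x∈p∪q⁻ S T′ (A⊆ k))
        from : A ∩ T′ ⊆ A ─ S
        from h = let x∈A , x∈T = x∈p∩q⁻ A T′ h in x∈p∧x∉q⇒x∈p─q x∈A (S∌ x∈T)

      Ind-⊆ : ∀ {I J} → I ⊆ J → Indep M J → Indep M I
      Ind-⊆ I⊆J (B , b , J⊆B) = B , b , J⊆B ∘ I⊆J

      Span-⊆ : ∀ {X Y} → X ⊆ Y → Spanning N X → Spanning N Y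
      Span-⊆ X⊆Y (B , b , B⊆X) = B , b , X⊆Y ∘ B⊆X

    free-nonempty : ∃ FreeBasis
    free-nonempty with Matroid.nonempty M | Matroid.nonempty N
    ... | B , bB | C , bC = B ∪ C , sub , card , (B , bB , in₁) , (C , bC , in₂)
      where
      B⊆S = Matroid.basis⊆ M B bB
      C⊆T = Matroid.basis⊆ N C bC
      sub : B ∪ C ⊆ S ∪ T′
      sub h = x∈p∪q⁺ ([ inj₁ ∘ B⊆S , inj₂ ∘ C⊆T ]′ (x∈p∪q⁻ B C h))
      in₁ : (B ∪ C) ∩ S ⊆ B
      in₁ h = let k , x∈S = x∈p∩q⁻ (B ∪ C) S h in
        [ id , (λ x∈C → contradiction x∈S (S∌ (C⊆T x∈C))) ]′ (x∈p∪q⁻ B C k)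
      in₂ : C ⊆ (B ∪ C) ∩ T′
      in₂ h = x∈p∩q⁺ (q⊆p∪q B C h , C⊆T h)
      in₂′ : (B ∪ C) ∩ T′ ⊆ C
      in₂′ h = let k , x∈T = x∈p∩q⁻ (B ∪ C) T′ h in
        [ (λ x∈B → contradiction (B⊆S x∈B) (S∌ x∈T)) , id ]′ (x∈p∪q⁻ B C k)
      in₁′ : B ⊆ (B ∪ C) ∩ S
      in₁′ h = x∈p∩q⁺ (p⊆p∪q C h , B⊆S h)
      card : ∣ B ∪ C ∣ ≡ ∣ B ∣ + ∣ C ∣
      card = trans (split sub)
        (cong₂ (λ p q → ∣ p ∣ + ∣ q ∣) (⊆-antisym in₁ in₁′) (⊆-antisym in₂′ in₂))

    free-exchange : ∀ A B → FreeBasis A → FreeBasis B → ∀ x → x ∈ A → x ∉ B →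
                    ∃ λ y → y ∈ B × y ∉ A × FreeBasis (swap A x y)
    free-exchange A B (A⊆ , cA , iA , sA) (B⊆ , cB , iB , sB) x x∈A x∉B = main
      where
      Goal = ∃ λ y → y ∈ B × y ∉ A × FreeBasis (swap A x y)

      finish : ∀ {y} → y ∈ B → y ∉ A →
               Indep M (swap A x y ∩ S) → Spanning N (swap A x y ∩ T′) → Goal
      finish y∈B y∉A i s = _ , y∈B , y∉A ,
        (λ h → [ A⊆ ∘ proj₁ , ∈-≡ (B⊆ y∈B) ]′ (∈-swap⁻ A h)) ,
        trans (∣swap∣ x∈A y∉A) cA , i , s

      shrink : ∀ {y} → y ∉ S → swap A x y ∩ S ⊆ A ∩ S
      shrink {y} y∉S h = let k , z∈S = x∈p∩q⁻ (swap A x y) S h in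
        [ (λ (z∈A , _) → x∈p∩q⁺ (z∈A , z∈S)) , (λ z≡y → contradiction (subst (_∈ S) z≡y z∈S) y∉S) ]′ (∈-swap⁻ A k)

      keep : ∀ {y} → (A ∩ T′) - x ⊆ swap A x y ∩ T′
      keep h = let z∈A , z∈T = x∈p∩q⁻ A T′ (p─q⊆p (A ∩ T′) ⁅ x ⁆ h) in
        x∈p∩q⁺ (∈-swapˡ z∈A (x∉⁅y⁆⇒x≢y (x∉p─q {p = A ∩ T′} h)) , z∈T)

      grow : ∀ {y} → swap A x y ∩ S ⊆ ((A ∩ S) - x) ∪ ⁅ y ⁆
      grow {y} h = let k , z∈S = x∈p∩q⁻ (swap A x y) S h in
        [ (λ (z∈A , z≢x) → x∈p∪q⁺ (inj₁ (x∈p∧x≢y⇒x∈p-y (x∈p∩q⁺ (z∈A , z∈S)) z≢x)))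
        , ∈-≡ (y∈A∪y ((A ∩ S) - x)) ]′ (∈-swap⁻ A k)

      fewer : ∣ (A ∩ S) - x ∣ + ∣ B ∩ T′ ∣ < ∣ A ∣ → ∣ (A ∩ S) - x ∣ < ∣ B ∩ S ∣
      fewer lt = ℕ.+-cancelʳ-< ∣ B ∩ T′ ∣ _ _
        (subst (∣ (A ∩ S) - x ∣ + ∣ B ∩ T′ ∣ <_) (trans cA (trans (sym cB) (split B⊆))) lt)

      -- No element of B ∖ A lies in T.
      fromS : Spanning N ((A ∩ T′) - x) → ∣ (A ∩ S) - x ∣ + ∣ B ∩ T′ ∣ < ∣ A ∣ → Goal
      fromS s lt =
        let y , y∈ , y∉ , i = M.augment (Ind-⊆ (p─q⊆p (A ∩ S) ⁅ x ⁆) iA) iB (fewer lt)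
            y∈B , y∈S = x∈p∩q⁻ B S y∈
            y∉A = λ y∈A → y∉ (x∈p∧x≢y⇒x∈p-y (x∈p∩q⁺ (y∈A , y∈S)) (≢-by x∉B y∈B))
        in finish y∈B y∉A (Ind-⊆ grow i) (Span-⊆ keep s)

      -- The part of A in T can lose x and still span.
      loose : Spanning N ((A ∩ T′) - x) → Goal
      loose s with any? (λ y → (y ∈? (B ∩ T′)) ×-dec ¬? (y ∈? A))
      ... | yes (y , y∈ , y∉A) = let y∈B , y∈T = x∈p∩q⁻ B T′ y∈ in
        finish y∈B y∉A (Ind-⊆ (shrink (S∌ y∈T)) iA) (Span-⊆ keep s)
      ... | no none = fromS s lt
        where
        BT⊆AT : B ∩ T′ ⊆ A ∩ T′
        BT⊆AT {y} h = x∈p∩q⁺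
          ( decidable-stable (y ∈? A) (λ y∉A → none (y , h , y∉A))
          , proj₂ (x∈p∩q⁻ B T′ h))
        lt : ∣ (A ∩ S) - x ∣ + ∣ B ∩ T′ ∣ < ∣ A ∣
        lt with x∈p∪q⁻ S T′ (A⊆ x∈A)
        ... | inj₁ x∈S = subst (∣ (A ∩ S) - x ∣ + ∣ B ∩ T′ ∣ <_) (sym (split A⊆))
          (ℕ.+-mono-<-≤ (x∈p⇒∣p-x∣<∣p∣ (x∈p∩q⁺ (x∈A , x∈S))) (p⊆q⇒∣p∣≤∣q∣ BT⊆AT))
        ... | inj₂ x∈T = subst (∣ (A ∩ S) - x ∣ + ∣ B ∩ T′ ∣ <_) (sym (split A⊆))
          (ℕ.+-mono-≤-< (∣p─q∣≤∣p∣ (A ∩ S) ⁅ x ⁆)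
            (p⊂q⇒∣p∣<∣q∣ (BT⊆AT , x , x∈p∩q⁺ (x∈A , x∈T) , x∉B ∘ proj₁ ∘ x∈p∩q⁻ B T′)))

      main : Goal
      main with N.span-exchange sA sB (x∉B ∘ proj₁ ∘ x∈p∩q⁻ B T′)
      ... | inj₁ s = loose s
      ... | inj₂ (y , y∈ , y∉ , s) =
        let y∈B , y∈T = x∈p∩q⁻ B T′ y∈
            y∉A = λ y∈A → y∉ (x∈p∩q⁺ (y∈A , y∈T))
        in finish y∈B y∉A (Ind-⊆ (shrink (S∌ y∈T)) iA)
             (Span-⊆ (λ h → [ keep , (λ k → subst (_∈ swap A x y ∩ T′) (sym (x∈⁅y⁆⇒x≡y y k))
                                (x∈p∩q⁺ (∈-swapʳ A , y∈T))) ]′ (x∈p∪q⁻ ((A ∩ T′) - x) ⁅ y ⁆ h)) s)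

    freeProduct : Matroid n
    freeProduct = record
      { ground    = ground M ∪ ground N
      ; Basis     = FreeBasis
      ; Basis?    = λ B → (B ⊆? (ground M ∪ ground N)) ×-dec (∣ B ∣ ℕ.≟ ρ M + ρ N) ×-dec
                          Matroid.Indep? M (B ∩ ground M) ×-dec Matroid.Spanning? N (B ∩ ground N)
      ; isMatroid = record
        { basis⊆   = λ _ → proj₁
        ; nonempty = free-nonempty
        ; exchange = free-exchange
        }
      }

infixr 7 _□_

-- The free product is defined only for disjoint ground sets; the value given
-- to M □ N otherwise is arbitrary.
_□_ : Matroid n → Matroid n → Matroid n
M □ N with nonempty? (ground M ∩ ground N)
... | no  disjoint = freeProduct M N disjoint
... | yes _        = M

□-cong : {M M′ N N′ : Matroid n} → M ≋ M′ → N ≋ N′ → M □ N ≋ M′ □ N′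
□-cong {M = M} {M′} {N} {N′} (eqM , bM) (eqN , bN)
  with nonempty? (ground M ∩ ground N) | nonempty? (ground M′ ∩ ground N′)
... | yes _ | yes _  = eqM , bM
... | yes p | no  ¬p = ⊥-elim (¬p (subst Nonempty (cong₂ _∩_ eqM eqN) p))
... | no ¬p | yes p  = ⊥-elim (¬p (subst Nonempty (sym (cong₂ _∩_ eqM eqN)) p))
... | no _  | no _   = cong₂ _∪_ eqM eqN , λ B → mk⇔
  (go M M′ N N′ eqM eqN (Equivalence.to ∘ bM) (Equivalence.to ∘ bN) B)
  (go M′ M N′ N (sym eqM) (sym eqN) (Equivalence.from ∘ bM) (Equivalence.from ∘ bN) B)
  where
  go : ∀ (M M′ N N′ : Matroid _) → ground M ≡ ground M′ → ground N ≡ ground N′ →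
       (∀ B → Basis M B → Basis M′ B) → (∀ B → Basis N B → Basis N′ B) →
       ∀ B → FreeBasis M N B → FreeBasis M′ N′ B
  go M M′ N N′ eqM eqN bM bN B (B⊆ , c , (I , bI , I⊇) , (X , bX , X⊆)) =
    subst (B ⊆_) (cong₂ _∪_ eqM eqN) B⊆ ,
    trans c (cong₂ _+_ (equicardinal M′ (bM _ (proj₂ (Matroid.nonempty M))))
                       (equicardinal N′ (bN _ (proj₂ (Matroid.nonempty N))))) ,
    (I , bM I bI , subst (λ S → B ∩ S ⊆ I) eqM I⊇) ,
    (X , bN X bX , subst (λ S → X ⊆ B ∩ S) eqN X⊆)

-- The free product is associative up to ≋, so the bracketing is immaterial.
□-product : List (Matroid n) → Matroid n
□-product []           = ∅
□-product (M ∷ [])     = M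
□-product (M ∷ N ∷ Ms) = M □ □-product (N ∷ Ms)

subsets : ∀ n → List (Subset n)
subsets zero    = [] ∷ []
subsets (suc n) = cartesianProductWith _∷_ (outside ∷ inside ∷ []) (subsets n)

subsets-complete : ∀ {n} (p : Subset n) → Any (p ≡_) (subsets n)
subsets-complete []            = here refl
subsets-complete (outside ∷ p) =
  Any.cartesianProductWith⁺ _∷_ (cong₂ _∷_) (here {xs = inside ∷ []} refl) (subsets-complete p)
subsets-complete (inside ∷ p)  =
  Any.cartesianProductWith⁺ _∷_ (cong₂ _∷_) (there (here {xs = []} refl)) (subsets-complete p)

Family : ℕ → Set
Family n = Subset n → Bool

caseFamily : Family n → Family n → Family (suc n)
caseFamily F G (outside ∷ p) = F p
caseFamily F G (inside ∷ p)  = G p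

families : ∀ n → List (Family n)
families zero    = (λ _ → false) ∷ (λ _ → true) ∷ []
families (suc n) = cartesianProductWith caseFamily (families n) (families n)

families-complete : ∀ {n} (F : Family n) → Any (λ G → ∀ p → F p ≡ G p) (families n)
families-complete {zero} F with F [] in eq
... | false = here λ { [] → eq }
... | true  = there (here λ { [] → eq })
families-complete {suc n} F = Any.cartesianProductWith⁺ caseFamily
  (λ { f g (outside ∷ p) → f p ; f g (inside ∷ p) → g p })
  (families-complete (F ∘ (outside ∷_))) (families-complete (F ∘ (inside ∷_)))

isMatroid? : ∀ {n} (S : Subset n) {P : Pred (Subset n) 0ℓ} → Decidable P → Dec (IsMatroid S P)
isMatroid? S P? = map′
  (λ (a , b , c) → record { basis⊆ = a ; nonempty = b ; exchange = c })
  (λ m → IsMatroid.basis⊆ m , IsMatroid.nonempty m , IsMatroid.exchange m)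
  ( allSubset? (λ B → P? B →-dec (B ⊆? S)) ×-dec anySubset? P? ×-dec
    allSubset? (λ A → allSubset? λ B → P? A →-dec P? B →-dec
      all? λ x → (x ∈? A) →-dec ¬? (x ∈? B) →-dec
      any? λ y → (y ∈? B) ×-dec ¬? (y ∈? A) ×-dec P? (swap A x y)))

matroidOf : Subset n × Family n → Maybe (Matroid n)
matroidOf (S , F) with isMatroid? S (λ p → Bool.T? (F p))
... | yes m = just record { ground = S ; Basis = T ∘ F ; Basis? = λ p → Bool.T? (F p) ; isMatroid = m }
... | no  _ = nothing

-- The matroids with ground set contained in Fin n, each exactly once up to ≋.
matroids : ∀ n → List (Matroid n)
matroids n = mapMaybe matroidOf (cartesianProduct (subsets n) (families n))

matroids-complete : ∀ {n} (M : Matroid n) → Any (M ≋_) (matroids n)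
matroids-complete {n} M = Any.mapMaybe⁺ matroidOf _ (Any.map⁺ (Any.map found
  (Any.cartesianProduct⁺ (subsets-complete (ground M)) (families-complete (isYes ∘ Basis? M)))))
  where
  basis⇒T : ∀ {F : Family n} → (∀ p → isYes (Basis? M p) ≡ F p) → ∀ B → Basis M B → T (F B)
  basis⇒T h B b = subst T (h B) (fromWitness {a? = Basis? M B} b)

  T⇒basis : ∀ {F : Family n} → (∀ p → isYes (Basis? M p) ≡ F p) → ∀ B → T (F B) → Basis M B
  T⇒basis h B t = toWitness {a? = Basis? M B} (subst T (sym (h B)) t)

  found : ∀ {SF : Subset n × Family n} →
          ground M ≡ proj₁ SF × (∀ p → isYes (Basis? M p) ≡ proj₂ SF p) →
          MAny.Any (M ≋_) (matroidOf SF)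
  found {S , F} (eq , h) with isMatroid? S (λ p → Bool.T? (F p))
  ... | yes _ = MAny.just (eq , λ B → mk⇔ (basis⇒T {F} h B) (T⇒basis {F} h B))
  ... | no ¬m = ⊥-elim (¬m record
    { basis⊆   = λ B t → subst (B ⊆_) eq (Matroid.basis⊆ M B (T⇒basis {F} h B t))
    ; nonempty = proj₁ (Matroid.nonempty M) , basis⇒T {F} h _ (proj₂ (Matroid.nonempty M))
    ; exchange = λ A B a b x x∈A x∉B →
        let y , y∈B , y∉A , c = Matroid.exchange M A B (T⇒basis {F} h A a) (T⇒basis {F} h B b) x x∈A x∉B
        in y , y∈B , y∉A , basis⇒T {F} h _ c
    })

_≋?_ : Decidable₂ (_≋_ {n})
M ≋? N = Vec.≡-dec Bool._≟_ _ _ ×-dec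
  map′ (λ h B → mk⇔ (proj₁ (h B)) (proj₂ (h B))) (λ h B → Equivalence.to (h B) , Equivalence.from (h B))
    (allSubset? λ B → (Basis? M B →-dec Basis? N B) ×-dec (Basis? N B →-dec Basis? M B))

_≤ʷ?_ : Decidable₂ (_≤ʷ_ {n})
M ≤ʷ? N = Vec.≡-dec Bool._≟_ _ _ ×-dec allSubset? λ B → Basis? M B →-dec Basis? N B

≋-sym : {M N : Matroid n} → M ≋ N → N ≋ M
≋-sym (e , b) = sym e , λ B → mk⇔ (Equivalence.from (b B)) (Equivalence.to (b B))

≋-trans : {L M N : Matroid n} → L ≋ M → M ≋ N → L ≋ N
≋-trans (e , b) (e′ , b′) = trans e e′ , λ B →
  mk⇔ (Equivalence.to (b′ B) ∘ Equivalence.to (b B)) (Equivalence.from (b B) ∘ Equivalence.from (b′ B))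

≤ʷ-isDecPartialOrder : ∀ n → IsDecPartialOrder (_≋_ {n}) _≤ʷ_
≤ʷ-isDecPartialOrder n = record
  { isPartialOrder = record
    { isPreorder = record
      { isEquivalence = record
        { refl  = refl , λ _ → mk⇔ id id
        ; sym   = λ {M} {N} → ≋-sym {M = M} {N}
        ; trans = λ {L} {M} {N} → ≋-trans {L = L} {M} {N}
        }
      ; reflexive = λ (e , b) → e , λ B → Equivalence.to (b B)
      ; trans     = λ (e , b) (e′ , b′) → trans e e′ , λ B → b′ B ∘ b B
      }
    ; antisym = λ (e , b) (_ , b′) → e , λ B → mk⇔ (b B) (b′ B)
    }
  ; _≟_  = _≋?_
  ; _≤?_ = _≤ʷ?_
  }

ProperFreeProduct : Matroid n → Set₁
ProperFreeProduct {n} M = ∃₂ λ (P Q : Matroid n) →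
  Nonempty (ground P) × Nonempty (ground Q) × Disjoint (ground P) (ground Q) × M ≋ P □ Q

Irreducible : Matroid n → Set₁
Irreducible M = Nonempty (ground M) × ¬ ProperFreeProduct M

Reducible : Matroid n → Set₁
Reducible M = ¬ Irreducible M

properFreeProduct? : Decidable (ProperFreeProduct {n})
properFreeProduct? {n} M = map′
  (λ h → let P , h′ = Any.satisfied h ; Q , h″ = Any.satisfied h′ in P , Q , h″)
  (λ (P , Q , p , q , d , e) →
    Any.map (λ {P′} P≋P′ → Any.map (λ {Q′} Q≋Q′ →
        subst Nonempty (proj₁ P≋P′) p , subst Nonempty (proj₁ Q≋Q′) q ,
        subst Empty (cong₂ _∩_ (proj₁ P≋P′) (proj₁ Q≋Q′)) d ,
        ≋-trans {L = M} {P □ Q} {P′ □ Q′} e (□-cong {M = P} {P′} {Q} {Q′} P≋P′ Q≋Q′))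
      (matroids-complete Q)) (matroids-complete P))
  (Any.any? (λ P → Any.any? (λ Q → nonempty? (ground P) ×-dec nonempty? (ground Q) ×-dec
    ¬? (nonempty? (ground P ∩ ground Q)) ×-dec (M ≋? (P □ Q))) (matroids n)) (matroids n))

irreducible? : Decidable (Irreducible {n})
irreducible? M = nonempty? (ground M) ×-dec ¬? (properFreeProduct? M)

reducible? : Decidable (Reducible {n})
reducible? M = ¬? (irreducible? M)

-- The list is (S₀ , … , Sₖ).
IsIrreducibleChain : Matroid n → List (Subset n) → Set₁
IsIrreducibleChain M D =
  List.head D ≡ just ⊥ × List.last D ≡ just (ground M) ×
  Linked (λ A B → A ⊂ B × Irreducible (minor M A B)) D

isIrreducibleChain? : (M : Matroid n) → Decidable (IsIrreducibleChain M)
isIrreducibleChain? M D =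
  Maybe.≡-dec (Vec.≡-dec Bool._≟_) _ _ ×-dec Maybe.≡-dec (Vec.≡-dec Bool._≟_) _ _ ×-dec
  linked? (λ A B → (A ⊂? B) ×-dec irreducible? (minor M A B)) D

sequences : ∀ {a} {A : Set a} → ℕ → List A → List (List A)
sequences zero    xs = [] ∷ []
sequences (suc k) xs = [] ∷ cartesianProductWith _∷_ xs (sequences k xs)

-- A strictly increasing sequence of subsets of Fin n has length at most 1 + n.
IC : Matroid n → List (List (Subset n))
IC {n} M = filter (isIrreducibleChain? M) (sequences (suc n) (subsets n))

minors : Matroid n → List (Subset n) → List (Matroid n)
minors M []          = []
minors M (A ∷ [])    = []
minors M (A ∷ B ∷ D) = minor M A B ∷ minors M (B ∷ D)

chainProduct : Matroid n → List (Subset n) → Matroid n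
chainProduct M D = □-product (minors M D)

module Möbius {m : ℕ} {_≈_ _≤_ : Rel (Fin m) 0ℓ} (isDPO : IsDecPartialOrder _≈_ _≤_) where
  open IsDecPartialOrder isDPO using (_≟_; _≤?_; isPartialOrder)
  open ToStrict _≈_ _≤_ using () renaming (_<_ to _≺_; <-decidable to ≺-decidable)

  _≺?_ : Decidable₂ _≺_
  _≺?_ = ≺-decidable _≟_ _≤?_

  μ-acc : Fin m → ∀ {z} → Acc _≺_ z → ℤ
  μ-acc x {z} (acc below) with x ≟ z
  ... | yes _ = 1ℤ
  ... | no  _ = ℤ.- sum term
    where
    term : Fin m → ℤ
    term y with x ≤? y | y ≺? z
    ... | yes _ | yes y≺z = μ-acc x (below y≺z)
    ... | _     | _       = 0ℤ

  μ : Fin m → Fin m → ℤ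
  μ x z = μ-acc x (spo-wellFounded (ToStrict.<-isStrictPartialOrder _≈_ _≤_ isPartialOrder) z)

above? : (M : Matroid n) → Decidable (λ N → M ≤ʷ N × Reducible N × ¬ M ≋ N)
above? M N = (M ≤ʷ? N) ×-dec reducible? N ×-dec ¬? (M ≋? N)

-- M itself comes first, at index zero; the other entries are pairwise
-- distinct with respect to ≋.
𝓡 : Matroid n → List (Matroid n)
𝓡 {n} M = M ∷ filter (above? M) (matroids n)

module 𝓡-Möbius {n : ℕ} (M : Matroid n) =
  Möbius (On.isDecPartialOrder (lookup (𝓡 M)) (≤ʷ-isDecPartialOrder n))

μ𝓡 : (M : Matroid n) → Fin (length (𝓡 M)) → ℤ
μ𝓡 M = 𝓡-Möbius.μ M zero

-- The field basis⇔ says that the bijection carries bases to bases: its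
-- hypothesis expresses that C is the image of B.
record _≅_ {m n : ℕ} (M : Matroid m) (N : Matroid n) : Set where
  field
    bijection : (∃ λ x → x ∈ ground M) ↔ (∃ λ y → y ∈ ground N)
    basis⇔    : ∀ B C → B ⊆ ground M → C ⊆ ground N →
                (∀ x → proj₁ x ∈ B ⇔ proj₁ (Inverse.to bijection x) ∈ C) →
                Basis M B ⇔ Basis N C

𝓦 : Set₁
𝓦 = ∃ Matroid

module _ {c ℓ₁ ℓ₂} (K : HeytingField c ℓ₁ ℓ₂) where
  open HeytingField K using (Carrier; _≈_; 0#; 1#; heytingCommutativeRing)
    renaming (_+_ to _+ᴷ_; -_ to -ᴷ_)
  open HeytingCommutativeRing heytingCommutativeRing using (commutativeRing)
  open import Algebra.Definitions.RawMonoid (CommutativeRing.+-rawMonoid commutativeRing)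
    using () renaming (_×_ to _·_)

  CharacteristicZero : Set ℓ₁
  CharacteristicZero = ∀ k → ¬ (suc k · 1#) ≈ 0#

  fromℤ : ℤ → Carrier
  fromℤ (ℤ.+ k)    = k · 1#
  fromℤ ℤ.-[1+ k ] = -ᴷ (suc k · 1#)

  H : Set (Level.suc 0ℓ ⊔ c)
  H = List (Carrier × 𝓦)

  infix 4 _≈ᴴ_

  -- Equality in the vector space with basis the isomorphism classes.
  data _≈ᴴ_ : H → H → Set (Level.suc 0ℓ ⊔ c ⊔ ℓ₁) where
    ≈-refl  : ∀ {x} → x ≈ᴴ x
    ≈-sym   : ∀ {x y} → x ≈ᴴ y → y ≈ᴴ x
    ≈-trans : ∀ {x y z} → x ≈ᴴ y → y ≈ᴴ z → x ≈ᴴ z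
    ≈-cons  : ∀ {a b m n x y} {M : Matroid m} {N : Matroid n} → a ≈ b → M ≅ N → x ≈ᴴ y →
              (a , m , M) ∷ x ≈ᴴ (b , n , N) ∷ y
    ≈-swap  : ∀ s t x → s ∷ t ∷ x ≈ᴴ t ∷ s ∷ x
    ≈-merge : ∀ a b M x → (a , M) ∷ (b , M) ∷ x ≈ᴴ (a +ᴷ b , M) ∷ x
    ≈-zero  : ∀ M x → (0# , M) ∷ x ≈ᴴ x

  e : Matroid n → H
  e {n} M = (1# , n , M) ∷ []

  φ : H → H
  φ = concatMap λ (a , n , M) → List.map (λ D → a , n , chainProduct M D) (IC M)

  -- x = φ⁻¹(y): x is the one and only preimage of y.
  _IsPreimageOf_ : H → H → Set (Level.suc 0ℓ ⊔ c ⊔ ℓ₁)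
  x IsPreimageOf y = φ x ≈ᴴ y × (∀ x′ → φ x′ ≈ᴴ y → x′ ≈ᴴ x)

  -- p_M = φ⁻¹(e_M), as a relation: x is a formal sum representing p_M.
  Is-p : Matroid n → H → Set (Level.suc 0ℓ ⊔ c ⊔ ℓ₁)
  Is-p M x = x IsPreimageOf e M

  möbiusSum : Matroid n → H
  möbiusSum {n} M = tabulate λ i → fromℤ (μ𝓡 M i) , n , lookup (𝓡 M) i

{-# OPTIONS --safe #-}

-- For a chain D = (S₀ , … , Sₖ), X is a basis of M(D) exactly when |X| = ρ(M) and
-- ρ(M) ≤ r(Sᵢ₋₁ ∪ (X ∩ Sᵢ)) + |X ∖ Sᵢ| for all i, with r the rank function of M.
-- Hence M ↦ M(D) is monotone, extensive and idempotent in the weak order, and it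
-- preserves the minors M(Sᵢ₋₁ , Sᵢ); so whether D is an irreducible chain depends on
-- M(D) only.  Expand φ of the Möbius sum and collect the terms by chains D.  The chain
-- (∅ , S) contributes e_M, as M is the only irreducible element of 𝓡_M.  Every longer
-- chain contributes zero: M is irreducible, hence not closed under N ↦ N(D), and by
-- Rota's closure lemma the values μ(M , N) with N(D) = L sum to zero for each L.
--
-- For uniqueness, φ is triangular with respect to the number of bases, because
-- M ≤ M(D), and its diagonal entries are positive integers, because a maximal chain of
-- free separators D is an irreducible chain with M(D) = M.  Characteristic zero and
-- tightness of the apartness relation allow these integers to be cancelled.

module Submission where

open import Defs
open import Algebra.Apartness.Bundles using (HeytingField; HeytingCommutativeRing)
open import Algebra.Bundles using (CommutativeRing)
import Algebra.Properties.CommutativeMonoid.Sum as CommutativeMonoidSum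
import Algebra.Properties.Ring as Ring
import Algebra.Properties.Semiring.Mult as Mult
open import Data.Bool.Base using (Bool; true; false; _∧_; _∨_; not) renaming (T to True)
import Data.Bool.Properties as Bool
open import Data.Empty using (⊥-elim)
open import Data.Fin.Base using (Fin; zero; suc; finToFun; funToFin)
open import Data.Fin.Induction using (spo-wellFounded)
open import Data.Fin.Properties as Fin using (all?; any?; finToFun-funToFin)
open import Data.Fin.Subset
  using (Subset; ⊥; ⁅_⁆; _∈_; _∉_; _⊆_; _⊂_; _∩_; _∪_; _─_; _-_; ∣_∣; Nonempty; inside; outside)
open import Data.Fin.Subset.Induction using (⊂-wellFounded; ⊃-wellFounded)
open import Data.Fin.Subset.Properties
open import Data.Integer.Base as ℤ using (ℤ; 0ℤ; 1ℤ)
import Data.Integer.Properties as ℤ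
open import Data.List.Base as List using (List; []; _∷_; cartesianProductWith)
open import Data.List.Membership.Propositional using (find) renaming (_∈_ to _∈ˡ_)
open import Data.List.Membership.Propositional.Properties
  using (∈-cartesianProductWith⁺; ∈-cartesianProductWith⁻; ∈-filter⁺; ∈-filter⁻; ∈-lookup; ∈-map⁺; ∈-map⁻)
open import Data.List.Membership.Propositional.Properties.WithK using (unique∧set⇒bag)
import Data.List.Properties as List
open import Data.List.Relation.Binary.BagAndSetEquality using (∼bag⇒↭)
open import Data.List.Relation.Binary.Permutation.Propositional as Perm using (_↭_)
import Data.List.Relation.Binary.Permutation.Propositional.Properties as Perm
open import Data.List.Relation.Unary.All as All using (All; []; _∷_)
import Data.List.Relation.Unary.All.Properties as All
open import Data.List.Relation.Unary.AllPairs as AllPairs using (AllPairs; []; _∷_)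
import Data.List.Relation.Unary.AllPairs.Properties as AllPairs
open import Data.List.Relation.Unary.Any as Any using (here; there)
import Data.List.Relation.Unary.Any.Properties as Any
open import Data.List.Relation.Unary.Linked as Linked using (Linked; []; [-]; _∷_)
import Data.List.Relation.Unary.Linked.Properties as Linked
open import Data.List.Relation.Unary.Unique.Propositional using (Unique)
import Data.List.Relation.Unary.Unique.Propositional.Properties as Unique
import Data.List.Relation.Unary.Unique.Setoid.Properties as UniqueSetoid
open import Data.Maybe.Base using (Maybe; just; nothing; maybe′; _>>=_)
import Data.Maybe.Properties as Maybe
open import Data.Nat.Base as ℕ using (ℕ; zero; suc; _+_; _≤_; z≤n; s≤s)
import Data.Nat.Properties as ℕ
open import Data.Product.Base using (∃; _×_; _,_; proj₁; proj₂)
open import Data.Sum.Base as Sum using (_⊎_; inj₁; inj₂; [_,_]′)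
open import Data.Unit.Base using (tt)
open import Data.Vec.Base as Vec using (Vec; []; _∷_)
import Data.Vec.Properties as Vec
open import Data.Vec.Properties.WithK using ([]=-irrelevant)
open import Function.Base using (_∘_; id)
open import Function.Bundles using (_⇔_; mk⇔; Equivalence; Inverse; mk↔ₛ′)
open import Induction.WellFounded using (Acc; acc)
open import Level using (0ℓ)
import Relation.Binary.Construct.NonStrictToStrict as ToStrict
import Relation.Binary.Construct.On as On
open import Relation.Binary.Core using (Rel)
open import Relation.Binary.PropositionalEquality as ≡
  using (_≡_; refl; sym; trans; cong; cong₂; subst; subst₂; module ≡-Reasoning)
open import Relation.Binary.Structures using (IsDecPartialOrder)
open import Relation.Nullary using (¬_; Dec; yes; no; contradiction)
open import Relation.Nullary.Decidable using (_×-dec_; _⊎-dec_; _→-dec_; ¬?; map′; decidable-stable)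
open import Relation.Unary using (Pred; Decidable)
open import Relation.Unary.Properties using (∁?)
open import Algebra.Properties.CommutativeMonoid.Sum ℤ.+-0-commutativeMonoid
  using (sum; sum-cong-≗; ∑-distrib-+; ∑-comm; sum-replicate-zero)

-- For fixed D the expansion of φ sums μ(M , N) only over those N in 𝓡_M that have D as an
-- irreducible chain, and Rota's lemma says nothing about sums over an arbitrary part of a poset.
-- This is why N ↦ N(D) is studied for every increasing chain D from ∅ to S, whether or not its
-- minors are irreducible: it is then a closure operator on all of 𝓡_M, and the N that count form a
-- union of its fibres. It stays inside 𝓡_M, since N(D) is a free product of nonempty matroids once
-- D has three or more sets. The rank inequalities come from one fact, iterated along D: with U the
-- ground set of Q, a set X spans P □ Q exactly when X spans Q and ρ(P) + ρ(Q) ≤ r_P(X) + |X ∩ U|.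
-- Each factor yields one inequality. Formal sums are compared by a generated relation, so the
-- independence of distinct classes is not given beforehand. Coefficients are read off by a
-- functional that tests for isomorphism, which is why isomorphism has to be decided.

private
  variable
    k m n : ℕ

-- Boolean combinations of finite sets

infixr 7 _⊓_
infixr 6 _⊔_
infixl 5 _∖_
infix  4 _⊑_ _≐_
infixr 3 _⇒_
infix  3 ⊢_

data Term (k : ℕ) : Set where
  var         : Fin k → Term k
  ∅ᵗ          : Term k
  _⊔_ _⊓_ _∖_ : Term k → Term k → Term k

data Formula (k : ℕ) : Set where
  _⊑_ _≐_ : Term k → Term k → Formula k

data Sequent (k : ℕ) : Set where
  ⊢_  : Formula k → Sequent k
  _⇒_ : Formula k → Sequent k → Sequent k

evalᵗ : Term k → Vec Bool k → Bool
evalᵗ (var i) b = Vec.lookup b i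
evalᵗ ∅ᵗ      b = false
evalᵗ (s ⊔ t) b = evalᵗ s b ∨ evalᵗ t b
evalᵗ (s ⊓ t) b = evalᵗ s b ∧ evalᵗ t b
evalᵗ (s ∖ t) b = evalᵗ s b ∧ not (evalᵗ t b)

implies : Bool → Bool → Bool
implies a b = not a ∨ b

evalᶠ : Formula k → Vec Bool k → Bool
evalᶠ (s ⊑ t) b = implies (evalᵗ s b) (evalᵗ t b)
evalᶠ (s ≐ t) b = implies (evalᵗ s b) (evalᵗ t b) ∧ implies (evalᵗ t b) (evalᵗ s b)

evalˢ : Sequent k → Vec Bool k → Bool
evalˢ (⊢ φ)   b = evalᶠ φ b
evalˢ (φ ⇒ s) b = implies (evalᶠ φ b) (evalˢ s b)

allBits : ∀ k → (Vec Bool k → Bool) → Bool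
allBits zero    f = f []
allBits (suc k) f = allBits k (f ∘ (true ∷_)) ∧ allBits k (f ∘ (false ∷_))

∧-elim : ∀ a {b} → True (a ∧ b) → True a × True b
∧-elim true t = tt , t

allBits-sound : ∀ k f → True (allBits k f) → ∀ b → True (f b)
allBits-sound zero    f t []          = t
allBits-sound (suc k) f t (true ∷ b)  = allBits-sound k _ (proj₁ (∧-elim (allBits k (f ∘ (true ∷_))) t)) b
allBits-sound (suc k) f t (false ∷ b) = allBits-sound k _ (proj₂ (∧-elim (allBits k (f ∘ (true ∷_))) t)) b

⟦_⟧ᵗ : Term k → Vec (Subset n) k → Subset n
⟦ var i ⟧ᵗ ps = Vec.lookup ps i
⟦ ∅ᵗ ⟧ᵗ    ps = ⊥
⟦ s ⊔ t ⟧ᵗ ps = ⟦ s ⟧ᵗ ps ∪ ⟦ t ⟧ᵗ ps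
⟦ s ⊓ t ⟧ᵗ ps = ⟦ s ⟧ᵗ ps ∩ ⟦ t ⟧ᵗ ps
⟦ s ∖ t ⟧ᵗ ps = ⟦ s ⟧ᵗ ps ─ ⟦ t ⟧ᵗ ps

⟦_⟧ᶠ : Formula k → Vec (Subset n) k → Set
⟦ s ⊑ t ⟧ᶠ ps = ⟦ s ⟧ᵗ ps ⊆ ⟦ t ⟧ᵗ ps
⟦ s ≐ t ⟧ᶠ ps = ⟦ s ⟧ᵗ ps ≡ ⟦ t ⟧ᵗ ps

⟦_⟧ˢ : Sequent k → Vec (Subset n) k → Set
⟦ ⊢ φ ⟧ˢ   ps = ⟦ φ ⟧ᶠ ps
⟦ φ ⇒ s ⟧ˢ ps = ⟦ φ ⟧ᶠ ps → ⟦ s ⟧ˢ ps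

bits : Vec (Subset n) k → Fin n → Vec Bool k
bits ps x = Vec.map (λ p → Vec.lookup p x) ps

lookup-─ : ∀ (p q : Subset n) x → Vec.lookup (p ─ q) x ≡ Vec.lookup p x ∧ not (Vec.lookup q x)
lookup-─ (true ∷ p)  (true ∷ q)  zero    = refl
lookup-─ (false ∷ p) (true ∷ q)  zero    = refl
lookup-─ (true ∷ p)  (false ∷ q) zero    = refl
lookup-─ (false ∷ p) (false ∷ q) zero    = refl
lookup-─ (_ ∷ p)     (true ∷ q)  (suc x) = lookup-─ p q x
lookup-─ (_ ∷ p)     (false ∷ q) (suc x) = lookup-─ p q x

lookup-⟦⟧ : ∀ (t : Term k) (ps : Vec (Subset n) k) x → Vec.lookup (⟦ t ⟧ᵗ ps) x ≡ evalᵗ t (bits ps x)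
lookup-⟦⟧ (var i) ps x = sym (Vec.lookup-map i _ ps)
lookup-⟦⟧ ∅ᵗ      ps x = Vec.lookup-replicate x outside
lookup-⟦⟧ (s ⊔ t) ps x = trans (Vec.lookup-zipWith _∨_ x (⟦ s ⟧ᵗ ps) (⟦ t ⟧ᵗ ps)) (cong₂ _∨_ (lookup-⟦⟧ s ps x) (lookup-⟦⟧ t ps x))
lookup-⟦⟧ (s ⊓ t) ps x = trans (Vec.lookup-zipWith _∧_ x (⟦ s ⟧ᵗ ps) (⟦ t ⟧ᵗ ps)) (cong₂ _∧_ (lookup-⟦⟧ s ps x) (lookup-⟦⟧ t ps x))
lookup-⟦⟧ (s ∖ t) ps x = trans (lookup-─ (⟦ s ⟧ᵗ ps) (⟦ t ⟧ᵗ ps) x)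
  (cong₂ (λ a b → a ∧ not b) (lookup-⟦⟧ s ps x) (lookup-⟦⟧ t ps x))

∈-⟦⟧ : ∀ (t : Term k) {ps : Vec (Subset n) k} {x} → x ∈ ⟦ t ⟧ᵗ ps → evalᵗ t (bits ps x) ≡ true
∈-⟦⟧ t h = trans (sym (lookup-⟦⟧ t _ _)) (Vec.[]=⇒lookup h)

⟦⟧-∈ : ∀ (t : Term k) {ps : Vec (Subset n) k} {x} → evalᵗ t (bits ps x) ≡ true → x ∈ ⟦ t ⟧ᵗ ps
⟦⟧-∈ t {x = x} h = Vec.lookup⇒[]= x _ (trans (lookup-⟦⟧ t _ x) h)

implies-intro : ∀ {a b} → (a ≡ true → b ≡ true) → True (implies a b)
implies-intro {true}  h = subst True (sym (h refl)) tt
implies-intro {false} h = tt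

implies-elim : ∀ {a b} → True (implies a b) → a ≡ true → b ≡ true
implies-elim {true} {true} _ refl = refl

∧-intro : ∀ {a b} → True a → True b → True (a ∧ b)
∧-intro {true} _ t = t

formula-at : ∀ (φ : Formula k) {ps : Vec (Subset n) k} → ⟦ φ ⟧ᶠ ps → ∀ x → True (evalᶠ φ (bits ps x))
formula-at (s ⊑ t) h x = implies-intro (∈-⟦⟧ t ∘ h ∘ ⟦⟧-∈ s)
formula-at (s ≐ t) h x = ∧-intro (implies-intro (∈-⟦⟧ t ∘ subst (x ∈_) h ∘ ⟦⟧-∈ s))
                                 (implies-intro (∈-⟦⟧ s ∘ subst (x ∈_) (sym h) ∘ ⟦⟧-∈ t))

formula-everywhere : ∀ (φ : Formula k) {ps : Vec (Subset n) k} → (∀ x → True (evalᶠ φ (bits ps x))) → ⟦ φ ⟧ᶠ ps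
formula-everywhere (s ⊑ t) h {x} = ⟦⟧-∈ t ∘ implies-elim (h x) ∘ ∈-⟦⟧ s
formula-everywhere (s ≐ t) h = ⊆-antisym
  (λ {x} → ⟦⟧-∈ t ∘ implies-elim (proj₁ (∧-elim _ (h x))) ∘ ∈-⟦⟧ s)
  (λ {x} → ⟦⟧-∈ s ∘ implies-elim (proj₂ (∧-elim (implies (evalᵗ s _) _) (h x))) ∘ ∈-⟦⟧ t)

-- Inclusions and equations of sets quantify over all points, so a sequent that holds at each single
-- point may use every premise at the very point where the conclusion is tested.
sequent-sound : ∀ (s : Sequent k) {ps : Vec (Subset n) k} → (∀ x → True (evalˢ s (bits ps x))) → ⟦ s ⟧ˢ ps
sequent-sound (⊢ φ)   h = formula-everywhere φ h
sequent-sound (φ ⇒ s) h p = sequent-sound s λ x → mp (h x) (formula-at φ p x)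
  where
  mp : ∀ {a b} → True (implies a b) → True a → True b
  mp {true} t _ = t

-- Allows a sequent to be written as a function of k named variables instead of with indices;
-- `tauto` applies it to `var` at all k indices.
Nary : ℕ → Set → Set → Set
Nary zero    A B = B
Nary (suc k) A B = A → Nary k A B

apply : ∀ (k : ℕ) {A B : Set} → Nary k A B → Vec A k → B
apply zero    f []       = f
apply (suc k) f (x ∷ xs) = apply k (f x) xs

Π : ∀ (k : ℕ) {A : Set} → (Vec A k → Set) → Set
Π zero    P = P []
Π (suc k) P = ∀ x → Π k (P ∘ (x ∷_))

curryΠ : ∀ (k : ℕ) {A : Set} {P : Vec A k → Set} → (∀ xs → P xs) → Π k P
curryΠ zero    f = f []
curryΠ (suc k) f x = curryΠ k (f ∘ (x ∷_))

-- Sequents between Boolean combinations of subsets, decided by truth tables.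
tauto : ∀ (k : ℕ) (s : Nary k (Term k) (Sequent k)) →
        let s′ = apply k {Term k} {Sequent k} s (Vec.tabulate var) in
        {True (allBits k (evalˢ s′))} → Π k {Subset n} ⟦ s′ ⟧ˢ
tauto k s {t} = curryΠ k λ ps → sequent-sound s′ λ x → allBits-sound k (evalˢ s′) t (bits ps x)
  where s′ = apply k {Term k} {Sequent k} s (Vec.tabulate var)


-- Cardinalities and the rank function

∣∣-mono : ∀ (p q : Subset n) → p ⊆ q → ∣ p ∣ ≤ ∣ q ∣
∣∣-mono p q = p⊆q⇒∣p∣≤∣q∣ {p = p} {q}

∣∣≤+ : ∀ (p q r : Subset n) → p ⊆ q ∪ r → ∣ p ∣ ≤ ∣ q ∣ + ∣ r ∣
∣∣≤+ p q r h = ℕ.≤-trans (ℕ.≤-reflexive (∣∣-split p q))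
  (ℕ.+-mono-≤ (∣∣-mono (p ∩ q) q (p∩q⊆q p q))
              (∣∣-mono (p ─ q) r (tauto 3 (λ p q r → p ⊑ q ⊔ r ⇒ ⊢ p ∖ q ⊑ r) p q r h)))

+≤∣∣ : ∀ (p q r : Subset n) → q ⊆ p → r ⊆ p → q ∩ r ⊆ ⊥ → ∣ q ∣ + ∣ r ∣ ≤ ∣ p ∣
+≤∣∣ p q r q⊆p r⊆p d = ℕ.≤-trans
  (ℕ.+-mono-≤ (∣∣-mono q (p ∩ q) (tauto 2 (λ p q → q ⊑ p ⇒ ⊢ q ⊑ p ⊓ q) p q q⊆p))
              (∣∣-mono r (p ─ q) (tauto 3 (λ p q r → r ⊑ p ⇒ q ⊓ r ⊑ ∅ᵗ ⇒ ⊢ r ⊑ p ∖ q) p q r r⊆p d)))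
  (ℕ.≤-reflexive (sym (∣∣-split p q)))

-- Elements of `q` are added one at a time, so no size on the way is skipped. In `□-spanning` this
-- pads a set to the size of a basis.
between : ∀ {p q : Subset n} m → p ⊆ q → ∣ p ∣ ≤ m → m ≤ ∣ q ∣ → ∃ λ s → p ⊆ s × s ⊆ q × ∣ s ∣ ≡ m
between {p = p} {q} m p⊆q = go p p⊆q (⊃-wellFounded p)
  where
  go : ∀ s → s ⊆ q → Acc (λ p q → q ⊂ p) s → ∣ s ∣ ≤ m → m ≤ ∣ q ∣ → ∃ λ t → s ⊆ t × t ⊆ q × ∣ t ∣ ≡ m
  go s s⊆q (acc rs) s≤m m≤q with ∣ s ∣ ℕ.≟ m
  ... | yes eq = s , id , s⊆q , eq
  ... | no  ne with any? (λ x → (x ∈? q) ×-dec ¬? (x ∈? s))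
  ...   | yes (x , x∈q , x∉s) =
    let t , s⊆t , t⊆q , eq = go (s ∪ ⁅ x ⁆) (λ h → [ s⊆q , ∈-≡ x∈q ]′ (∈-add⁻ h))
          (rs (p⊆p∪q _ , x , y∈A∪y s , x∉s))
          (ℕ.≤-trans (ℕ.≤-reflexive (∣add∣ x∉s)) (ℕ.≤∧≢⇒< s≤m ne)) m≤q
    in t , s⊆t ∘ p⊆p∪q _ , t⊆q , eq
  ...   | no none = contradiction (ℕ.≤-antisym s≤m (ℕ.≤-trans m≤q (∣∣-mono q s
            λ {x} x∈q → decidable-stable (x ∈? s) λ x∉s → none (x , x∈q , x∉s)))) ne

module _ (M : Matroid n) where
  open Matroid M using (basis⊆; nonempty; Indep?)
  open MatroidLemmas (isMatroid M)

  Indep-⊆ : ∀ {I J} → I ⊆ J → Indep M J → Indep M I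
  Indep-⊆ I⊆J (B , b , J⊆B) = B , b , J⊆B ∘ I⊆J

  Indep⊆ground : ∀ {I} → Indep M I → I ⊆ ground M
  Indep⊆ground (B , b , I⊆B) = basis⊆ B b ∘ I⊆B

  extend : ∀ {I X} → Indep M I → I ⊆ X → ∃ λ B → I ⊆ B × RestrictBasis M X B
  extend {I₀} {X} iI I⊆X = go I₀ iI I⊆X (⊃-wellFounded I₀)
    where
    go : ∀ I → Indep M I → I ⊆ X → Acc (λ p q → q ⊂ p) I → ∃ λ B → I ⊆ B × RestrictBasis M X B
    go I iI I⊆X (acc rs) with any? (λ y → (y ∈? X) ×-dec ¬? (y ∈? I) ×-dec Indep? (I ∪ ⁅ y ⁆))
    ... | yes (y , y∈X , y∉I , i) =
      let B , I∪y⊆B , b = go (I ∪ ⁅ y ⁆) i (λ h → [ I⊆X , ∈-≡ y∈X ]′ (∈-add⁻ h))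
                             (rs (p⊆p∪q _ , y , y∈A∪y I , y∉I))
      in B , I∪y⊆B ∘ p⊆p∪q _ , b
    ... | no none = I , id , iI , I⊆X , λ y y∈X y∉I i → none (y , y∈X , y∉I , i)

  indep-⊥ : Indep M ⊥
  indep-⊥ = let B , b = nonempty in B , b , λ h → contradiction h ∉⊥

  abstract
    -- Opaque, so that type checking never unfolds it to the search for a maximal independent set;
    -- outside this block only `restrictBasis-rank` is known of it. As `_↾_` accepts sets beyond the
    -- ground set, so does the rank.
    rank : Subset n → ℕ
    rank X = ρ (M ↾ X)

    restrictBasis-rank : ∀ {X B} → RestrictBasis M X B → ∣ B ∣ ≡ rank X
    restrictBasis-rank {X} = equicardinal (M ↾ X)

  rank-attained : ∀ X → ∃ λ I → Indep M I × I ⊆ X × ∣ I ∣ ≡ rank X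
  rank-attained X = let B , r@(i , B⊆X , _) = restrict-nonempty M X in B , i , B⊆X , restrictBasis-rank r

  indep≤rank : ∀ {I X} → Indep M I → I ⊆ X → ∣ I ∣ ≤ rank X
  indep≤rank {I} {X} i I⊆X = let B , r = restrict-nonempty M X in
    subst (∣ I ∣ ≤_) (restrictBasis-rank r) (restrict-card M X r i I⊆X)

  -- Only the part of X in the ground set matters.
  rank-mono : ∀ {X Y} → X ∩ ground M ⊆ Y → rank X ≤ rank Y
  rank-mono {X} {Y} h = let I , i , I⊆X , e = rank-attained X in
    subst (_≤ rank Y) e (indep≤rank i λ z → h (x∈p∩q⁺ (I⊆X z , Indep⊆ground i z)))

  rank-⊆ : ∀ {X Y} → X ⊆ Y → rank X ≤ rank Y
  rank-⊆ X⊆Y = rank-mono (X⊆Y ∘ p∩q⊆p _ _)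

  rank≤+ : ∀ {X Y Z} → Y ⊆ X ∪ Z → rank Y ≤ rank X + ∣ Z ∣
  rank≤+ {X} {Y} {Z} h = let I , i , I⊆Y , e = rank-attained Y in
    subst (_≤ rank X + ∣ Z ∣) e (ℕ.≤-trans (∣∣≤+ I (I ∩ X) Z
        (tauto 4 (λ i x y z → i ⊑ y ⇒ y ⊑ x ⊔ z ⇒ ⊢ i ⊑ (i ⊓ x) ⊔ z) I X Y Z I⊆Y h))
      (ℕ.+-monoˡ-≤ ∣ Z ∣ (indep≤rank (Indep-⊆ (p∩q⊆p I X) i) (p∩q⊆q I X))))

  rank≤∣∣ : ∀ X → rank X ≤ ∣ X ∣
  rank≤∣∣ X = let I , _ , I⊆X , e = rank-attained X in subst (_≤ ∣ X ∣) e (∣∣-mono I X I⊆X)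

  rank-indep : ∀ {I} → Indep M I → rank I ≡ ∣ I ∣
  rank-indep i = ℕ.≤-antisym (rank≤∣∣ _) (indep≤rank i id)

  rank≤ρ : ∀ X → rank X ≤ ρ M
  rank≤ρ X = let I , (B , b , I⊆B) , I⊆X , e = rank-attained X in
    subst (_≤ ρ M) e (ℕ.≤-trans (∣∣-mono I B I⊆B) (ℕ.≤-reflexive (equicardinal M b)))

  spanning⇒rank : ∀ {X} → Spanning M X → ρ M ≤ rank X
  spanning⇒rank {X} (B , b , B⊆X) = subst (_≤ rank X) (equicardinal M b) (indep≤rank (B , b , id) B⊆X)

  rank⇒spanning : ∀ {X} → ρ M ≤ rank X → Spanning M X
  rank⇒spanning {X} h = let I , i , I⊆X , e = rank-attained X in
    I , max-indep i (proj₂ nonempty) (subst (ρ M ≤_) (sym e) h) , I⊆X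

  rank-ground : ∀ {X} → ground M ⊆ X → rank X ≡ ρ M
  rank-ground {X} h = ℕ.≤-antisym (rank≤ρ X)
    (let B , b = nonempty in spanning⇒rank (B , b , h ∘ basis⊆ B b))

  basis⇒rank : ∀ {B} → Basis M B → rank B ≡ ρ M
  basis⇒rank {B} b = ℕ.≤-antisym (rank≤ρ B) (spanning⇒rank (B , b , id))

  rank⇒basis : ∀ {B} → ∣ B ∣ ≤ ρ M → ρ M ≤ rank B → Basis M B
  rank⇒basis {B} le h = let C , c , C⊆B = rank⇒spanning h in
    subst (Basis M) (⊆-antisym C⊆B (⊆∧∣∣⇒⊇ C⊆B (subst (∣ B ∣ ≤_) (sym (equicardinal M c)) le))) c

≤ʷ-ρ : {M N : Matroid n} → M ≤ʷ N → ρ M ≡ ρ N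
≤ʷ-ρ {M = M} {N} (_ , h) = equicardinal N (h _ (proj₂ (Matroid.nonempty M)))

rank-≤ʷ : {M N : Matroid n} → M ≤ʷ N → ∀ X → rank M X ≤ rank N X
rank-≤ʷ {M = M} {N} (_ , h) X = let I , (B , b , I⊆B) , I⊆X , e = rank-attained M X in
  subst (_≤ rank N X) e (indep≤rank N (B , h B b , I⊆B) I⊆X)

≋⇒≤ʷ : {M N : Matroid n} → M ≋ N → M ≤ʷ N
≋⇒≤ʷ (e , h) = e , λ B → Equivalence.to (h B)

≤ʷ-antisym : {M N : Matroid n} → M ≤ʷ N → N ≤ʷ M → M ≋ N
≤ʷ-antisym (e , h) (_ , h′) = e , λ B → mk⇔ (h B) (h′ B)

rank-≋ : {M N : Matroid n} → M ≋ N → ∀ X → rank M X ≡ rank N X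
rank-≋ {M = M} {N} e X = ℕ.≤-antisym (rank-≤ʷ {M = M} {N} (≋⇒≤ʷ {M = M} {N} e) X)
  (rank-≤ʷ {M = N} {M} (≋⇒≤ʷ {M = N} {M} (≋-sym {M = M} {N} e)) X)

-- A set B is a basis exactly when |B| and r(B) both equal the rank of the matroid.
rank-determines : {M N : Matroid n} → ground M ≡ ground N →
                  (∀ X → X ⊆ ground M → rank M X ≡ rank N X) → M ≋ N
rank-determines {M = M} {N} e h = e , λ B → mk⇔
  (λ b → rank⇒basis N (ℕ.≤-reflexive (trans (equicardinal M b) ρ≡))
          (ℕ.≤-reflexive (trans (sym ρ≡) (trans (sym (basis⇒rank M b)) (h B (Matroid.basis⊆ M B b))))))
  (λ b → rank⇒basis M (ℕ.≤-reflexive (trans (equicardinal N b) (sym ρ≡)))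
          (ℕ.≤-reflexive (trans ρ≡ (trans (sym (basis⇒rank N b))
            (sym (h B (subst (B ⊆_) (sym e) (Matroid.basis⊆ N B b))))))))
  where
  ρ≡ : ρ M ≡ ρ N
  ρ≡ = trans (sym (rank-ground M id)) (trans (h _ id) (rank-ground N (subst (ground N ⊆_) (sym e) id)))

module _ (M : Matroid n) (A : Subset n) where
  open MatroidLemmas (isMatroid M)

  indep-restrict⁺ : ∀ {I} → Indep M I → I ⊆ A → Indep (M ↾ A) I
  indep-restrict⁺ i I⊆A = let B , I⊆B , b = extend M i I⊆A in B , b , I⊆B

  rank-restrict : ∀ X → rank (M ↾ A) X ≡ rank M (X ∩ A)
  rank-restrict X = ℕ.≤-antisym
    (let I , (B , (iB , B⊆A , _) , I⊆B) , I⊆X , e = rank-attained (M ↾ A) X in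
      subst (_≤ rank M (X ∩ A)) e
        (indep≤rank M (Indep-⊆ M I⊆B iB) λ h → x∈p∩q⁺ (I⊆X h , B⊆A (I⊆B h))))
    (let I , i , I⊆ , e = rank-attained M (X ∩ A) in
      subst (_≤ rank (M ↾ A) X) e
        (indep≤rank (M ↾ A) (indep-restrict⁺ i (p∩q⊆q X A ∘ I⊆)) (p∩q⊆p X A ∘ I⊆)))

  -- The usual formula r(A ∪ X) - r(A), written as a sum to avoid truncated subtraction. For the
  -- second inequality a basis J of A is extended to a basis K of A ∪ X; then K ∖ J is independent
  -- in the contraction.
  rank-contract : ∀ X → rank (M / A) X + rank M A ≡ rank M (A ∪ X)
  rank-contract X = ℕ.≤-antisym le ge
    where
    le : rank (M / A) X + rank M A ≤ rank M (A ∪ X)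
    le = let I , (B , (B⊆ , J , rJ@(_ , J⊆A , _) , bJ) , I⊆B) , I⊆X , e = rank-attained (M / A) X in
      subst₂ (λ a b → a + b ≤ rank M (A ∪ X)) e (restrictBasis-rank M rJ)
        (ℕ.≤-trans (+≤∣∣ (I ∪ J) I J (p⊆p∪q J) (q⊆p∪q I J)
            (tauto 5 (λ i b j s a → i ⊑ b ⇒ b ⊑ (s ∖ a) ⇒ j ⊑ a ⇒ ⊢ i ⊓ j ⊑ ∅ᵗ) I B J (ground M) A I⊆B B⊆ J⊆A))
          (indep≤rank M {I ∪ J} (B ∪ J , bJ , tauto 3 (λ i b j → i ⊑ b ⇒ ⊢ i ⊔ j ⊑ b ⊔ j) I B J I⊆B)
            (tauto 4 (λ i j a x → i ⊑ x ⇒ j ⊑ a ⇒ ⊢ i ⊔ j ⊑ a ⊔ x) I J A X I⊆X J⊆A)))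
    ge : rank M (A ∪ X) ≤ rank (M / A) X + rank M A
    ge with restrict-nonempty M A
    ... | J , rJ@(iJ , J⊆A , maxJ) with extend M iJ (p⊆p∪q {p = A} X ∘ J⊆A)
    ...   | K , J⊆K , rK@(iK@(C , bC , K⊆C) , K⊆ , _) =
      subst₂ (λ a b → a ≤ rank (M / A) X + b) (restrictBasis-rank M rK) (restrictBasis-rank M rJ)
        (subst (∣ K ∣ ≤_) (ℕ.+-comm ∣ J ∣ _) (ℕ.≤-trans (∣∣≤+ K J (K ─ J) (tauto 2 (λ j k → ⊢ k ⊑ j ⊔ (k ∖ j)) J K))
          (ℕ.+-monoʳ-≤ ∣ J ∣ (indep≤rank (M / A)
            (C ─ J , (C─J⊆ , J , rJ , subst (Basis M) (tauto 2 (λ c j → j ⊑ c ⇒ ⊢ c ≐ (c ∖ j) ⊔ j) C J (K⊆C ∘ J⊆K)) bC)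
            , tauto 3 (λ j k c → k ⊑ c ⇒ ⊢ (k ∖ j) ⊑ (c ∖ j)) J K C K⊆C)
            K─J⊆X))))
      where
      -- Otherwise y could be added to J inside A, against the maximality of J.
      avoids : ∀ {y} → y ∈ C → y ∉ J → y ∉ A
      avoids {y} y∈C y∉J y∈A = maxJ y y∈A y∉J (C , bC , λ h → [ K⊆C ∘ J⊆K , ∈-≡ y∈C ]′ (∈-add⁻ h))
      C─J⊆ : C ─ J ⊆ ground M ─ A
      C─J⊆ h = let y∈C = p─q⊆p C J h in
        x∈p∧x∉q⇒x∈p─q (Matroid.basis⊆ M C bC y∈C) (avoids y∈C (x∉p─q {p = C} h))
      K─J⊆X : K ─ J ⊆ X
      K─J⊆X h = let y∈K = p─q⊆p K J h in
        [ (λ y∈A → contradiction y∈A (avoids (K⊆C y∈K) (x∉p─q {p = K} h))) , id ]′ (x∈p∪q⁻ A X (K⊆ y∈K))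

rank-minor : ∀ (M : Matroid n) {A B} → A ⊆ B → ∀ X → rank (minor M A B) X + rank M A ≡ rank M (A ∪ (X ∩ B))
rank-minor M {A} {B} A⊆B X = trans
  (cong (rank (minor M A B) X +_) (trans (cong (rank M) (tauto 2 (λ a b → a ⊑ b ⇒ ⊢ a ≐ a ⊓ b) A B A⊆B))
    (sym (rank-restrict M B A))))
  (trans (rank-contract (M ↾ B) A X) (trans (rank-restrict M B (A ∪ X))
    (cong (rank M) (tauto 3 (λ a b x → a ⊑ b ⇒ ⊢ (a ⊔ x) ⊓ b ≐ a ⊔ (x ⊓ b)) A B X A⊆B))))

-- Free products along chains

module _ (P Q : Matroid n) (d : Disjoint (ground P) (ground Q)) where

  □-defined : ∃ λ d → P □ Q ≡ freeProduct P Q d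
  □-defined with nonempty? (ground P ∩ ground Q)
  ... | yes h  = contradiction h d
  ... | no  d′ = d′ , refl

  □-ground : ground (P □ Q) ≡ ground P ∪ ground Q
  □-ground = cong ground (proj₂ □-defined)

  □-basis : ∀ {B} → Basis (P □ Q) B ⇔ FreeBasis P Q B
  □-basis {B} = mk⇔ (subst (λ R → Basis R B) (proj₂ □-defined))
                    (subst (λ R → Basis R B) (sym (proj₂ □-defined)))

  □-ρ : ρ (P □ Q) ≡ ρ P + ρ Q
  □-ρ = proj₁ (proj₂ (Equivalence.to □-basis (proj₂ (Matroid.nonempty (P □ Q)))))

  -- A basis C of P □ Q inside X has at most r_P(X) elements in P and at most |X ∩ U| in Q, with U
  -- the ground set of Q. Conversely, take I ⊆ X independent in P of size r_P(X) and a basis J ⊆ X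
  -- of Q. Their union has at most ρ(P) + ρ(Q) elements and is filled up to that size with elements
  -- of X ∩ U, which harms neither independence in P nor spanning in Q.
  □-spanning : ∀ {X} → ρ (P □ Q) ≤ rank (P □ Q) X ⇔
               (ρ P + ρ Q ≤ rank P X + ∣ X ∩ ground Q ∣ × ρ Q ≤ rank Q X)
  □-spanning {X} = mk⇔ to from
    where
    S = ground P
    U = ground Q
    to : _
    to h with rank⇒spanning (P □ Q) h
    ... | C , bC , C⊆X with Equivalence.to □-basis bC
    ...   | C⊆ , c , i , s =
      subst (_≤ rank P X + ∣ X ∩ U ∣) c (ℕ.≤-trans
        (∣∣≤+ C (C ∩ S) (C ∩ U) (tauto 3 (λ c s u → c ⊑ s ⊔ u ⇒ ⊢ c ⊑ (c ⊓ s) ⊔ (c ⊓ u)) C S U C⊆))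
        (ℕ.+-mono-≤ (indep≤rank P i (C⊆X ∘ p∩q⊆p C S))
          (∣∣-mono (C ∩ U) (X ∩ U) (tauto 3 (λ c u x → c ⊑ x ⇒ ⊢ c ⊓ u ⊑ x ⊓ u) C U X C⊆X)))) ,
      ℕ.≤-trans (spanning⇒rank Q s) (rank-⊆ Q (C⊆X ∘ p∩q⊆p C U))
    from : _
    from (h , h′) with rank-attained P X | rank⇒spanning Q h′
    ... | I , i , I⊆X , cI | J , bJ , J⊆X
      with between {p = I ∪ J} {I ∪ (X ∩ U)} (ρ P + ρ Q)
             (tauto 4 (λ i j x u → j ⊑ x ⇒ j ⊑ u ⇒ ⊢ i ⊔ j ⊑ i ⊔ (x ⊓ u)) I J X U J⊆X (Matroid.basis⊆ Q J bJ))
             (ℕ.≤-trans (∣∣≤+ (I ∪ J) I J id) (ℕ.+-mono-≤ (subst (_≤ ρ P) (sym cI) (rank≤ρ P X))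
               (ℕ.≤-reflexive (equicardinal Q bJ))))
             (ℕ.≤-trans (subst (λ a → ρ P + ρ Q ≤ a + ∣ X ∩ U ∣) (sym cI) h)
               (+≤∣∣ (I ∪ (X ∩ U)) I (X ∩ U) (p⊆p∪q (X ∩ U)) (q⊆p∪q I (X ∩ U))
                 (tauto 4 (λ i x s u → i ⊑ s ⇒ s ⊓ u ⊑ ∅ᵗ ⇒ ⊢ i ⊓ (x ⊓ u) ⊑ ∅ᵗ) I X S U (Indep⊆ground P i) S∩U)))
      where
      S∩U : S ∩ U ⊆ ⊥
      S∩U h = ⊥-elim (d (_ , h))
    ... | C , IJ⊆C , C⊆ , c = spanning⇒rank (P □ Q) (C , Equivalence.from □-basis
        ( tauto 5 (λ c i x u s → c ⊑ i ⊔ (x ⊓ u) ⇒ i ⊑ s ⇒ ⊢ c ⊑ s ⊔ u) C I X U S C⊆ (Indep⊆ground P i)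
        , c
        , Indep-⊆ P (tauto 5 (λ c i x u s → c ⊑ i ⊔ (x ⊓ u) ⇒ s ⊓ u ⊑ ∅ᵗ ⇒ ⊢ c ⊓ s ⊑ i) C I X U S C⊆ S∩U) i
        , J , bJ , tauto 4 (λ c i j u → i ⊔ j ⊑ c ⇒ j ⊑ u ⇒ ⊢ j ⊑ c ⊓ u) C I J U IJ⊆C (Matroid.basis⊆ Q J bJ))
      , tauto 4 (λ c i x u → c ⊑ i ⊔ (x ⊓ u) ⇒ i ⊑ x ⇒ ⊢ c ⊑ x) C I X U C⊆ I⊆X)
      where
      S∩U : S ∩ U ⊆ ⊥
      S∩U h = ⊥-elim (d (_ , h))

IsChain : Subset n → List (Subset n) → Set
IsChain S D = List.head D ≡ just ⊥ × List.last D ≡ just S × Linked _⊂_ D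

last-⊆ : ∀ {S A : Subset n} D → List.last (A ∷ D) ≡ just S → Linked _⊂_ (A ∷ D) → A ⊆ S
last-⊆ []      refl _               = id
last-⊆ (B ∷ D) e    ((A⊆B , _) ∷ l) = last-⊆ D e l ∘ A⊆B

module _ (M : Matroid n) where

  -- Condition, at a step A ⊂ B of a chain D, for X to span chainProduct M D.
  Freely : Subset n → Subset n → Subset n → Set
  Freely X A B = ρ M ≤ rank M (A ∪ (X ∩ B)) + ∣ X ─ B ∣

  minor-ground : ∀ {A B} → B ⊆ ground M → ground (minor M A B) ≡ B ─ A
  minor-ground {A} {B} = tauto 3 (λ s a b → b ⊑ s ⇒ ⊢ (s ⊓ b) ∖ a ≐ b ∖ a) (ground M) A B

  minor-ρ : ∀ {A B} → A ⊆ B → ρ (minor M A B) + rank M A ≡ rank M B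
  minor-ρ {A} {B} A⊆B = trans
    (cong (_+ rank M A) (sym (rank-ground (minor M A B) {B} (p∩q⊆q (ground M) B ∘ p─q⊆p (ground M ∩ B) A))))
    (trans (rank-minor M A⊆B B) (cong (rank M) (tauto 2 (λ a b → a ⊑ b ⇒ ⊢ a ⊔ (b ⊓ b) ≐ b) A B A⊆B)))

  -- The induction runs over the final segments of a chain, whose product lives on S ∖ A and has
  -- rank ρ(M) - r(A). Adding r(A) to both sides turns the first condition of `□-spanning` into
  -- `Freely` at the step A ⊂ B. X may be any subset of S, as its part in A has no effect on the
  -- ranks and intersections involved.
  chainProduct-tail : ∀ A B D → List.last (A ∷ B ∷ D) ≡ just (ground M) → Linked _⊂_ (A ∷ B ∷ D) →
    let Q = chainProduct M (A ∷ B ∷ D) in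
    ground Q ≡ ground M ─ A × ρ Q + rank M A ≡ ρ M ×
    (∀ X → X ⊆ ground M → ρ Q ≤ rank Q X ⇔ Linked (Freely X) (A ∷ B ∷ D))
  chainProduct-tail A .(ground M) [] refl ((A⊆S , _) ∷ [-]) =
    -- At the top X ∖ S is empty, so here `Freely` says just that X spans the last minor.
    minor-ground id , ρ≡ , λ X X⊆S → mk⇔
      (λ h → ℕ.≤-trans (subst₂ _≤_ ρ≡ (rank-minor M A⊆S X) (ℕ.+-monoˡ-≤ (rank M A) h)) (ℕ.m≤m+n _ _) ∷ [-])
      (λ { (h ∷ [-]) → ℕ.+-cancelʳ-≤ (rank M A) _ _ (subst₂ _≤_ (sym ρ≡) (sym (rank-minor M A⊆S X))
        (subst (ρ M ≤_) (trans (cong (rank M (A ∪ (X ∩ S)) +_) (none X X⊆S)) (ℕ.+-identityʳ _)) h)) })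
    where
    S = ground M
    ρ≡ : ρ (minor M A S) + rank M A ≡ ρ M
    ρ≡ = trans (minor-ρ A⊆S) (rank-ground M id)
    none : ∀ X → X ⊆ S → ∣ X ─ S ∣ ≡ 0
    none X X⊆S = trans (cong ∣_∣ (tauto 2 (λ x s → x ⊑ s ⇒ ⊢ x ∖ s ≐ ∅ᵗ) X S X⊆S)) (∣⊥∣≡0 n)
  chainProduct-tail A B (C ∷ D) last l@((A⊆B , _) ∷ l′) with chainProduct-tail B C D last l′
  ... | ground≡ , ρQ , spans = gr , ρPQ , λ X X⊆S → mk⇔
      (λ h → let h₁ , h₂ = Equivalence.to (□-spanning P Q disj) h
             in Equivalence.to (here⇔ X X⊆S) h₁ ∷ Equivalence.to (spans X X⊆S) h₂)
      (λ { (h₁ ∷ h₂) → Equivalence.from (□-spanning P Q disj)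
             (Equivalence.from (here⇔ X X⊆S) h₁ , Equivalence.from (spans X X⊆S) h₂) })
    where
    S = ground M
    P = minor M A B
    Q = chainProduct M (B ∷ C ∷ D)
    B⊆S : B ⊆ S
    B⊆S = last-⊆ (C ∷ D) last l′
    disj : Disjoint (ground P) (ground Q)
    disj (x , h) = ∉⊥ (subst (x ∈_) (trans (cong₂ _∩_ (minor-ground {A} B⊆S) ground≡)
      (tauto 3 (λ s a b → ⊢ (b ∖ a) ⊓ (s ∖ b) ≐ ∅ᵗ) S A B)) h)
    gr : ground (P □ Q) ≡ S ─ A
    gr = trans (□-ground P Q disj) (trans (cong₂ _∪_ (minor-ground {A} B⊆S) ground≡)
      (tauto 3 (λ s a b → a ⊑ b ⇒ b ⊑ s ⇒ ⊢ (b ∖ a) ⊔ (s ∖ b) ≐ s ∖ a) S A B A⊆B B⊆S))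
    ρ+ : (ρ P + ρ Q) + rank M A ≡ ρ M
    ρ+ = begin
      (ρ P + ρ Q) + rank M A ≡⟨ cong (_+ rank M A) (ℕ.+-comm (ρ P) (ρ Q)) ⟩
      (ρ Q + ρ P) + rank M A ≡⟨ ℕ.+-assoc (ρ Q) _ _ ⟩
      ρ Q + (ρ P + rank M A) ≡⟨ cong (ρ Q +_) (minor-ρ A⊆B) ⟩
      ρ Q + rank M B         ≡⟨ ρQ ⟩
      ρ M                    ∎
      where open ≡-Reasoning
    ρPQ : ρ (P □ Q) + rank M A ≡ ρ M
    ρPQ = trans (cong (_+ rank M A) (□-ρ P Q disj)) ρ+
    here⇔ : ∀ X → X ⊆ S → ρ P + ρ Q ≤ rank P X + ∣ X ∩ ground Q ∣ ⇔ Freely X A B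
    here⇔ X X⊆S = mk⇔
      (λ h → subst₂ _≤_ ρ+ eq (ℕ.+-monoˡ-≤ (rank M A) h))
      (λ h → ℕ.+-cancelʳ-≤ (rank M A) _ _ (subst₂ _≤_ (sym ρ+) (sym eq) h))
      where
      open ≡-Reasoning
      eq : (rank P X + ∣ X ∩ ground Q ∣) + rank M A ≡ rank M (A ∪ (X ∩ B)) + ∣ X ─ B ∣
      eq = begin
        (rank P X + ∣ X ∩ ground Q ∣) + rank M A
          ≡⟨ ℕ.+-assoc (rank P X) _ _ ⟩
        rank P X + (∣ X ∩ ground Q ∣ + rank M A)
          ≡⟨ cong (rank P X +_) (ℕ.+-comm _ (rank M A)) ⟩
        rank P X + (rank M A + ∣ X ∩ ground Q ∣)
          ≡⟨ ℕ.+-assoc (rank P X) _ _ ⟨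
        (rank P X + rank M A) + ∣ X ∩ ground Q ∣
          ≡⟨ cong₂ (λ a p → a + ∣ p ∣) (rank-minor M A⊆B X) (trans (cong (X ∩_) ground≡)
               (tauto 3 (λ x s b → x ⊑ s ⇒ ⊢ x ⊓ (s ∖ b) ≐ x ∖ b) X S B X⊆S)) ⟩
        rank M (A ∪ (X ∩ B)) + ∣ X ─ B ∣ ∎

  rank-⊥ : rank M ⊥ ≡ 0
  rank-⊥ = trans (rank-indep M (indep-⊥ M)) (∣⊥∣≡0 n)

  chainProduct-ground : ∀ {D} → IsChain (ground M) D → ground (chainProduct M D) ≡ ground M
  chainProduct-ground {[]} (() , _)
  chainProduct-ground {_ ∷ []}    (refl , eq , _) = Maybe.just-injective eq
  chainProduct-ground {_ ∷ B ∷ D} (refl , last , l) =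
    trans (proj₁ (chainProduct-tail ⊥ B D last l)) (tauto 1 (λ s → ⊢ s ∖ ∅ᵗ ≐ s) (ground M))

  chainProduct-basis : ∀ {D} → IsChain (ground M) D → ∀ {X} →
    Basis (chainProduct M D) X ⇔ (X ⊆ ground M × ∣ X ∣ ≡ ρ M × Linked (Freely X) D)
  chainProduct-basis {[]} (() , _)
  -- A chain with a single set forces S = ∅, and its product is the empty matroid.
  chainProduct-basis {_ ∷ []} (refl , eq , _) {X} = mk⇔
    (λ { refl → (λ h → contradiction h ∉⊥)
              , trans (∣⊥∣≡0 n) (sym ρ≡0) , [-] })
    (λ (X⊆S , _) → ⊆-antisym (λ {x} → subst (λ S → x ∈ S) (sym S≡⊥) ∘ X⊆S) (λ h → contradiction h ∉⊥))
    where
    S≡⊥ : ⊥ ≡ ground M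
    S≡⊥ = Maybe.just-injective eq
    ρ≡0 : ρ M ≡ 0
    ρ≡0 = trans (sym (rank-ground M {⊥} (λ {x} → subst (λ S → x ∈ S) (sym S≡⊥)))) rank-⊥
  chainProduct-basis {_ ∷ B ∷ D} ch@(refl , last , l) {X} with chainProduct-tail ⊥ B D last l
  ... | _ , ρ≡ , spans = mk⇔ to from
    where
    Q = chainProduct M (⊥ ∷ B ∷ D)
    ρQ : ρ Q ≡ ρ M
    ρQ = trans (sym (ℕ.+-identityʳ _)) (trans (cong (ρ Q +_) (sym rank-⊥)) ρ≡)
    to : Basis Q X → X ⊆ ground M × ∣ X ∣ ≡ ρ M × Linked (Freely X) (⊥ ∷ B ∷ D)
    to b = X⊆S , trans (equicardinal Q b) ρQ ,
           Equivalence.to (spans X X⊆S) (ℕ.≤-reflexive (sym (basis⇒rank Q b)))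
      where
      X⊆S : X ⊆ ground M
      X⊆S = subst (X ⊆_) (chainProduct-ground ch) (Matroid.basis⊆ Q X b)
    from : X ⊆ ground M × ∣ X ∣ ≡ ρ M × Linked (Freely X) (⊥ ∷ B ∷ D) → Basis Q X
    from (X⊆S , c , f) = rank⇒basis Q (ℕ.≤-reflexive (trans c (sym ρQ))) (Equivalence.from (spans X X⊆S) f)

-- The closure operator of a chain

linked-Π : ∀ {a b r} {A : Set a} {Y : Set b} {R : Y → A → A → Set r} (D : List A) →
           (∀ y → Linked (R y) D) → Linked (λ A B → ∀ y → R y A B) D
linked-Π []          f = []
linked-Π (x ∷ [])    f = [-]
linked-Π (x ∷ y ∷ D) f = (λ z → Linked.head (f z)) ∷ linked-Π (y ∷ D) (λ z → Linked.tail (f z))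

irreducible-≋ : {M N : Matroid n} → M ≋ N → Irreducible M → Irreducible N
irreducible-≋ {M = M} {N} e (ne , irr) = subst Nonempty (proj₁ e) ne ,
  λ (P , Q , neP , neQ , d , e′) → irr (P , Q , neP , neQ , d , ≋-trans {L = M} {N} {P □ Q} e e′)

minor-whole : (M : Matroid n) → minor M ⊥ (ground M) ≋ M
minor-whole {n} M = rank-determines {M = minor M ⊥ S} {M} (tauto 1 (λ s → ⊢ (s ⊓ s) ∖ ∅ᵗ ≐ s) S) λ X X⊆ → begin
  rank (minor M ⊥ S) X             ≡⟨ ℕ.+-identityʳ _ ⟨
  rank (minor M ⊥ S) X + 0         ≡⟨ cong (rank (minor M ⊥ S) X +_) (rank-⊥ M) ⟨
  rank (minor M ⊥ S) X + rank M ⊥  ≡⟨ rank-minor M (λ h → contradiction h ∉⊥) X ⟩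
  rank M (⊥ ∪ (X ∩ S))             ≡⟨ cong (rank M) (tauto 2 (λ x s → x ⊑ (s ⊓ s) ∖ ∅ᵗ ⇒ ⊢ ∅ᵗ ⊔ (x ⊓ s) ≐ x) X S X⊆) ⟩
  rank M X                         ∎
  where
  S = ground M
  open ≡-Reasoning

chainProduct-monotone : {M N : Matroid n} → M ≤ʷ N → ∀ {D} → IsChain (ground M) D →
                        chainProduct M D ≤ʷ chainProduct N D
chainProduct-monotone {n = n} {M} {N} M≤N {D} ch =
  trans (chainProduct-ground M ch) (trans (proj₁ M≤N) (sym (chainProduct-ground N ch′))) , bases
  where
  ch′ : IsChain (ground N) D
  ch′ = subst (λ S → IsChain S D) (proj₁ M≤N) ch
  ρ≡ : ρ M ≡ ρ N
  ρ≡ = ≤ʷ-ρ {M = M} {N} M≤N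
  bases : ∀ B → Basis (chainProduct M D) B → Basis (chainProduct N D) B
  bases B b with Equivalence.to (chainProduct-basis M ch) b
  ... | B⊆ , c , f = Equivalence.from (chainProduct-basis N ch′)
    ( subst (B ⊆_) (proj₁ M≤N) B⊆ , trans c ρ≡
    , Linked.map (λ {A} {C} h → subst (_≤ rank N (A ∪ (B ∩ C)) + ∣ B ─ C ∣) ρ≡
        (ℕ.≤-trans h (ℕ.+-monoˡ-≤ _ (rank-≤ʷ {M = M} {N} M≤N _)))) f)

module _ (M : Matroid n) {D : List (Subset n)} (ch : IsChain (ground M) D) where
  private
    linked = proj₂ (proj₂ ch)
    S = ground M
    L = chainProduct M D

  -- For a basis B and a member C of the chain, |B| = |B ∩ C| + |B ∖ C|, and B ∩ C is independent.
  chainProduct-extensive : M ≤ʷ L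
  chainProduct-extensive = sym (chainProduct-ground M ch) , λ B b → Equivalence.from (chainProduct-basis M ch)
    ( Matroid.basis⊆ M B b , equicardinal M b
    , Linked.map (λ {A} {C} _ → ℕ.≤-trans (ℕ.≤-reflexive (trans (sym (equicardinal M b)) (∣∣-split B C)))
        (ℕ.+-monoˡ-≤ ∣ B ─ C ∣ (indep≤rank M (B , b , p∩q⊆p B C) (q⊆p∪q A (B ∩ C))))) linked)

  -- Let Y be a basis of L with |Y ∩ X| at least the rank of X in L. Since A ⊆ X, adding (Y ∩ B) ∖ X
  -- to X covers A ∪ (Y ∩ B), so `Freely` bounds |Y| = ρ(M) by r(X) + |(Y ∩ B) ∖ X| + |Y ∖ B|, with
  -- r the rank in M. The last two terms count Y ∖ X, which leaves |Y ∩ X| ≤ r(X). Both the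
  -- invariance of the minors and idempotence rest on this.
  chainProduct-interval : Linked (λ A B → ∀ X → A ⊆ X → X ⊆ B → rank L X ≡ rank M X) D
  chainProduct-interval = Linked.map (λ {A} {B} → eq {A} {B})
    -- Each basis Y of L brings its own list of inequalities; they are regrouped so that every step
    -- of the chain has them for all Y.
    (linked-Π D λ Y → linked-Π D λ b → proj₂ (proj₂ (Equivalence.to (chainProduct-basis M ch {Y}) b)))
    where
    le : ∀ {A B} → (∀ Y → Basis L Y → Freely M Y A B) → ∀ X → A ⊆ X → X ⊆ B → rank L X ≤ rank M X
    le {A} {B} f X A⊆X X⊆B with rank-attained L X
    ... | I , (Y , bY , I⊆Y) , I⊆X , e = subst (_≤ rank M X) e (ℕ.≤-trans
        (∣∣-mono I (Y ∩ X) λ h → x∈p∩q⁺ (I⊆Y h , I⊆X h))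
        (ℕ.+-cancelʳ-≤ (∣ (Y ∩ B) ─ X ∣ + ∣ Y ─ B ∣) _ _ (begin
          ∣ Y ∩ X ∣ + (∣ (Y ∩ B) ─ X ∣ + ∣ Y ─ B ∣)
            ≤⟨ ℕ.+-monoʳ-≤ ∣ Y ∩ X ∣ (+≤∣∣ (Y ─ X) ((Y ∩ B) ─ X) (Y ─ B)
                 (tauto 3 (λ y b x → ⊢ (y ⊓ b) ∖ x ⊑ y ∖ x) Y B X)
                 (tauto 3 (λ y b x → x ⊑ b ⇒ ⊢ y ∖ b ⊑ y ∖ x) Y B X X⊆B)
                 (tauto 3 (λ y b x → ⊢ ((y ⊓ b) ∖ x) ⊓ (y ∖ b) ⊑ ∅ᵗ) Y B X)) ⟩
          ∣ Y ∩ X ∣ + ∣ Y ─ X ∣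
            ≡⟨ ∣∣-split Y X ⟨
          ∣ Y ∣
            ≡⟨ proj₁ (proj₂ (Equivalence.to (chainProduct-basis M ch) bY)) ⟩
          ρ M
            ≤⟨ f Y bY ⟩
          rank M (A ∪ (Y ∩ B)) + ∣ Y ─ B ∣
            ≤⟨ ℕ.+-monoˡ-≤ ∣ Y ─ B ∣ (rank≤+ M {X} {A ∪ (Y ∩ B)} {(Y ∩ B) ─ X}
                 (tauto 4 (λ a y b x → a ⊑ x ⇒ ⊢ a ⊔ (y ⊓ b) ⊑ x ⊔ ((y ⊓ b) ∖ x)) A Y B X A⊆X)) ⟩
          (rank M X + ∣ (Y ∩ B) ─ X ∣) + ∣ Y ─ B ∣
            ≡⟨ ℕ.+-assoc (rank M X) _ _ ⟩
          rank M X + (∣ (Y ∩ B) ─ X ∣ + ∣ Y ─ B ∣) ∎)))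
      where open ℕ.≤-Reasoning
    eq : ∀ {A B} → (∀ Y → Basis L Y → Freely M Y A B) → ∀ X → A ⊆ X → X ⊆ B → rank L X ≡ rank M X
    eq f X A⊆X X⊆B = ℕ.≤-antisym (le f X A⊆X X⊆B) (rank-≤ʷ {M = M} {L} chainProduct-extensive X)

  chainProduct-minors : Linked (λ A B → minor L A B ≋ minor M A B) D
  chainProduct-minors = Linked.map (λ { {A} {B} ((A⊆B , _) , f) → step A⊆B f }) (Linked.zip (linked , chainProduct-interval))
    where
    step : ∀ {A B} → A ⊆ B → (∀ X → A ⊆ X → X ⊆ B → rank L X ≡ rank M X) → minor L A B ≋ minor M A B
    step {A} {B} A⊆B f = rank-determines {M = minor L A B} {minor M A B}
      (cong (λ S → (S ∩ B) ─ A) (chainProduct-ground M ch))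
      λ X _ → ℕ.+-cancelʳ-≡ (rank M A) _ _ (begin
        rank (minor L A B) X + rank M A  ≡⟨ cong (rank (minor L A B) X +_) (f A id A⊆B) ⟨
        rank (minor L A B) X + rank L A  ≡⟨ rank-minor L A⊆B X ⟩
        rank L (A ∪ (X ∩ B))             ≡⟨ f _ (p⊆p∪q (X ∩ B)) (tauto 3 (λ a b x → a ⊑ b ⇒ ⊢ a ⊔ (x ⊓ b) ⊑ b) A B X A⊆B) ⟩
        rank M (A ∪ (X ∩ B))             ≡⟨ rank-minor M A⊆B X ⟨
        rank (minor M A B) X + rank M A  ∎)
      where open ≡-Reasoning

  chainProduct-chain⁺ : IsIrreducibleChain M D → IsIrreducibleChain L D
  chainProduct-chain⁺ (h , l , irr) = h , trans l (cong just (sym (chainProduct-ground M ch))) ,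
    Linked.map (λ { {A} {B} (e , A⊂B , i) → A⊂B , irreducible-≋ {M = minor M A B} {minor L A B}
      (≋-sym {M = minor L A B} {minor M A B} e) i }) (Linked.zip (chainProduct-minors , irr))

  chainProduct-chain⁻ : IsIrreducibleChain L D → IsIrreducibleChain M D
  chainProduct-chain⁻ (h , l , irr) = h , trans l (cong just (chainProduct-ground M ch)) ,
    Linked.map (λ { {A} {B} (e , A⊂B , i) → A⊂B , irreducible-≋ {M = minor L A B} {minor M A B} e i })
      (Linked.zip (chainProduct-minors , irr))

-- The ranks that occur in `Freely` at a step A ⊂ C are those of sets between A and C, where
-- `chainProduct-interval` identifies the two rank functions.
chainProduct-idempotent : (M : Matroid n) {D : List (Subset n)} (ch : IsChain (ground M) D) →
                          chainProduct (chainProduct M D) D ≤ʷ chainProduct M D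
chainProduct-idempotent {n} M {D} ch = chainProduct-ground L ch′ , bases
  where
  L = chainProduct M D
  ch′ : IsChain (ground L) D
  ch′ = subst (λ S → IsChain S D) (sym (chainProduct-ground M ch)) ch
  ρ≡ : ρ L ≡ ρ M
  ρ≡ = sym (≤ʷ-ρ {M = M} {L} (chainProduct-extensive M ch))
  bases : ∀ B → Basis (chainProduct L D) B → Basis L B
  bases B b with Equivalence.to (chainProduct-basis L ch′) b
  ... | B⊆ , c , f = Equivalence.from (chainProduct-basis M ch)
    ( subst (B ⊆_) (chainProduct-ground M ch) B⊆ , trans c ρ≡
    , Linked.map (λ { {A} {C} ((A⊆C , _) , g , h) → subst₂ (λ a b → a ≤ b + ∣ B ─ C ∣) ρ≡
        (g _ (p⊆p∪q (B ∩ C)) (tauto 3 (λ a c b → a ⊑ c ⇒ ⊢ a ⊔ (b ⊓ c) ⊑ c) A C B A⊆C)) h })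
        (Linked.zip (proj₂ (proj₂ ch) , Linked.zip (chainProduct-interval M ch , f))))

-- The product unfolds to the first minor times the product of the rest, and strict inclusions make
-- both ground sets nonempty. As the chain is only assumed to increase, this covers every N in 𝓡_M,
-- including those of which D is not an irreducible chain.
chainProduct-reducible : (M : Matroid n) → ∀ {A B C D} → IsChain (ground M) (A ∷ B ∷ C ∷ D) →
                         ProperFreeProduct (chainProduct M (A ∷ B ∷ C ∷ D))
chainProduct-reducible {n} M {A} {B} {C} {D} (refl , last , (_ , x , x∈B , x∉A) ∷ l@((_ , y , y∈C , y∉B) ∷ l′)) =
  P , Q ,
  (x , subst (x ∈_) (sym gP) (x∈p∧x∉q⇒x∈p─q x∈B x∉A)) ,
  (y , subst (y ∈_) (sym gQ) (x∈p∧x∉q⇒x∈p─q (last-⊆ D last l′ y∈C) y∉B)) ,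
  (λ (z , h) → ∉⊥ (subst (z ∈_) (trans (cong₂ _∩_ gP gQ)
      (tauto 3 (λ s a b → ⊢ (b ∖ a) ⊓ (s ∖ b) ≐ ∅ᵗ) (ground M) A B)) h)) ,
  refl , λ _ → mk⇔ id id
  where
  P = minor M A B
  Q = chainProduct M (B ∷ C ∷ D)
  gP : ground P ≡ B ─ A
  gP = minor-ground M {A} (last-⊆ (C ∷ D) last l)
  gQ : ground Q ≡ ground M ─ B
  gQ = proj₁ (chainProduct-tail M B C D last l)

-- Free separators and factorization

-- A rank condition equivalent to M ≋ (M ↾ A) □ (M / A).
FreeSep : Matroid n → Subset n → Set
FreeSep M A = ∀ X → X ⊆ ground M →
  rank M (A ∪ X) ≤ rank M X ⊎ rank M (X ∩ A) + ∣ X ─ A ∣ ≤ rank M X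

FreeSep? : (M : Matroid n) → ∀ A → Dec (FreeSep M A)
FreeSep? M A = allSubset? λ X → (X ⊆? ground M) →-dec
  ((rank M (A ∪ X) ℕ.≤? rank M X) ⊎-dec (rank M (X ∩ A) + ∣ X ─ A ∣ ℕ.≤? rank M X))

module _ (M : Matroid n) where
  private S = ground M

  freeSep-⊥ : FreeSep M ⊥
  freeSep-⊥ X _ = inj₁ (ℕ.≤-reflexive (cong (rank M) (∪-identityˡ X)))

  freeSep-ground : FreeSep M S
  freeSep-ground X X⊆S = inj₂ (ℕ.≤-reflexive (trans
    (cong₂ (λ p q → rank M p + ∣ q ∣) (tauto 2 (λ x s → x ⊑ s ⇒ ⊢ x ⊓ s ≐ x) X S X⊆S)
      (tauto 2 (λ x s → x ⊑ s ⇒ ⊢ x ∖ s ≐ ∅ᵗ) X S X⊆S))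
    (trans (cong (rank M X +_) (∣⊥∣≡0 n)) (ℕ.+-identityʳ _))))

  -- Passing from A to C, the elements of X in C ∖ A stop being counted one by one and count only
  -- through the rank.
  rank-part-antitone : ∀ {A C} X → A ⊆ C → rank M (X ∩ C) + ∣ X ─ C ∣ ≤ rank M (X ∩ A) + ∣ X ─ A ∣
  rank-part-antitone {A} {C} X A⊆C = ℕ.≤-trans
    (ℕ.+-monoˡ-≤ ∣ X ─ C ∣ (rank≤+ M {X ∩ A} {X ∩ C} {(X ∩ C) ─ A}
      (tauto 3 (λ x a c → ⊢ x ⊓ c ⊑ (x ⊓ a) ⊔ ((x ⊓ c) ∖ a)) X A C)))
    (ℕ.≤-trans (ℕ.≤-reflexive (ℕ.+-assoc (rank M (X ∩ A)) _ _))
      (ℕ.+-monoʳ-≤ (rank M (X ∩ A)) (+≤∣∣ (X ─ A) ((X ∩ C) ─ A) (X ─ C)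
        (tauto 3 (λ x a c → ⊢ (x ⊓ c) ∖ a ⊑ x ∖ a) X A C)
        (tauto 3 (λ x a c → a ⊑ c ⇒ ⊢ x ∖ c ⊑ x ∖ a) X A C A⊆C)
        (tauto 3 (λ x a c → ⊢ ((x ⊓ c) ∖ a) ⊓ (x ∖ c) ⊑ ∅ᵗ) X A C))))

  part-step : ∀ {A B} X → A ⊆ B → rank M ((X ∩ B) ∩ A) + ∣ (X ∩ B) ─ A ∣ ≤ rank M (X ∩ B) →
              rank M (X ∩ B) + ∣ X ─ B ∣ ≤ rank M X → rank M (X ∩ A) + ∣ X ─ A ∣ ≤ rank M X
  part-step {A} {B} X A⊆B h h′ = begin
    rank M (X ∩ A) + ∣ X ─ A ∣
      ≤⟨ ℕ.+-mono-≤ (ℕ.≤-reflexive (cong (rank M) (tauto 3 (λ x a b → a ⊑ b ⇒ ⊢ x ⊓ a ≐ (x ⊓ b) ⊓ a) X A B A⊆B)))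
           (∣∣≤+ (X ─ A) ((X ∩ B) ─ A) (X ─ B) (tauto 3 (λ x a b → ⊢ x ∖ a ⊑ ((x ⊓ b) ∖ a) ⊔ (x ∖ b)) X A B)) ⟩
    rank M ((X ∩ B) ∩ A) + (∣ (X ∩ B) ─ A ∣ + ∣ X ─ B ∣)
      ≡⟨ ℕ.+-assoc (rank M ((X ∩ B) ∩ A)) _ _ ⟨
    (rank M ((X ∩ B) ∩ A) + ∣ (X ∩ B) ─ A ∣) + ∣ X ─ B ∣
      ≤⟨ ℕ.+-monoˡ-≤ ∣ X ─ B ∣ h ⟩
    rank M (X ∩ B) + ∣ X ─ B ∣
      ≤⟨ h′ ⟩
    rank M X ∎
    where open ℕ.≤-Reasoning

  -- Going down the chain, either X spans or X ∖ A is free over X ∩ A. From B to A, the separator A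
  -- is tested on X ∩ B: if X ∩ B spans A, then `Freely` at this step makes X spanning; otherwise
  -- freeness is passed on by `part-step`. At ∅ freeness says that X is independent, and then its
  -- size makes it spanning.
  freeSep-chain : ∀ {D} → IsChain S D → All (FreeSep M) D → chainProduct M D ≋ M
  freeSep-chain {D} ch@(h , last , linked) seps = ≤ʷ-antisym {M = chainProduct M D} {M}
    (chainProduct-ground M ch , bases) (chainProduct-extensive M ch)
    where
    go : ∀ X → X ⊆ S → ∀ A D → List.last (A ∷ D) ≡ just S → Linked _⊂_ (A ∷ D) → Linked (Freely M X) (A ∷ D) →
         All (FreeSep M) (A ∷ D) → ρ M ≤ rank M X ⊎ rank M (X ∩ A) + ∣ X ─ A ∣ ≤ rank M X
    go X X⊆S A [] refl _ _ _ with freeSep-ground X X⊆S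
    ... | inj₁ h = inj₁ (subst (_≤ rank M X) (rank-ground M (p⊆p∪q X)) h)
    ... | inj₂ h = inj₂ h
    go X X⊆S A (B ∷ D) last ((A⊆B , _) ∷ l) (f ∷ fs) (s ∷ ss) with go X X⊆S B D last l fs ss
    ... | inj₁ h = inj₁ h
    ... | inj₂ h with s (X ∩ B) (X⊆S ∘ p∩q⊆p X B)
    ...   | inj₁ h′ = inj₁ (ℕ.≤-trans f (ℕ.≤-trans (ℕ.+-monoˡ-≤ ∣ X ─ B ∣ h′) h))
    ...   | inj₂ h′ = inj₂ (part-step X A⊆B h′ h)
    start : ∀ X → X ⊆ S → ∀ D → IsChain S D → Linked (Freely M X) D → All (FreeSep M) D →
            ρ M ≤ ∣ X ∣ → ρ M ≤ rank M X
    start X X⊆S []      (() , _)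
    start X X⊆S (_ ∷ D) (refl , last , l) f s ≥ with go X X⊆S ⊥ D last l f s
    ... | inj₁ h = h
    ... | inj₂ h = ℕ.≤-trans ≥ (ℕ.≤-trans (ℕ.≤-reflexive (cong ∣_∣ (tauto 1 (λ x → ⊢ x ≐ x ∖ ∅ᵗ) X)))
                     (ℕ.≤-trans (ℕ.m≤n+m _ _) h))
    bases : ∀ B → Basis (chainProduct M D) B → Basis M B
    bases B b with Equivalence.to (chainProduct-basis M ch) b
    ... | B⊆S , c , f = rank⇒basis M (ℕ.≤-reflexive c)
      (start B B⊆S D ch f seps (ℕ.≤-reflexive (sym c)))

+-swap : ∀ a b c → (a + b) + c ≡ (a + c) + b
+-swap a b c = trans (ℕ.+-assoc a b c) (trans (cong (a +_) (ℕ.+-comm b c)) (sym (ℕ.+-assoc a c b)))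

-- I is a basis of X that extends a basis J of the part of X in P. If some t in P can still be added
-- to I, let B be a basis of M containing I ∪ t. A point y of X outside P and outside I could
-- replace t in B, because this only shrinks the part in P and keeps the part in Q spanning. Then I
-- ∪ y would be independent, against the maximality of I; so I contains all of X outside P.
freeSep-product : {M : Matroid n} (P Q : Matroid n) → Disjoint (ground P) (ground Q) → M ≋ P □ Q →
                  FreeSep M (ground P)
freeSep-product {n} {M} P Q d (eqM , eqB) X X⊆S with restrict-nonempty M (X ∩ ground P)
... | J , rJ@(iJ , J⊆ , _) with extend M iJ (p∩q⊆p X (ground P) ∘ J⊆)
...   | I , J⊆I , rI@(iI , I⊆X , maxI)
  with any? (λ t → (t ∈? ground P) ×-dec ¬? (t ∈? I) ×-dec Matroid.Indep? M (I ∪ ⁅ t ⁆))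
...     | no none = inj₁ (subst₂ _≤_ (restrictBasis-rank M r) (restrictBasis-rank M rI) ℕ.≤-refl)
  where
  r : RestrictBasis M (ground P ∪ X) I
  r = iI , q⊆p∪q (ground P) X ∘ I⊆X , λ y y∈ y∉I i →
    [ (λ y∈P → none (y , y∈P , y∉I , i)) , (λ y∈X → maxI y y∈X y∉I i) ]′ (x∈p∪q⁻ (ground P) X y∈)
...     | yes (t , t∈P , t∉I , B , bB , It⊆B) = inj₂ (subst₂ (λ a b → a + ∣ X ─ T ∣ ≤ b)
    (restrictBasis-rank M rJ) (restrictBasis-rank M rI)
    (+≤∣∣ I J (X ─ T) J⊆I X─T⊆I (tauto 3 (λ j x t → j ⊑ x ⊓ t ⇒ ⊢ j ⊓ (x ∖ t) ⊑ ∅ᵗ) J X T J⊆)))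
  where
  T = ground P
  U = ground Q
  t∈B : t ∈ B
  t∈B = It⊆B (y∈A∪y I)
  X─T⊆I : X ─ T ⊆ I
  X─T⊆I {y} h = decidable-stable (y ∈? I) λ y∉I →
    let y∈X = p─q⊆p X T h
        y∉T = x∉p─q {p = X} h
        y∉B = λ y∈B → maxI y y∈X y∉I (B , bB , λ k → [ It⊆B ∘ p⊆p∪q _ , ∈-≡ y∈B ]′ (∈-add⁻ k))
        B⊆ , c , i , s = Equivalence.to (□-basis P Q d) (Equivalence.to (eqB B) bB)
        y∈TU = subst (y ∈_) (trans eqM (□-ground P Q d)) (X⊆S y∈X)
        b = Equivalence.from (eqB (swap B t y)) (Equivalence.from (□-basis P Q d)
          ( (λ k → [ B⊆ ∘ proj₁ , ∈-≡ y∈TU ]′ (∈-swap⁻ B k))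
          , trans (∣swap∣ t∈B y∉B) c
          , Indep-⊆ P (shrink y∉T) i
          , rank⇒spanning Q (ℕ.≤-trans (spanning⇒rank Q s) (rank-⊆ Q keep))))
    in maxI y y∈X y∉I (swap B t y , b , λ k → [ (λ z∈I → ∈-swapˡ (It⊆B (p⊆p∪q _ z∈I)) (≢-by t∉I z∈I))
                                               , ∈-≡ (∈-swapʳ B) ]′ (∈-add⁻ k))
    where
    shrink : ∀ {y} → y ∉ T → swap B t y ∩ T ⊆ B ∩ T
    shrink {y} y∉T h = let k , z∈T = x∈p∩q⁻ (swap B t y) T h in
      [ (λ (z∈B , _) → x∈p∩q⁺ (z∈B , z∈T)) , (λ { refl → contradiction z∈T y∉T }) ]′ (∈-swap⁻ B k)
    keep : ∀ {y} → B ∩ U ⊆ swap B t y ∩ U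
    keep h = let z∈B , z∈U = x∈p∩q⁻ B U h in
      x∈p∩q⁺ (∈-swapˡ z∈B (λ { refl → d (_ , x∈p∩q⁺ (t∈P , z∈U)) }) , z∈U)

-- This is what makes M(A , B) irreducible when no free separator lies strictly between A and B: a
-- proper separator T of the minor would produce A ∪ T. X is tested against B, then X ∩ B against A,
-- then (X ∩ B) ∖ A against T. Spanning B or freeness over A settles the claim at once; otherwise
-- the alternative found in the minor is lifted by `rank-minor`.
freeSep-refine : (M : Matroid n) → ∀ {A B T} → A ⊆ B → B ⊆ ground M → T ⊆ B →
                 FreeSep M A → FreeSep M B → FreeSep (minor M A B) T → FreeSep M (A ∪ T)
freeSep-refine {n} M {A} {B} {T} A⊆B B⊆S T⊆B sA sB sT X X⊆S with sB X X⊆S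
... | inj₁ h = inj₁ (ℕ.≤-trans (rank-⊆ M (tauto 4 (λ a b t x → a ⊑ b ⇒ t ⊑ b ⇒ ⊢ (a ⊔ t) ⊔ x ⊑ b ⊔ x) A B T X A⊆B T⊆B)) h)
... | inj₂ hB with sA (X ∩ B) (X⊆S ∘ p∩q⊆p X B)
...   | inj₂ hA = inj₂ (ℕ.≤-trans (rank-part-antitone M X (p⊆p∪q T)) (part-step M X A⊆B hA hB))
...   | inj₁ hA with sT ((X ∩ B) ─ A) (subst ((X ∩ B) ─ A ⊆_) (sym (minor-ground M {A} B⊆S))
                      (tauto 3 (λ a b x → ⊢ (x ⊓ b) ∖ a ⊑ b ∖ a) A B X))
...     | inj₁ hT = inj₁ (begin
  rank M ((A ∪ T) ∪ X)
    ≤⟨ rank≤+ M {A ∪ ((T ∪ Y) ∩ B)} {(A ∪ T) ∪ X} {X ─ B}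
         (tauto 4 (λ a b t x → t ⊑ b ⇒ ⊢ (a ⊔ t) ⊔ x ⊑ (a ⊔ ((t ⊔ ((x ⊓ b) ∖ a)) ⊓ b)) ⊔ (x ∖ b)) A B T X T⊆B) ⟩
  rank M (A ∪ ((T ∪ Y) ∩ B)) + ∣ X ─ B ∣
    ≡⟨ cong (_+ ∣ X ─ B ∣) (rank-minor M A⊆B (T ∪ Y)) ⟨
  (rank (minor M A B) (T ∪ Y) + rank M A) + ∣ X ─ B ∣
    ≤⟨ ℕ.+-monoˡ-≤ ∣ X ─ B ∣ (ℕ.+-monoˡ-≤ (rank M A) hT) ⟩
  (rank (minor M A B) Y + rank M A) + ∣ X ─ B ∣
    ≡⟨ cong (_+ ∣ X ─ B ∣) rank-Y ⟩
  rank M (A ∪ (X ∩ B)) + ∣ X ─ B ∣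
    ≤⟨ ℕ.+-monoˡ-≤ ∣ X ─ B ∣ hA ⟩
  rank M (X ∩ B) + ∣ X ─ B ∣
    ≤⟨ hB ⟩
  rank M X ∎)
  where
  open ℕ.≤-Reasoning
  Y = (X ∩ B) ─ A
  rank-Y : rank (minor M A B) Y + rank M A ≡ rank M (A ∪ (X ∩ B))
  rank-Y = trans (rank-minor M A⊆B Y)
    (cong (rank M) (tauto 3 (λ a b x → ⊢ a ⊔ (((x ⊓ b) ∖ a) ⊓ b) ≐ a ⊔ (x ⊓ b)) A B X))
...     | inj₂ hT = inj₂ (begin
  rank M (X ∩ (A ∪ T)) + ∣ X ─ (A ∪ T) ∣
    ≤⟨ ℕ.+-mono-≤ (rank-⊆ M (tauto 4 (λ a b t x → t ⊑ b ⇒ ⊢ x ⊓ (a ⊔ t) ⊑ a ⊔ ((((x ⊓ b) ∖ a) ⊓ t) ⊓ b)) A B T X T⊆B))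
         (∣∣≤+ (X ─ (A ∪ T)) (Y ─ T) (X ─ B) (tauto 4 (λ a b t x → ⊢ x ∖ (a ⊔ t) ⊑ (((x ⊓ b) ∖ a) ∖ t) ⊔ (x ∖ b)) A B T X)) ⟩
  rank M (A ∪ ((Y ∩ T) ∩ B)) + (∣ Y ─ T ∣ + ∣ X ─ B ∣)
    ≡⟨ ℕ.+-assoc (rank M (A ∪ ((Y ∩ T) ∩ B))) _ _ ⟨
  (rank M (A ∪ ((Y ∩ T) ∩ B)) + ∣ Y ─ T ∣) + ∣ X ─ B ∣
    ≡⟨ cong (λ a → (a + ∣ Y ─ T ∣) + ∣ X ─ B ∣) (rank-minor M A⊆B (Y ∩ T)) ⟨
  ((rank (minor M A B) (Y ∩ T) + rank M A) + ∣ Y ─ T ∣) + ∣ X ─ B ∣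
    ≡⟨ cong (_+ ∣ X ─ B ∣) (+-swap (rank (minor M A B) (Y ∩ T)) (rank M A) ∣ Y ─ T ∣) ⟩
  ((rank (minor M A B) (Y ∩ T) + ∣ Y ─ T ∣) + rank M A) + ∣ X ─ B ∣
    ≤⟨ ℕ.+-monoˡ-≤ ∣ X ─ B ∣ (ℕ.+-monoˡ-≤ (rank M A) hT) ⟩
  (rank (minor M A B) Y + rank M A) + ∣ X ─ B ∣
    ≡⟨ cong (_+ ∣ X ─ B ∣) rank-Y ⟩
  rank M (A ∪ (X ∩ B)) + ∣ X ─ B ∣
    ≤⟨ ℕ.+-monoˡ-≤ ∣ X ─ B ∣ hA ⟩
  rank M (X ∩ B) + ∣ X ─ B ∣
    ≤⟨ hB ⟩
  rank M X ∎)
  where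
  open ℕ.≤-Reasoning
  Y = (X ∩ B) ─ A
  rank-Y : rank (minor M A B) Y + rank M A ≡ rank M (A ∪ (X ∩ B))
  rank-Y = trans (rank-minor M A⊆B Y)
    (cong (rank M) (tauto 3 (λ a b x → ⊢ a ⊔ (((x ⊓ b) ∖ a) ⊓ b) ≐ a ⊔ (x ⊓ b)) A B X))

-- Reducibility as a property of one subset and the rank function. Unlike a pair of factor matroids,
-- it is easily carried along an isomorphism or lifted from a minor.
ProperSep : Matroid n → Subset n → Set
ProperSep M T = T ⊆ ground M × Nonempty T × Nonempty (ground M ─ T) × FreeSep M T

properSep⇒product : {M : Matroid n} → ∀ {T} → ProperSep M T → ProperFreeProduct M
properSep⇒product {n} {M} {T} (T⊆S , (x , x∈T) , (y , h) , sep) =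
  let P , Q , neP , neQ , d , e = chainProduct-reducible M ch
  in P , Q , neP , neQ , d , ≋-trans {L = M} {chainProduct M D} {P □ Q}
       (≋-sym {M = chainProduct M D} {M} (freeSep-chain M ch (freeSep-⊥ M ∷ sep ∷ freeSep-ground M ∷ []))) e
  where
  D = ⊥ ∷ T ∷ ground M ∷ []
  ch : IsChain (ground M) D
  ch = refl , refl , ((λ h → contradiction h ∉⊥) , x , x∈T , ∉⊥) ∷
       (T⊆S , y , p─q⊆p (ground M) T h , x∉p─q {p = ground M} h) ∷ [-]

product⇒properSep : {M : Matroid n} → ProperFreeProduct M → ∃ (ProperSep M)
product⇒properSep {n} {M} (P , Q , neP , (y , y∈Q) , d , e) = ground P ,
  subst (ground P ⊆_) (sym S≡) (p⊆p∪q (ground Q)) , neP ,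
  (y , x∈p∧x∉q⇒x∈p─q (subst (y ∈_) (sym S≡) (q⊆p∪q (ground P) (ground Q) y∈Q)) (λ y∈P → d (y , x∈p∩q⁺ (y∈P , y∈Q)))) ,
  freeSep-product {M = M} P Q d e
  where
  S≡ : ground M ≡ ground P ∪ ground Q
  S≡ = trans (proj₁ e) (□-ground P Q d)

-- D is a maximal chain of free separators of M.
factorization : (M : Matroid n) → ∃ λ D → IsIrreducibleChain M D × chainProduct M D ≋ M
factorization {n} M = finish (go ⊥ (freeSep-⊥ M) (λ h → contradiction h ∉⊥) (⊃-wellFounded ⊥))
  where
  S = ground M
  Step : Subset n → Subset n → Set₁
  Step A B = A ⊂ B × Irreducible (minor M A B)

  minimal : ∀ {A} B → FreeSep M B → A ⊂ B → B ⊆ S → Acc _⊂_ B →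
            ∃ λ B → FreeSep M B × A ⊂ B × B ⊆ S × (∀ C → FreeSep M C → A ⊂ C → ¬ C ⊂ B)
  minimal {A} B sB A⊂B B⊆S (acc rs) with anySubset? (λ C → FreeSep? M C ×-dec (A ⊂? C) ×-dec (C ⊂? B))
  ... | yes (C , sC , A⊂C , C⊂B) = minimal C sC A⊂C (B⊆S ∘ proj₁ C⊂B) (rs C⊂B)
  ... | no none = B , sB , A⊂B , B⊆S , λ C sC A⊂C C⊂B → none (C , sC , A⊂C , C⊂B)

  irreducible-step : ∀ {A B} → FreeSep M A → FreeSep M B → A ⊂ B → B ⊆ S →
                     (∀ C → FreeSep M C → A ⊂ C → ¬ C ⊂ B) → Irreducible (minor M A B)
  irreducible-step {A} {B} sA sB (A⊆B , x , x∈B , x∉A) B⊆S none =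
    (x , subst (x ∈_) (sym g≡) (x∈p∧x∉q⇒x∈p─q x∈B x∉A)) , λ pfp →
    let T , T⊆g , (y , y∈T) , (z , z∈) , sT = product⇒properSep {M = minor M A B} pfp
        T⊆B─A : T ⊆ B ─ A
        T⊆B─A = subst (T ⊆_) g≡ T⊆g
        z∈g = p─q⊆p (ground (minor M A B)) T z∈
        z∈B─A = subst (z ∈_) g≡ z∈g
    in none (A ∪ T) (freeSep-refine M A⊆B B⊆S (λ {w} h → p─q⊆p B A (T⊆B─A h)) sA sB sT)
         (p⊆p∪q T , y , q⊆p∪q A T y∈T , x∉p─q {p = B} (T⊆B─A y∈T))
         ( (λ h → [ A⊆B , (λ k → p─q⊆p B A (T⊆B─A k)) ]′ (x∈p∪q⁻ A T h)) , z , p─q⊆p B A z∈B─A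
         , λ h → [ x∉p─q {p = B} z∈B─A , x∉p─q {p = ground (minor M A B)} z∈ ]′ (x∈p∪q⁻ A T h))
    where
    g≡ : ground (minor M A B) ≡ B ─ A
    g≡ = minor-ground M {A} B⊆S

  go : ∀ A → FreeSep M A → A ⊆ S → Acc (λ p q → q ⊂ p) A →
       ∃ λ D → List.last (A ∷ D) ≡ just S × Linked Step (A ∷ D) × All (FreeSep M) (A ∷ D)
  go A sA A⊆S (acc rs) with S ⊆? A
  ... | yes S⊆A = [] , cong just (⊆-antisym A⊆S S⊆A) , [-] , sA ∷ []
  ... | no ¬S⊆A with any? (λ x → (x ∈? S) ×-dec ¬? (x ∈? A))
  ...   | no none = ⊥-elim (¬S⊆A λ {x} x∈S → decidable-stable (x ∈? A) λ x∉A → none (x , x∈S , x∉A))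
  ...   | yes x∈S─A with minimal S (freeSep-ground M) (A⊆S , x∈S─A) id (⊂-wellFounded S)
  ...     | B , sB , A⊂B , B⊆S , min with go B sB B⊆S (rs A⊂B)
  ...       | D , last , l , seps = B ∷ D , last , (A⊂B , irreducible-step sA sB A⊂B B⊆S min) ∷ l , sA ∷ seps

  finish : (∃ λ D → List.last (⊥ ∷ D) ≡ just S × Linked Step (⊥ ∷ D) × All (FreeSep M) (⊥ ∷ D)) →
           ∃ λ D → IsIrreducibleChain M D × chainProduct M D ≋ M
  finish (D , last , l , seps) = ⊥ ∷ D , (refl , last , l) ,
    freeSep-chain M (refl , last , Linked.map proj₁ l) seps

-- Isomorphism

infix 4 _⇌_

-- A partial injection of the index sets. It is partial because m and n may differ and only the
-- ground sets correspond; both directions are stored as functions, so that images and preimages can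
-- be computed.
record _⇌_ (m n : ℕ) : Set where
  field
    to      : Fin m → Maybe (Fin n)
    from    : Fin n → Maybe (Fin m)
    to⇒from : ∀ {x y} → to x ≡ just y → from y ≡ just x
    from⇒to : ∀ {x y} → from y ≡ just x → to x ≡ just y

inverse : m ⇌ n → n ⇌ m
inverse σ = record { to = from ; from = to ; to⇒from = from⇒to ; from⇒to = to⇒from }
  where open _⇌_ σ

pullback : (Fin n → Maybe (Fin m)) → Subset m → Subset n
pullback h A = Vec.tabulate λ y → maybe′ (Vec.lookup A) outside (h y)

lookup-pullback : ∀ (h : Fin n → Maybe (Fin m)) A y → Vec.lookup (pullback h A) y ≡ maybe′ (Vec.lookup A) outside (h y)
lookup-pullback h A y = Vec.lookup∘tabulate _ y

lookup-injective : ∀ {p q : Subset n} → (∀ x → Vec.lookup p x ≡ Vec.lookup q x) → p ≡ q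
lookup-injective {p = p} {q} h =
  trans (sym (Vec.tabulate∘lookup p)) (trans (Vec.tabulate-cong h) (Vec.tabulate∘lookup q))

module _ (σ : m ⇌ n) where
  open _⇌_ σ

  image : Subset m → Subset n
  image = pullback from

  -- A point outside the range lies in no image, hence the condition that f sends two absences to an
  -- absence; this excludes complementation but admits difference.
  image-pointwise : (f : Bool → Bool → Bool) → f false false ≡ false → ∀ A B C →
    (∀ x → Vec.lookup C x ≡ f (Vec.lookup A x) (Vec.lookup B x)) →
    ∀ y → Vec.lookup (image C) y ≡ f (Vec.lookup (image A) y) (Vec.lookup (image B) y)
  image-pointwise f f-false A B C h y
    rewrite lookup-pullback from A y | lookup-pullback from B y | lookup-pullback from C y with from y
  ... | just x  = h x
  ... | nothing = sym f-false

  image-∪ : ∀ A B → image (A ∪ B) ≡ image A ∪ image B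
  image-∪ A B = lookup-injective λ y → trans
    (image-pointwise _∨_ refl A B (A ∪ B) (λ x → Vec.lookup-zipWith _∨_ x A B) y)
    (sym (Vec.lookup-zipWith _∨_ y (image A) (image B)))

  image-∩ : ∀ A B → image (A ∩ B) ≡ image A ∩ image B
  image-∩ A B = lookup-injective λ y → trans
    (image-pointwise _∧_ refl A B (A ∩ B) (λ x → Vec.lookup-zipWith _∧_ x A B) y)
    (sym (Vec.lookup-zipWith _∧_ y (image A) (image B)))

  image-─ : ∀ A B → image (A ─ B) ≡ image A ─ image B
  image-─ A B = lookup-injective λ y → trans
    (image-pointwise (λ a b → a ∧ not b) refl A B (A ─ B) (λ x → lookup-─ A B x) y)
    (sym (lookup-─ (image A) (image B) y))

  ∈-image⁻ : ∀ {A y} → y ∈ image A → ∃ λ x → from y ≡ just x × x ∈ A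
  ∈-image⁻ {A} {y} h with from y | trans (sym (lookup-pullback from A y)) (Vec.[]=⇒lookup h)
  ... | just x | e = x , refl , Vec.lookup⇒[]= x A e

  ∈-image⁺ : ∀ {A x y} → to x ≡ just y → x ∈ A → y ∈ image A
  ∈-image⁺ {A} {x} {y} e x∈A = Vec.lookup⇒[]= y (image A)
    (trans (lookup-pullback from A y) (trans (cong (maybe′ (Vec.lookup A) outside) (to⇒from e)) (Vec.[]=⇒lookup x∈A)))

  image-⊆ : ∀ {A B} → A ⊆ B → image A ⊆ image B
  image-⊆ A⊆B h = let x , e , x∈A = ∈-image⁻ h in ∈-image⁺ (from⇒to e) (A⊆B x∈A)

  image-⊥ : image ⊥ ≡ ⊥
  image-⊥ = ⊆-antisym (λ h → contradiction (proj₂ (proj₂ (∈-image⁻ h))) ∉⊥) (λ h → contradiction h ∉⊥)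

  ∣image∣≤ : ∀ A → ∣ image A ∣ ≤ ∣ A ∣
  ∣image∣≤ A = go A (⊂-wellFounded A)
    where
    go : ∀ A → Acc _⊂_ A → ∣ image A ∣ ≤ ∣ A ∣
    go A (acc rs) with nonempty? (image A)
    ... | no  e = subst (_≤ ∣ A ∣) (sym (trans (cong ∣_∣ (Empty-unique e)) (∣⊥∣≡0 n))) z≤n
    ... | yes (y , h) with ∈-image⁻ h
    ...   | x , e , x∈A = subst₂ _≤_ (sym (∣-∣ h)) (sym (∣-∣ x∈A)) (s≤s (ℕ.≤-trans
      (∣∣-mono (image A - y) (image (A - x)) sub) (go (A - x) (rs (x∈p⇒p-x⊂p x∈A)))))
      where
      sub : image A - y ⊆ image (A - x)
      sub {z} k = let x′ , e′ , x′∈A = ∈-image⁻ {A} (p─q⊆p (image A) ⁅ y ⁆ k) in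
        ∈-image⁺ {A - x} (from⇒to e′) (x∈p∧x≢y⇒x∈p-y {p = A} x′∈A
          λ { refl → x∉⁅y⁆⇒x≢y (x∉p─q {p = image A} k) (Maybe.just-injective (trans (sym (from⇒to e′)) (from⇒to e))) })

-- The hypothesis is a way to say that σ is defined on all of A.
image-inverse : (σ : m ⇌ n) → ∀ {A Z} → A ⊆ image (inverse σ) Z → image (inverse σ) (image σ A) ≡ A
image-inverse σ {A} {Z} A⊆ = ⊆-antisym
  (λ h → let y , e , y∈ = ∈-image⁻ (inverse σ) h
             x , e′ , x∈A = ∈-image⁻ σ y∈
         in subst (_∈ A) (Maybe.just-injective (trans (sym e′) (to⇒from e))) x∈A)
  (λ h → let y , e , _ = ∈-image⁻ (inverse σ) {Z} (A⊆ h) in ∈-image⁺ (inverse σ) (to⇒from e) (∈-image⁺ σ e h))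
  where open _⇌_ σ

∣image∣ : (σ : m ⇌ n) → ∀ {A Z} → A ⊆ image (inverse σ) Z → ∣ image σ A ∣ ≡ ∣ A ∣
∣image∣ σ {A} {Z} A⊆ = ℕ.≤-antisym (∣image∣≤ σ A)
  (subst (λ B → ∣ B ∣ ≤ ∣ image σ A ∣) (image-inverse σ {Z = Z} A⊆) (∣image∣≤ (inverse σ) (image σ A)))

-- The first equation makes every point of U the image of a point of S, the second makes σ defined
-- on all of S; neither implies the other.
record GroundIso (σ : m ⇌ n) (S : Subset m) (U : Subset n) : Set where
  field
    image≡    : image σ S ≡ U
    preimage≡ : image (inverse σ) U ≡ S

  back : ∀ {A} → A ⊆ S → image (inverse σ) (image σ A) ≡ A
  back {A} A⊆S = image-inverse σ {Z = U} (subst (A ⊆_) (sym preimage≡) A⊆S)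

  card : ∀ {A} → A ⊆ S → ∣ image σ A ∣ ≡ ∣ A ∣
  card {A} A⊆S = ∣image∣ σ {Z = U} (subst (A ⊆_) (sym preimage≡) A⊆S)

  image⊆ : ∀ {A} → A ⊆ S → image σ A ⊆ U
  image⊆ {A} A⊆S = subst (image σ A ⊆_) image≡ (image-⊆ σ A⊆S)

  image-nonempty : ∀ {A} → A ⊆ S → Nonempty A → Nonempty (image σ A)
  image-nonempty {A} A⊆S (x , x∈A) with ∈-image⁻ (inverse σ) (subst (x ∈_) (sym (back A⊆S)) x∈A)
  ... | y , _ , y∈ = y , y∈

  image-⊂ : ∀ {A B} → B ⊆ S → A ⊂ B → image σ A ⊂ image σ B
  image-⊂ {A} {B} B⊆S (A⊆B , x , x∈B , x∉A)
    with image-nonempty {B ─ A} (B⊆S ∘ p─q⊆p B A) (x , x∈p∧x∉q⇒x∈p─q x∈B x∉A)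
  ... | y , h = image-⊆ σ A⊆B , y , p─q⊆p (image σ B) (image σ A) h′ , x∉p─q {p = image σ B} h′
    where
    h′ = subst (y ∈_) (image-─ σ B A) h

groundIso-sym : {σ : m ⇌ n} → ∀ {S U} → GroundIso σ S U → GroundIso (inverse σ) U S
groundIso-sym g = record { image≡ = preimage≡ ; preimage≡ = image≡ }
  where open GroundIso g

-- Stated with ranks, because minors and free separators are described by ranks. X is arbitrary, as
-- points outside the ground sets do not contribute.
record RankIso (σ : m ⇌ n) (P : Matroid m) (Q : Matroid n) : Set where
  field
    groundIso : GroundIso σ (ground P) (ground Q)
    rank≡     : ∀ X → rank Q (image σ X) ≡ rank P X
  open GroundIso groundIso public

rank-∩ground : (M : Matroid n) → ∀ X → rank M (X ∩ ground M) ≡ rank M X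
rank-∩ground M X = ℕ.≤-antisym (rank-⊆ M (p∩q⊆p X (ground M))) (rank-mono M id)

rankIso-sym : {σ : m ⇌ n} {P : Matroid m} {Q : Matroid n} → RankIso σ P Q → RankIso (inverse σ) Q P
rankIso-sym {σ = σ} {P} {Q} r = record { groundIso = groundIso-sym groundIso ; rank≡ = eq }
  where
  open RankIso r
  open ≡-Reasoning
  S = ground P
  U = ground Q
  eq : ∀ Y → rank P (image (inverse σ) Y) ≡ rank Q Y
  eq Y = begin
    rank P (image (inverse σ) Y)                        ≡⟨ rank-∩ground P _ ⟨
    rank P (image (inverse σ) Y ∩ S)                    ≡⟨ cong (λ Z → rank P (image (inverse σ) Y ∩ Z)) preimage≡ ⟨
    rank P (image (inverse σ) Y ∩ image (inverse σ) U)  ≡⟨ cong (rank P) (image-∩ (inverse σ) Y U) ⟨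
    rank P (image (inverse σ) (Y ∩ U))                  ≡⟨ rank≡ _ ⟨
    rank Q (image σ (image (inverse σ) (Y ∩ U)))        ≡⟨ cong (rank Q) (GroundIso.back (groundIso-sym groundIso) (p∩q⊆q Y U)) ⟩
    rank Q (Y ∩ U)                                      ≡⟨ rank-∩ground Q Y ⟩
    rank Q Y                                            ∎

bases⇒rankIso : {σ : m ⇌ n} {P : Matroid m} {Q : Matroid n} → GroundIso σ (ground P) (ground Q) →
  (∀ B → Basis P B → Basis Q (image σ B)) → (∀ C → Basis Q C → Basis P (image (inverse σ) C)) → RankIso σ P Q
bases⇒rankIso {σ = σ} {P} {Q} g f h = record { groundIso = g ; rank≡ = λ X → ℕ.≤-antisym
    (ℕ.≤-trans (le (groundIso-sym g) h (image σ X)) (rank-⊆ P (back⊆ X)))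
    (le g f X) }
  where
  back⊆ : ∀ X → image (inverse σ) (image σ X) ⊆ X
  back⊆ X k with ∈-image⁻ (inverse σ) k
  ... | y , e , y∈ with ∈-image⁻ σ y∈
  ...   | x , e′ , x∈X = subst (_∈ X) (Maybe.just-injective (trans (sym e′) (_⇌_.to⇒from σ e))) x∈X
  le : ∀ {m n} {σ : m ⇌ n} {P : Matroid m} {Q : Matroid n} → GroundIso σ (ground P) (ground Q) →
       (∀ B → Basis P B → Basis Q (image σ B)) → ∀ X → rank P X ≤ rank Q (image σ X)
  le {σ = σ} {P} {Q} g f X with rank-attained P X
  ... | I , (B , b , I⊆B) , I⊆X , e = subst (_≤ rank Q (image σ X))
    (trans (GroundIso.card g (Matroid.basis⊆ P B b ∘ I⊆B)) e)
    (indep≤rank Q (image σ B , f B b , image-⊆ σ I⊆B) (image-⊆ σ I⊆X))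

module _ {σ : m ⇌ n} {P : Matroid m} {Q : Matroid n} (r : RankIso σ P Q) where
  open RankIso r

  rankIso-ρ : ρ Q ≡ ρ P
  rankIso-ρ = trans (sym (rank-ground Q id)) (trans (cong (rank Q) (sym image≡)) (trans (rank≡ _) (rank-ground P id)))

  rankIso-basis : ∀ {B} → Basis P B → Basis Q (image σ B)
  rankIso-basis {B} b = rank⇒basis Q
    (ℕ.≤-reflexive (trans (card (Matroid.basis⊆ P B b)) (trans (equicardinal P b) (sym rankIso-ρ))))
    (ℕ.≤-reflexive (trans rankIso-ρ (trans (sym (basis⇒rank P b)) (sym (rank≡ B)))))

  rankIso-minor : ∀ {A B} → A ⊆ B → B ⊆ ground P → RankIso σ (minor P A B) (minor Q (image σ A) (image σ B))
  rankIso-minor {A} {B} A⊆B B⊆S = record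
    { groundIso = record
      { image≡ = trans (image-─ σ (ground P ∩ B) A) (cong (_─ image σ A) (trans (image-∩ σ (ground P) B) (cong (_∩ image σ B) image≡)))
      ; preimage≡ = trans (image-─ (inverse σ) (ground Q ∩ image σ B) (image σ A)) (cong₂ _─_
          (trans (image-∩ (inverse σ) (ground Q) (image σ B)) (cong₂ _∩_ preimage≡ (back B⊆S))) (back (B⊆S ∘ A⊆B)))
      }
    ; rank≡ = λ X → ℕ.+-cancelʳ-≡ (rank P A) _ _ (begin
        rank (minor Q A′ B′) (image σ X) + rank P A    ≡⟨ cong (rank (minor Q A′ B′) (image σ X) +_) (rank≡ A) ⟨
        rank (minor Q A′ B′) (image σ X) + rank Q A′   ≡⟨ rank-minor Q (image-⊆ σ A⊆B) (image σ X) ⟩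
        rank Q (A′ ∪ (image σ X ∩ B′))                 ≡⟨ cong (λ Z → rank Q (A′ ∪ Z)) (image-∩ σ X B) ⟨
        rank Q (A′ ∪ image σ (X ∩ B))                  ≡⟨ cong (rank Q) (image-∪ σ A (X ∩ B)) ⟨
        rank Q (image σ (A ∪ (X ∩ B)))                 ≡⟨ rank≡ _ ⟩
        rank P (A ∪ (X ∩ B))                           ≡⟨ rank-minor P A⊆B X ⟨
        rank (minor P A B) X + rank P A                ∎)
    }
    where
    A′ = image σ A
    B′ = image σ B
    open ≡-Reasoning

  rankIso-freeSep : ∀ {T} → FreeSep P T → FreeSep Q (image σ T)
  rankIso-freeSep {T} sep Y Y⊆U = subst Goal (GroundIso.back (groundIso-sym groundIso) Y⊆U)
    (Sum.map (subst₂ _≤_ e₁ (sym (rank≡ X))) (subst₂ _≤_ e₂ (sym (rank≡ X))) (sep X X⊆S))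
    where
    Goal : Subset _ → Set
    Goal Y = rank Q (image σ T ∪ Y) ≤ rank Q Y ⊎ rank Q (Y ∩ image σ T) + ∣ Y ─ image σ T ∣ ≤ rank Q Y
    X = image (inverse σ) Y
    X⊆S : X ⊆ ground P
    X⊆S = GroundIso.image⊆ (groundIso-sym groundIso) Y⊆U
    e₁ : rank P (T ∪ X) ≡ rank Q (image σ T ∪ image σ X)
    e₁ = trans (sym (rank≡ _)) (cong (rank Q) (image-∪ σ T X))
    e₂ : rank P (X ∩ T) + ∣ X ─ T ∣ ≡ rank Q (image σ X ∩ image σ T) + ∣ image σ X ─ image σ T ∣
    e₂ = cong₂ _+_ (trans (sym (rank≡ _)) (cong (rank Q) (image-∩ σ X T)))
                   (trans (sym (card (X⊆S ∘ p─q⊆p X T))) (cong ∣_∣ (image-─ σ X T)))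

  rankIso-properSep : ∀ {T} → ProperSep P T → ProperSep Q (image σ T)
  rankIso-properSep {T} (T⊆S , ne , ne′ , sep) = image⊆ T⊆S , image-nonempty T⊆S ne ,
    subst Nonempty (trans (image-─ σ (ground P) T) (cong (_─ image σ T) image≡)) (image-nonempty (p─q⊆p (ground P) T) ne′) ,
    rankIso-freeSep sep

rankIso-irreducible : {σ : m ⇌ n} {P : Matroid m} {Q : Matroid n} → RankIso σ P Q → Irreducible P → Irreducible Q
rankIso-irreducible {P = P} {Q} r (ne , irr) = subst Nonempty image≡ (image-nonempty id ne) ,
  λ pfp → irr (properSep⇒product {M = P} (rankIso-properSep (rankIso-sym r) (proj₂ (product⇒properSep {M = Q} pfp))))
  where open RankIso r

linked-⊆ : ∀ {S : Subset n} D → List.last D ≡ just S → Linked _⊂_ D → Linked (λ A B → A ⊂ B × B ⊆ S) D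
linked-⊆ []          _ _       = []
linked-⊆ (A ∷ [])    _ _       = [-]
linked-⊆ (A ∷ B ∷ D) e (h ∷ l) = (h , last-⊆ D e l) ∷ linked-⊆ (B ∷ D) e l

last-map : ∀ {A B : Set} (f : A → B) xs {x} → List.last xs ≡ just x → List.last (List.map f xs) ≡ just (f x)
last-map f (x ∷ [])     refl = refl
last-map f (x ∷ y ∷ xs) e    = last-map f (y ∷ xs) e

head-map : ∀ {A B : Set} (f : A → B) xs {x} → List.head xs ≡ just x → List.head (List.map f xs) ≡ just (f x)
head-map f (x ∷ xs) refl = refl

module _ {σ : m ⇌ n} {M : Matroid m} {N : Matroid n} (r : RankIso σ M N) where
  open RankIso r

  rankIso-isChain : ∀ {D} → IsChain (ground M) D → IsChain (ground N) (List.map (image σ) D)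
  rankIso-isChain {D} (h , l , linked) = trans (head-map (image σ) D h) (cong just (image-⊥ σ)) ,
    trans (last-map (image σ) D l) (cong just image≡) ,
    Linked.map⁺ (Linked.map (λ { {A} {B} (A⊂B , B⊆S) → image-⊂ B⊆S A⊂B }) (linked-⊆ D l linked))

  rankIso-chain : ∀ {D} → IsIrreducibleChain M D → IsIrreducibleChain N (List.map (image σ) D)
  rankIso-chain {D} (h , l , steps) with rankIso-isChain {D} (h , l , Linked.map proj₁ steps)
  ... | h′ , l′ , _ = h′ , l′ ,
    Linked.map⁺ (Linked.map (λ { {A} {B} ((A⊂B , irr) , (_ , B⊆S)) →
        image-⊂ B⊆S A⊂B , rankIso-irreducible (rankIso-minor r (proj₁ A⊂B) B⊆S) irr })
      (Linked.zip (steps , linked-⊆ D l (Linked.map proj₁ steps))))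

  chain-back : ∀ {D} → IsChain (ground M) D → List.map (image (inverse σ)) (List.map (image σ) D) ≡ D
  chain-back {D} (_ , l , linked) = go D l linked
    where
    go : ∀ D → List.last D ≡ just (ground M) → Linked _⊂_ D → List.map (image (inverse σ)) (List.map (image σ) D) ≡ D
    go []          ()   _
    go (A ∷ [])    e    _       = cong (_∷ []) (back (last-⊆ [] e [-]))
    go (A ∷ B ∷ D) e l@(_ ∷ l′) = cong₂ _∷_ (back (last-⊆ (B ∷ D) e l)) (go (B ∷ D) e l′)

  image-product-basis : ∀ {D} → IsChain (ground M) D → ∀ B →
    Basis (chainProduct M D) B → Basis (chainProduct N (List.map (image σ) D)) (image σ B)
  image-product-basis {D} ch B b with Equivalence.to (chainProduct-basis M ch) b
  ... | B⊆ , c , f = Equivalence.from (chainProduct-basis N (rankIso-isChain {D} ch))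
    ( image⊆ B⊆ , trans (card B⊆) (trans c (sym (rankIso-ρ r)))
    , Linked.map⁺ (Linked.map (λ {A} {C} h → subst₂ _≤_ (sym (rankIso-ρ r)) (cong₂ _+_
        (trans (sym (rank≡ _)) (cong (rank N) (trans (image-∪ σ A (B ∩ C)) (cong (image σ A ∪_) (image-∩ σ B C)))))
        (trans (sym (card (B⊆ ∘ p─q⊆p B C))) (cong ∣_∣ (image-─ σ B C)))) h) f))

rankIso-product : {σ : m ⇌ n} {M : Matroid m} {N : Matroid n} (r : RankIso σ M N) → ∀ {D} → IsChain (ground M) D →
                  RankIso σ (chainProduct M D) (chainProduct N (List.map (image σ) D))
rankIso-product {σ = σ} {M} {N} r {D} ch = bases⇒rankIso
  (record { image≡    = trans (cong (image σ) (chainProduct-ground M ch)) (trans image≡ (sym (chainProduct-ground N ch′)))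
          ; preimage≡ = trans (cong (image (inverse σ)) (chainProduct-ground N ch′)) (trans preimage≡ (sym (chainProduct-ground M ch))) })
  (image-product-basis r ch)
  (λ C c → subst (λ E → Basis (chainProduct M E) (image (inverse σ) C)) (chain-back r ch)
             (image-product-basis (rankIso-sym r) ch′ C c))
  where
  open RankIso r
  ch′ = rankIso-isChain r {D} ch

Iso : Matroid m → Matroid n → Set
Iso {m} {n} M N = ∃ λ (σ : m ⇌ n) → RankIso σ M N

iso-sym : {M : Matroid m} {N : Matroid n} → Iso M N → Iso N M
iso-sym (σ , r) = inverse σ , rankIso-sym r

identity : n ⇌ n
identity = record { to = just ; from = just ; to⇒from = λ { refl → refl } ; from⇒to = λ { refl → refl } }

image-identity : (A : Subset n) → image identity A ≡ A
image-identity A = lookup-injective (lookup-pullback just A)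

≋⇒iso : {M N : Matroid n} → M ≋ N → Iso M N
≋⇒iso {M = M} {N} e = identity , record
  { groundIso = record { image≡ = trans (image-identity _) (proj₁ e) ; preimage≡ = trans (image-identity _) (sym (proj₁ e)) }
  ; rank≡ = λ X → trans (cong (rank N) (image-identity X)) (sym (rank-≋ {M = M} {N} e X)) }

_⨾_ : ∀ {l m n} → l ⇌ m → m ⇌ n → l ⇌ n
σ ⨾ τ = record
  { to      = λ x → to σ x >>= to τ
  ; from    = λ z → from τ z >>= from σ
  ; to⇒from = λ {x} → compose (to σ) (to τ) (from τ) (from σ) (to⇒from σ) (to⇒from τ) x
  ; from⇒to = λ {x} {z} → compose (from τ) (from σ) (to σ) (to τ) (from⇒to τ) (from⇒to σ) z
  }
  where
  open _⇌_
  compose : ∀ {l m n} (f : Fin l → Maybe (Fin m)) (g : Fin m → Maybe (Fin n)) (g′ : Fin n → Maybe (Fin m))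
            (f′ : Fin m → Maybe (Fin l)) → (∀ {x y} → f x ≡ just y → f′ y ≡ just x) →
            (∀ {y z} → g y ≡ just z → g′ z ≡ just y) → ∀ x {z} →
            (f x >>= g) ≡ just z → (g′ z >>= f′) ≡ just x
  compose f g g′ f′ hf hg x e with f x in eq
  ... | just y = trans (cong (_>>= f′) (hg e)) (hf eq)

image-⨾ : ∀ {l m n} (σ : l ⇌ m) (τ : m ⇌ n) A → image (σ ⨾ τ) A ≡ image τ (image σ A)
image-⨾ σ τ A = lookup-injective λ z → trans (lookup-pullback (from (σ ⨾ τ)) A z)
  (trans (bind (from τ z)) (sym (lookup-pullback (from τ) (image σ A) z)))
  where
  open _⇌_
  bind : ∀ y → maybe′ (Vec.lookup A) outside (y >>= from σ) ≡ maybe′ (Vec.lookup (image σ A)) outside y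
  bind nothing  = refl
  bind (just y) = sym (lookup-pullback (from σ) A y)

iso-trans : ∀ {l m n} {L : Matroid l} {M : Matroid m} {N : Matroid n} → Iso L M → Iso M N → Iso L N
iso-trans {L = L} {N = N} (σ , r) (τ , s) = σ ⨾ τ , record
  { groundIso = record
    { image≡    = trans (image-⨾ σ τ (ground L)) (trans (cong (image τ) R.image≡) S.image≡)
    ; preimage≡ = trans (image-⨾ (inverse τ) (inverse σ) (ground N)) (trans (cong (image (inverse σ)) S.preimage≡) R.preimage≡)
    }
  ; rank≡ = λ X → trans (cong (rank N) (image-⨾ σ τ X)) (trans (S.rank≡ (image σ X)) (R.rank≡ X))
  }
  where
  module R = RankIso r
  module S = RankIso s

-- Partial maps are coded by a finite type, which makes the search for an isomorphism finite.
predecessor : Fin (suc n) → Maybe (Fin n)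
predecessor zero    = nothing
predecessor (suc i) = just i

decode : Fin (suc n ℕ.^ m) → Fin m → Maybe (Fin n)
decode c x = predecessor (finToFun c x)

decode-surjective : (h : Fin m → Maybe (Fin n)) → ∃ λ c → ∀ x → decode {n} {m} c x ≡ h x
decode-surjective h = funToFin f , λ x → trans (cong predecessor (finToFun-funToFin f x)) (section (h x))
  where
  code : Maybe (Fin _) → Fin (suc _)
  code = maybe′ suc zero
  f = code ∘ h
  section : ∀ y → predecessor (code y) ≡ y
  section nothing  = refl
  section (just y) = refl

pullback-cong : {h h′ : Fin n → Maybe (Fin m)} → (∀ y → h y ≡ h′ y) → ∀ A → pullback h A ≡ pullback h′ A
pullback-cong e A = Vec.tabulate-cong λ y → cong (maybe′ (Vec.lookup A) outside) (e y)

iso? : (M : Matroid m) (N : Matroid n) → Dec (Iso M N)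
iso? {m} {n} M N = map′ fwd bwd (any? λ c → any? λ d → spec? (decode c) (decode d))
  where
  Spec : (Fin m → Maybe (Fin n)) → (Fin n → Maybe (Fin m)) → Set
  Spec h k = ((∀ x y → h x ≡ just y → k y ≡ just x) × (∀ x y → k y ≡ just x → h x ≡ just y)) ×
    (pullback k (ground M) ≡ ground N × pullback h (ground N) ≡ ground M) ×
    (∀ X → rank N (pullback k X) ≡ rank M X)
  spec? : ∀ h k → Dec (Spec h k)
  spec? h k =
    ((all? λ x → all? λ y → Maybe.≡-dec Fin._≟_ (h x) (just y) →-dec Maybe.≡-dec Fin._≟_ (k y) (just x)) ×-dec
     (all? λ x → all? λ y → Maybe.≡-dec Fin._≟_ (k y) (just x) →-dec Maybe.≡-dec Fin._≟_ (h x) (just y))) ×-dec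
    (Vec.≡-dec Bool._≟_ _ _ ×-dec Vec.≡-dec Bool._≟_ _ _) ×-dec
    allSubset? (λ X → rank N (pullback k X) ℕ.≟ rank M X)
  fwd : (∃ λ c → ∃ λ d → Spec (decode c) (decode d)) → Iso M N
  fwd (c , d , (i , j) , (s , u) , r) =
    record { to = decode c ; from = decode d ; to⇒from = i _ _ ; from⇒to = j _ _ } ,
    record { groundIso = record { image≡ = s ; preimage≡ = u } ; rank≡ = r }
  bwd : Iso M N → ∃ λ c → ∃ λ d → Spec (decode c) (decode d)
  -- The decoded maps agree with those of σ only pointwise, so each condition is carried over
  -- separately.
  bwd (σ , r) with decode-surjective (_⇌_.to σ) | decode-surjective (_⇌_.from σ)
  ... | c , ec | d , ed = c , d ,
    ( (λ x y e → trans (ed y) (to⇒from (trans (sym (ec x)) e)))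
    , (λ x y e → trans (ec x) (from⇒to (trans (sym (ed y)) e)))) ,
    (trans (pullback-cong ed (ground M)) image≡ , trans (pullback-cong ec (ground N)) preimage≡) ,
    λ X → trans (cong (rank N) (pullback-cong ed X)) (rank≡ X)
    where
    open _⇌_ σ
    open RankIso r

module _ {S : Subset m} {U : Subset n} (f : (∃ λ x → x ∈ S) → (∃ λ y → y ∈ U)) where

  partial : Fin m → Maybe (Fin n)
  partial x with x ∈? S
  ... | yes p = just (proj₁ (f (x , p)))
  ... | no  _ = nothing

  -- The test `x ∈? S` may return another proof than p; proofs of membership in a subset are unique,
  -- so the value of f is the same.
  partial-∈ : ∀ {x} (p : x ∈ S) → partial x ≡ just (proj₁ (f (x , p)))
  partial-∈ {x} p with x ∈? S
  ... | yes q = cong (λ r → just (proj₁ (f (x , r)))) ([]=-irrelevant q p)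
  ... | no ∉S = contradiction p ∉S

  partial-just : ∀ {x y} → partial x ≡ just y → ∃ λ (p : x ∈ S) → proj₁ (f (x , p)) ≡ y
  partial-just {x} e with x ∈? S
  partial-just refl | yes p = p , refl

partial-inverse : {S : Subset m} {U : Subset n} (f : (∃ λ x → x ∈ S) → (∃ λ y → y ∈ U))
  (g : (∃ λ y → y ∈ U) → (∃ λ x → x ∈ S)) → (∀ x → g (f x) ≡ x) →
  ∀ {x y} → partial f x ≡ just y → partial g y ≡ just x
partial-inverse f g gf {x} e with partial-just f e
... | p , refl = trans (partial-∈ g (proj₂ (f (x , p)))) (cong (just ∘ proj₁) (gf (x , p)))

≅⇒iso : {M : Matroid m} {N : Matroid n} → M ≅ N → Iso M N
≅⇒iso {m} {n} {M} {N} i = σ , bases⇒rankIso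
    (record { image≡ = img (λ {x} → partial-∈ g {x}) (partial-just g) (_⇌_.from⇒to σ)
            ; preimage≡ = img′ (λ {x} → partial-∈ f {x}) (partial-just f) (_⇌_.to⇒from σ) })
    (λ B b → let B⊆ = λ {x} → Matroid.basis⊆ M B b {x} in
       Equivalence.to (basis⇔ B (image σ B) B⊆ (λ {x} → image⊆U B⊆ {x}) λ x → mk⇔
         (∈-image⁺ σ (partial-∈ f (proj₂ x)))
         (λ h → let x′ , e , x′∈B = ∈-image⁻ σ h in subst (_∈ B)
            (Maybe.just-injective (trans (sym e) (_⇌_.to⇒from σ (partial-∈ f (proj₂ x))))) x′∈B)) b)
    (λ C c → let C⊆ = λ {x} → Matroid.basis⊆ N C c {x} in
       Equivalence.from (basis⇔ (image (inverse σ) C) C (λ {x} → image⊆S C⊆ {x}) C⊆ λ x → mk⇔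
         (λ h → let y , e , y∈C = ∈-image⁻ (inverse σ) h in subst (_∈ C)
            (Maybe.just-injective (trans (sym e) (partial-∈ f (proj₂ x)))) y∈C)
         (∈-image⁺ (inverse σ) (_⇌_.to⇒from σ (partial-∈ f (proj₂ x))))) c)
  where
  open _≅_ i
  f = Inverse.to bijection
  g = Inverse.from bijection
  σ : m ⇌ n
  σ = record { to = partial f ; from = partial g
             ; to⇒from = partial-inverse f g (Inverse.strictlyInverseʳ bijection)
             ; from⇒to = partial-inverse g f (Inverse.strictlyInverseˡ bijection) }
  img : (∀ {y} (q : y ∈ ground N) → partial g y ≡ just (proj₁ (g (y , q)))) →
        (∀ {y x} → partial g y ≡ just x → ∃ λ (q : y ∈ ground N) → proj₁ (g (y , q)) ≡ x) →
        (∀ {x y} → partial g y ≡ just x → partial f x ≡ just y) → image σ (ground M) ≡ ground N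
  img a b c = ⊆-antisym (λ h → let _ , e , _ = ∈-image⁻ σ {ground M} h in proj₁ (b e))
    (λ {y} q → ∈-image⁺ σ (c (a q)) (proj₂ (g (y , q))))
  img′ : (∀ {x} (p : x ∈ ground M) → partial f x ≡ just (proj₁ (f (x , p)))) →
        (∀ {x y} → partial f x ≡ just y → ∃ λ (p : x ∈ ground M) → proj₁ (f (x , p)) ≡ y) →
        (∀ {x y} → partial f x ≡ just y → partial g y ≡ just x) → image (inverse σ) (ground N) ≡ ground M
  img′ a b c = ⊆-antisym (λ h → let _ , e , _ = ∈-image⁻ (inverse σ) {ground N} h in proj₁ (b e))
    (λ {x} p → ∈-image⁺ (inverse σ) (c (a p)) (proj₂ (f (x , p))))
  image⊆U : ∀ {B} → B ⊆ ground M → image σ B ⊆ ground N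
  image⊆U {B} _ h = let _ , e , _ = ∈-image⁻ σ {B} h in proj₁ (partial-just g e)
  image⊆S : ∀ {C} → C ⊆ ground N → image (inverse σ) C ⊆ ground M
  image⊆S {C} _ h = let _ , e , _ = ∈-image⁻ (inverse σ) {C} h in proj₁ (partial-just f e)

iso⇒≅ : {M : Matroid m} {N : Matroid n} → Iso M N → M ≅ N
iso⇒≅ {m} {n} {M} {N} (σ , r) = record
  { bijection = mk↔ₛ′ f g
      (λ (y , q) → Σ-≡ (Maybe.just-injective (trans (sym (f-spec (g (y , q)))) (from⇒to (g-spec (y , q))))))
      (λ (x , p) → Σ-≡ (Maybe.just-injective (trans (sym (g-spec (f (x , p)))) (to⇒from (f-spec (x , p))))))
  ; basis⇔ = λ B C B⊆ C⊆ h → let C≡ = C≡image B C B⊆ C⊆ h in mk⇔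
      (λ b → subst (Basis N) (sym C≡) (rankIso-basis r b))
      (λ c → subst (Basis M) (trans (cong (image (inverse σ)) C≡) (back B⊆)) (rankIso-basis (rankIso-sym r) c))
  }
  where
  open _⇌_ σ
  open RankIso r
  Σ-≡ : ∀ {k} {S : Subset k} {x y} {p : x ∈ S} {q : y ∈ S} → x ≡ y → (x , p) ≡ (y , q)
  Σ-≡ {x = x} refl = cong (x ,_) ([]=-irrelevant _ _)
  F : ∀ x → x ∈ ground M → ∃ λ y → to x ≡ just y × y ∈ ground N
  F x p = ∈-image⁻ (inverse σ) (subst (x ∈_) (sym preimage≡) p)
  G : ∀ y → y ∈ ground N → ∃ λ x → from y ≡ just x × x ∈ ground M
  G y q = ∈-image⁻ σ (subst (y ∈_) (sym image≡) q)
  f : (∃ λ x → x ∈ ground M) → (∃ λ y → y ∈ ground N)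
  f (x , p) = let y , _ , q = F x p in y , q
  g : (∃ λ y → y ∈ ground N) → (∃ λ x → x ∈ ground M)
  g (y , q) = let x , _ , p = G y q in x , p
  f-spec : ∀ x → to (proj₁ x) ≡ just (proj₁ (f x))
  f-spec (x , p) = proj₁ (proj₂ (F x p))
  g-spec : ∀ y → from (proj₁ y) ≡ just (proj₁ (g y))
  g-spec (y , q) = proj₁ (proj₂ (G y q))
  C≡image : ∀ B C → B ⊆ ground M → C ⊆ ground N → (∀ x → proj₁ x ∈ B ⇔ proj₁ (f x) ∈ C) → C ≡ image σ B
  C≡image B C B⊆ C⊆ h = ⊆-antisym
    (λ {y} y∈C → let x = g (y , C⊆ y∈C)
                     e = from⇒to (g-spec (y , C⊆ y∈C))
                 in ∈-image⁺ σ e (Equivalence.from (h x)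
                      (subst (_∈ C) (Maybe.just-injective (trans (sym e) (f-spec x))) y∈C)))
    (λ {y} k → let x , e , x∈B = ∈-image⁻ σ k in
       subst (_∈ C) (Maybe.just-injective (trans (sym (f-spec (x , B⊆ x∈B))) (from⇒to e)))
         (Equivalence.to (h (x , B⊆ x∈B)) x∈B))

abstract
  -- Opaque, so that type checking never runs the search through all pairs of partial maps.
  ≅-dec : (M : Matroid m) (N : Matroid n) → Dec (M ≅ N)
  ≅-dec M N = map′ iso⇒≅ ≅⇒iso (iso? M N)

≅-sym : {M : Matroid m} {N : Matroid n} → M ≅ N → N ≅ M
≅-sym = iso⇒≅ ∘ iso-sym ∘ ≅⇒iso

≅-trans : ∀ {l m n} {L : Matroid l} {M : Matroid m} {N : Matroid n} → L ≅ M → M ≅ N → L ≅ N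
≅-trans i j = iso⇒≅ (iso-trans (≅⇒iso i) (≅⇒iso j))

≋⇒≅ : {M N : Matroid n} → M ≋ N → M ≅ N
≋⇒≅ {M = M} {N} e = iso⇒≅ (≋⇒iso {M = M} {N} e)

≅-refl : {M : Matroid n} → M ≅ M
≅-refl {M = M} = ≋⇒≅ {M = M} {M} (refl , λ _ → mk⇔ id id)

-- Enumeration of chains and bases

module _ {a b} {A : Set a} {B : Set b} {f : A → B} {g : B → A} where

  unique-map : ∀ {xs} → Unique xs → (∀ {x} → x ∈ˡ xs → g (f x) ≡ x) → Unique (List.map f xs)
  unique-map []       inv = []
  unique-map (x∉ ∷ u) inv = All.map⁺ (All.tabulate λ y∈ eq →
      All.lookup x∉ y∈ (trans (sym (inv (here refl))) (trans (cong g eq) (inv (there y∈)))))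
    ∷ unique-map u (inv ∘ there)

  -- Both lists are free of repetitions, so equality as sets is equality as multisets. The maps are
  -- assumed inverse on the entries only, since `image σ` and `image (inverse σ)` undo each other
  -- just within the ground sets.
  bijection⇒↭ : ∀ {xs ys} → Unique xs → Unique ys →
    (∀ {x} → x ∈ˡ xs → f x ∈ˡ ys × g (f x) ≡ x) → (∀ {y} → y ∈ˡ ys → g y ∈ˡ xs × f (g y) ≡ y) →
    List.map f xs ↭ ys
  bijection⇒↭ {xs} {ys} u v to from = ∼bag⇒↭ (unique∧set⇒bag (unique-map u (proj₂ ∘ to)) v (mk⇔
    (λ h → let x , x∈ , e = ∈-map⁻ f h in subst (_∈ˡ ys) (sym e) (proj₁ (to x∈)))
    (λ h → let gy∈ , e = from h in subst (_∈ˡ List.map f xs) e (∈-map⁺ f gy∈))))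

subsets-unique : ∀ n → Unique (subsets n)
subsets-unique zero    = [] ∷ []
subsets-unique (suc n) = Unique.cartesianProductWith⁺ _∷_ (λ { refl → refl , refl })
  (((λ ()) ∷ []) ∷ [] ∷ []) (subsets-unique n)

module _ {a} {A : Set a} where

  sequences-unique : ∀ k {xs : List A} → Unique xs → Unique (sequences k xs)
  sequences-unique zero    u = [] ∷ []
  sequences-unique (suc k) {xs} u = All.tabulate (λ h e → nonempty (subst (_∈ˡ _) (sym e) h)) ∷
    Unique.cartesianProductWith⁺ _∷_ List.∷-injective u (sequences-unique k u)
    where
    nonempty : ¬ [] ∈ˡ cartesianProductWith _∷_ xs (sequences k xs)
    nonempty h with ∈-cartesianProductWith⁻ _∷_ xs (sequences k xs) h
    ... | _ , _ , _ , _ , ()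

  sequences-complete : ∀ k {xs D : List A} → List.length D ≤ k → All (_∈ˡ xs) D → D ∈ˡ sequences k xs
  sequences-complete zero    {D = []}    _       _        = here refl
  sequences-complete (suc k) {D = []}    _       _        = here refl
  sequences-complete (suc k) {D = _ ∷ _} (s≤s le) (p ∷ ps) =
    there (∈-cartesianProductWith⁺ _∷_ p (sequences-complete k le ps))

-- Each step adds a point, so at most n sets follow the first one; this is the length bound built
-- into `IC`.
chain-length : ∀ {A : Subset n} D → Linked _⊂_ (A ∷ D) → List.length D + ∣ A ∣ ≤ n
chain-length {A = A} []      _          = ∣p∣≤n A
chain-length {A = A} (B ∷ D) (A⊂B ∷ l) = ℕ.≤-trans
  (ℕ.≤-trans (ℕ.≤-reflexive (sym (ℕ.+-suc (List.length D) ∣ A ∣))) (ℕ.+-monoʳ-≤ (List.length D) (p⊂q⇒∣p∣<∣q∣ A⊂B)))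
  (chain-length D l)

linked∈sequences : ∀ {D : List (Subset n)} → Linked _⊂_ D → D ∈ˡ sequences (suc n) (subsets n)
linked∈sequences {n} {D} l = sequences-complete (suc n) (bound D l) (All.tabulate λ {p} _ → subsets-complete p)
  where
  bound : ∀ D → Linked _⊂_ D → List.length D ≤ suc n
  bound []      _ = z≤n
  bound (A ∷ D) l = s≤s (ℕ.≤-trans (ℕ.m≤m+n _ _) (chain-length D l))

chain⇒isChain : {M : Matroid n} → ∀ {D} → IsIrreducibleChain M D → IsChain (ground M) D
chain⇒isChain (h , l , steps) = h , l , Linked.map proj₁ steps

module _ (M : Matroid n) where

  ∈IC⁺ : ∀ {D} → IsIrreducibleChain M D → D ∈ˡ IC M
  ∈IC⁺ i@(_ , _ , steps) = ∈-filter⁺ (isIrreducibleChain? M) (linked∈sequences (Linked.map proj₁ steps)) i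

  ∈IC⁻ : ∀ {D} → D ∈ˡ IC M → IsIrreducibleChain M D
  ∈IC⁻ h = proj₂ (∈-filter⁻ (isIrreducibleChain? M) {xs = sequences (suc n) (subsets n)} h)

  IC-unique : Unique (IC M)
  IC-unique = Unique.filter⁺ (isIrreducibleChain? M) (sequences-unique (suc n) (subsets-unique n))

  bases : List (Subset n)
  bases = List.filter (Basis? M) (subsets n)

  ∈bases⁺ : ∀ {B} → Basis M B → B ∈ˡ bases
  ∈bases⁺ {B} b = ∈-filter⁺ (Basis? M) (subsets-complete B) b

  ∈bases⁻ : ∀ {B} → B ∈ˡ bases → Basis M B
  ∈bases⁻ h = proj₂ (∈-filter⁻ (Basis? M) {xs = subsets n} h)

  bases-unique : Unique bases
  bases-unique = Unique.filter⁺ (Basis? M) (subsets-unique n)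

module _ {σ : m ⇌ n} {M : Matroid m} {N : Matroid n} (r : RankIso σ M N) where
  private
    s = rankIso-sym r
    f = List.map (image σ)
    g = List.map (image (inverse σ))

  IC-image : List.map (List.map (image σ)) (IC M) ↭ IC N
  IC-image = bijection⇒↭ {f = f} {g} (IC-unique M) (IC-unique N)
    (λ h → let i = ∈IC⁻ M h in ∈IC⁺ N (rankIso-chain r i) , chain-back r (chain⇒isChain {M = M} i))
    (λ h → let i = ∈IC⁻ N h in ∈IC⁺ M (rankIso-chain s i) , chain-back s (chain⇒isChain {M = N} i))

  bases-image : List.map (image σ) (bases M) ↭ bases N
  bases-image = bijection⇒↭ {f = image σ} {image (inverse σ)} (bases-unique M) (bases-unique N)
    (λ h → let b = ∈bases⁻ M h in ∈bases⁺ N (rankIso-basis r b) , RankIso.back r (Matroid.basis⊆ M _ b))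
    (λ h → let b = ∈bases⁻ N h in ∈bases⁺ M (rankIso-basis s b) , RankIso.back s (Matroid.basis⊆ N _ b))

#bases : Matroid n → ℕ
#bases M = List.length (bases M)

#bases-iso : {M : Matroid m} {N : Matroid n} → Iso M N → #bases M ≡ #bases N
#bases-iso {M = M} (σ , r) = trans (sym (List.length-map (image σ) (bases M))) (Perm.↭-length (bases-image r))

module _ {a p q} {A : Set a} {P : Pred A p} {Q : Pred A q} (P? : Decidable P) (Q? : Decidable Q)
         (P⊆Q : ∀ {x} → P x → Q x) where

  filter-length-≤ : ∀ xs → List.length (List.filter P? xs) ≤ List.length (List.filter Q? xs)
  filter-length-≤ []       = z≤n
  filter-length-≤ (x ∷ xs) with P? x | Q? x
  ... | yes p | yes _ = s≤s (filter-length-≤ xs)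
  ... | yes p | no ¬q = contradiction (P⊆Q p) ¬q
  ... | no _  | yes _ = ℕ.m≤n⇒m≤1+n (filter-length-≤ xs)
  ... | no _  | no _  = filter-length-≤ xs

  filter-length-≥ : ∀ {xs} → List.length (List.filter Q? xs) ≤ List.length (List.filter P? xs) →
                    ∀ {x} → x ∈ˡ xs → Q x → P x
  filter-length-≥ {y ∷ ys} le h q with P? y | Q? y
  filter-length-≥ {y ∷ ys} le (here refl) q | yes p | _     = p
  filter-length-≥ {y ∷ ys} le (there h)   q | yes p | yes _ = filter-length-≥ (ℕ.s≤s⁻¹ le) h q
  filter-length-≥ {y ∷ ys} le (there h)   q | yes p | no ¬q = contradiction (P⊆Q p) ¬q
  filter-length-≥ {y ∷ ys} le h           q | no _  | yes _ = contradiction (filter-length-≤ ys) (ℕ.<⇒≱ le)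
  filter-length-≥ {y ∷ ys} le (here refl) q | no _  | no ¬q = contradiction q ¬q
  filter-length-≥ {y ∷ ys} le (there h)   q | no _  | no _  = filter-length-≥ le h q

≤ʷ-#bases : {M N : Matroid n} → M ≤ʷ N → #bases N ≤ #bases M → M ≋ N
≤ʷ-#bases {M = M} {N} (e , h) le = e , λ B → mk⇔ (h B)
  (filter-length-≥ (Basis? M) (Basis? N) (λ {B} → h B) le (subsets-complete B))

-- Möbius functions and closures

when : ∀ {p} {P : Set p} → Dec P → ℤ → ℤ
when (yes _) a = a
when (no _)  a = 0ℤ

when-⇔ : ∀ {p q} {P : Set p} {Q : Set q} (P? : Dec P) (Q? : Dec Q) → (P → Q) → (Q → P) → ∀ a → when P? a ≡ when Q? a
when-⇔ (yes p) (yes q) f g a = refl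
when-⇔ (yes p) (no ¬q) f g a = contradiction (f p) ¬q
when-⇔ (no ¬p) (yes q) f g a = contradiction (g q) ¬p
when-⇔ (no ¬p) (no ¬q) f g a = refl

when-no : ∀ {p} {P : Set p} (P? : Dec P) → ¬ P → ∀ a → when P? a ≡ 0ℤ
when-no (yes p) ¬p a = contradiction p ¬p
when-no (no _)  ¬p a = refl

when-0 : ∀ {p} {P : Set p} (P? : Dec P) → when P? 0ℤ ≡ 0ℤ
when-0 (yes _) = refl
when-0 (no _)  = refl

sum-zero : ∀ {m} {f : Fin m → ℤ} → (∀ i → f i ≡ 0ℤ) → sum f ≡ 0ℤ
sum-zero {m} h = trans (sum-cong-≗ h) (sum-replicate-zero m)

when-sum : ∀ {p m} {P : Set p} (P? : Dec P) (f : Fin m → ℤ) → sum (λ i → when P? (f i)) ≡ when P? (sum f)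
when-sum (yes _) f = refl
when-sum {m = m} (no _) f = sum-zero {m} λ _ → refl

sum-δ : ∀ {m} (f : Fin m → ℤ) z → sum (λ y → when (y Fin.≟ z) (f y)) ≡ f z
sum-δ {suc m} f zero = trans (cong (λ s → f zero ℤ.+ s) (sum-zero {m} λ _ → refl)) (ℤ.+-identityʳ _)
sum-δ f (suc z) = trans (ℤ.+-identityˡ _) (trans
  (sum-cong-≗ λ y → when-⇔ (suc y Fin.≟ suc z) (y Fin.≟ z) Fin.suc-injective (cong suc) (f (suc y)))
  (sum-δ (f ∘ suc) z))

-- Antisymmetry of the weak order yields only `_≋_`; an enumeration without repetitions turns this
-- into equality of indices, over which the sums are taken.
module ClosureSum {m : ℕ} {_≈_ _≼_ : Rel (Fin m) 0ℓ} (isDPO : IsDecPartialOrder _≈_ _≼_)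
                  (≈⇒≡ : ∀ {i j} → i ≈ j → i ≡ j) where
  open IsDecPartialOrder isDPO using (_≟_; _≤?_; isPartialOrder)
    renaming (refl to ≼-refl; trans to ≼-trans; antisym to ≼-antisym)
  open IsDecPartialOrder.Eq isDPO using () renaming (refl to reflexive)
  open ToStrict _≈_ _≼_ using () renaming (_<_ to _≺_)
  open Möbius isDPO using (_≺?_; μ-acc; μ)

  -- The summand of `μ-acc` with its two decisions as arguments, so that they can be analysed by
  -- cases.
  term : ∀ x {z} → (∀ y → y ≺ z → ℤ) → ∀ y → Dec (x ≼ y) → Dec (y ≺ z) → ℤ
  term x f y (yes _) (yes p) = f y p
  term x f y _       _       = 0ℤ

  -- The type of μ-acc-term is left to inference: its left-hand side is a
  -- function local to the definition of μ-acc, which has no name here.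
  μ-acc-term : ∀ x {z} (below : ∀ {y} → y ≺ z → Acc _≺_ y) (x≉z : ¬ (x ≈ z)) (y : Fin m) → _

  μ-acc-unfold : ∀ x {z} (below : ∀ {y} → y ≺ z → Acc _≺_ y) → ¬ (x ≈ z) →
    μ-acc x (acc below) ≡ ℤ.- sum (λ y → term x (λ _ p → μ-acc x (below p)) y (x ≤? y) (y ≺? z))
  μ-acc-unfold x {z} below x≉z with x ≟ z
  ... | yes e   = contradiction e x≉z
  ... | no x≉z′ = cong ℤ.-_ (sum-cong-≗ (μ-acc-term x below x≉z′))

  μ-acc-term x {z} below x≉z y with x ≤? y | y ≺? z
  ... | yes _ | yes _ = refl
  ... | yes _ | no _  = refl
  ... | no _  | _     = refl

  μ-acc-diag : ∀ x {z} (a : Acc _≺_ z) → x ≈ z → μ-acc x a ≡ 1ℤ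
  μ-acc-diag x {z} (acc _) e with x ≟ z
  ... | yes _  = refl
  ... | no x≉z = contradiction e x≉z

  -- The recursion inside `μ` uses accessibility proofs derived from that of z, while `μ x y` uses
  -- the one given by `≺-wf y`. Only once these agree can the defining sum be read as a sum of
  -- values of `μ`.
  μ-acc-irrelevant : ∀ x {z} (a b : Acc _≺_ z) → μ-acc x a ≡ μ-acc x b
  μ-acc-irrelevant x {z} (acc as) (acc bs) = go (x ≟ z)
    where
    terms : ∀ y (d : Dec (x ≼ y)) (e : Dec (y ≺ z)) →
            term x (λ _ p → μ-acc x (as p)) y d e ≡ term x (λ _ p → μ-acc x (bs p)) y d e
    terms y (yes _) (yes p) = μ-acc-irrelevant x (as p) (bs p)
    terms y (yes _) (no _)  = refl
    terms y (no _)  _       = refl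
    go : Dec (x ≈ z) → μ-acc x (acc as) ≡ μ-acc x (acc bs)
    go (yes e)  = trans (μ-acc-diag x (acc as) e) (sym (μ-acc-diag x (acc bs) e))
    go (no x≉z) = trans (μ-acc-unfold x as x≉z)
      (trans (cong ℤ.-_ (sum-cong-≗ λ y → terms y (x ≤? y) (y ≺? z))) (sym (μ-acc-unfold x bs x≉z)))

  ≺-wf : ∀ z → Acc _≺_ z
  ≺-wf = spo-wellFounded (ToStrict.<-isStrictPartialOrder _≈_ _≼_ isPartialOrder)

  μ-diag : ∀ x → μ x x ≡ 1ℤ
  μ-diag x = μ-acc-diag x (≺-wf x) reflexive

  split-≼ : ∀ y z a → when (y ≤? z) a ≡ when (y ≺? z) a ℤ.+ when (y Fin.≟ z) a
  split-≼ y z a = go (y Fin.≟ z)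
    where
    go : (d : Dec (y ≡ z)) → when (y ≤? z) a ≡ when (y ≺? z) a ℤ.+ when d a
    go (yes refl) = trans (when-⇔ (y ≤? y) (yes (refl {x = y})) (λ _ → refl) (λ _ → ≼-refl) a)
      (trans (sym (ℤ.+-identityˡ a)) (cong (ℤ._+ a) (sym (when-no (y ≺? y) (λ (_ , y≉y) → y≉y reflexive) a))))
    go (no y≢z)   = trans (when-⇔ (y ≤? z) (y ≺? z) (λ le → le , y≢z ∘ ≈⇒≡) proj₁ a) (sym (ℤ.+-identityʳ _))

  module _ (x : Fin m) (x≼ : ∀ y → x ≼ y) where

    -- With x least, the recursion for μ(x , z) runs over all y ≺ z, and the term at z cancels the
    -- rest.
    μ-sum : ∀ z → ¬ z ≡ x → sum (λ y → when (y ≤? z) (μ x y)) ≡ 0ℤ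
    μ-sum z z≢x = begin
      sum (λ y → when (y ≤? z) (μ x y))
        ≡⟨ sum-cong-≗ (λ y → split-≼ y z (μ x y)) ⟩
      sum (λ y → when (y ≺? z) (μ x y) ℤ.+ when (y Fin.≟ z) (μ x y))
        ≡⟨ ∑-distrib-+ (λ y → when (y ≺? z) (μ x y)) (λ y → when (y Fin.≟ z) (μ x y)) ⟩
      sum (λ y → when (y ≺? z) (μ x y)) ℤ.+ sum (λ y → when (y Fin.≟ z) (μ x y))
        ≡⟨ cong (λ s → sum (λ y → when (y ≺? z) (μ x y)) ℤ.+ s) (trans (sum-δ (μ x) z) unfold) ⟩
      sum (λ y → when (y ≺? z) (μ x y)) ℤ.+ ℤ.- sum (λ y → when (y ≺? z) (μ x y))
        ≡⟨ ℤ.+-inverseʳ (sum (λ y → when (y ≺? z) (μ x y))) ⟩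
      0ℤ ∎
      where
      open ≡-Reasoning
      terms : (below : ∀ {y} → y ≺ z → Acc _≺_ y) → ∀ y (d : Dec (x ≼ y)) (e : Dec (y ≺ z)) →
              term x (λ _ p → μ-acc x (below p)) y d e ≡ when e (μ x y)
      terms below y (yes _)  (yes p) = μ-acc-irrelevant x (below p) (≺-wf y)
      terms below y (yes _)  (no _)  = refl
      terms below y (no x⋠y) _       = contradiction (x≼ y) x⋠y
      at : (a : Acc _≺_ z) → μ-acc x a ≡ ℤ.- sum (λ y → when (y ≺? z) (μ x y))
      at (acc below) = trans (μ-acc-unfold x below (z≢x ∘ sym ∘ ≈⇒≡))
        (cong ℤ.-_ (sum-cong-≗ λ y → terms below y (x ≤? y) (y ≺? z)))
      unfold : μ x z ≡ ℤ.- sum (λ y → when (y ≺? z) (μ x y))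
      unfold = at (≺-wf z)

    -- Rota's closure lemma, for a closure operator c under which x is not closed.
    closure-sum : (c : Fin m → Fin m) → (∀ i → i ≼ c i) → (∀ {i j} → i ≼ j → c i ≼ c j) →
                  (∀ i → c (c i) ≡ c i) → (∀ i → ¬ c i ≡ x) →
                  ∀ j → sum (λ i → when (c i Fin.≟ j) (μ x i)) ≡ 0ℤ
    closure-sum c extensive monotone idempotent c≢x j = go j (≺-wf j)
      where
      f : Fin m → ℤ
      f j = sum (λ i → when (c i Fin.≟ j) (μ x i))
      go : ∀ j → Acc _≺_ j → f j ≡ 0ℤ
      go j (acc rs) with c j Fin.≟ j
      -- Only closed elements are values of c, so the fibre is empty.
      ... | no cj≢j = sum-zero λ i → when-no (c i Fin.≟ j)
              (λ ci≡j → cj≢j (trans (cong c (sym ci≡j)) (trans (idempotent i) ci≡j))) (μ x i)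
      -- The i with closure strictly below j contribute zero by induction. Those with closure at
      -- most j are exactly the i ≼ j, as j is closed, and they sum to zero by `μ-sum`; the
      -- difference is f j.
      ... | yes cj≡j = begin
        f j
          ≡⟨ ℤ.+-identityˡ (f j) ⟨
        0ℤ ℤ.+ f j
          ≡⟨ cong (ℤ._+ f j) below ⟨
        sum (λ i → when (c i ≺? j) (μ x i)) ℤ.+ f j
          ≡⟨ ∑-distrib-+ (λ i → when (c i ≺? j) (μ x i)) (λ i → when (c i Fin.≟ j) (μ x i)) ⟨
        sum (λ i → when (c i ≺? j) (μ x i) ℤ.+ when (c i Fin.≟ j) (μ x i))
          ≡⟨ sum-cong-≗ (λ i → sym (split-≼ (c i) j (μ x i))) ⟩
        sum (λ i → when (c i ≤? j) (μ x i))
          ≡⟨ sum-cong-≗ (λ i → when-⇔ (c i ≤? j) (i ≤? j) (≼-trans (extensive i))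
               (λ i≼j → subst (c i ≼_) cj≡j (monotone i≼j)) (μ x i)) ⟩
        sum (λ i → when (i ≤? j) (μ x i))
          ≡⟨ μ-sum j (λ j≡x → c≢x j (trans cj≡j j≡x)) ⟩
        0ℤ ∎
        where
        open ≡-Reasoning
        pick : ∀ i → when (c i ≺? j) (μ x i) ≡ sum (λ k → when (k ≺? j) (when (c i Fin.≟ k) (μ x i)))
        pick i = begin
          when (c i ≺? j) (μ x i)
            ≡⟨ sum-δ (λ k → when (k ≺? j) (μ x i)) (c i) ⟨
          sum (λ k → when (k Fin.≟ c i) (when (k ≺? j) (μ x i)))
            ≡⟨ sum-cong-≗ (λ k → exchange (k Fin.≟ c i) (k ≺? j) (c i Fin.≟ k)) ⟩
          sum (λ k → when (k ≺? j) (when (c i Fin.≟ k) (μ x i))) ∎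
          where
          exchange : ∀ {k} {P : Set} (d : Dec (k ≡ c i)) (e : Dec P) (d′ : Dec (c i ≡ k)) →
                     when d (when e (μ x i)) ≡ when e (when d′ (μ x i))
          exchange d (yes _) d′ = when-⇔ d d′ sym sym (μ x i)
          exchange d (no _)  d′ = when-0 d
        below : sum (λ i → when (c i ≺? j) (μ x i)) ≡ 0ℤ
        below = begin
          sum (λ i → when (c i ≺? j) (μ x i))
            ≡⟨ sum-cong-≗ pick ⟩
          sum (λ i → sum (λ k → when (k ≺? j) (when (c i Fin.≟ k) (μ x i))))
            ≡⟨ ∑-comm (λ i k → when (k ≺? j) (when (c i Fin.≟ k) (μ x i))) ⟩
          sum (λ k → sum (λ i → when (k ≺? j) (when (c i Fin.≟ k) (μ x i))))
            ≡⟨ sum-cong-≗ (λ k → when-sum (k ≺? j) (λ i → when (c i Fin.≟ k) (μ x i))) ⟩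
          sum (λ k → when (k ≺? j) (f k))
            ≡⟨ sum-zero (λ k → vanish k (k ≺? j)) ⟩
          0ℤ ∎
          where
          vanish : ∀ k (d : Dec (k ≺ j)) → when d (f k) ≡ 0ℤ
          vanish k (yes k≺j) = go k (rs k≺j)
          vanish k (no _)    = refl

-- Formal sums

module FormalSums {c ℓ₁ ℓ₂} (K : HeytingField c ℓ₁ ℓ₂) where
  open HeytingField K public using (Carrier; heytingCommutativeRing; tight; #⇒invertible)
  ring : CommutativeRing c ℓ₁
  ring = HeytingCommutativeRing.commutativeRing heytingCommutativeRing
  open CommutativeRing ring public using (0#; 1#; setoid; +-commutativeMonoid; +-cong; +-identityˡ; +-identityʳ; +-assoc; +-comm;
      -‿inverseʳ; -‿cong; *-cong; *-congʳ; *-assoc; *-identityʳ; *-identityˡ; zeroˡ; semiring)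
    renaming (_≈_ to _≈ᴷ_; _+_ to _+ᴷ_; -_ to -ᴷ_; _*_ to _*ᴷ_; refl to ≈ᴷ-refl; sym to ≈ᴷ-sym; trans to ≈ᴷ-trans)
  open Ring (CommutativeRing.ring ring) public using (-0#≈0#; -‿+-comm)
  open Mult semiring public using (×-assoc-*; ×-congʳ; ×-homo-+) renaming (_×_ to _·_)
  open import Relation.Binary.Reasoning.Setoid setoid

  infix 4 _∼_
  _∼_ : H K → H K → Set _
  _∼_ = _≈ᴴ_ K

  ++-congˡ : ∀ x {y z} → y ∼ z → x List.++ y ∼ x List.++ z
  ++-congˡ []      e = e
  ++-congˡ (_ ∷ x) e = ≈-cons ≈ᴷ-refl ≅-refl (++-congˡ x e)

  ++-congʳ : ∀ {x y} → x ∼ y → ∀ z → x List.++ z ∼ y List.++ z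
  ++-congʳ ≈-refl           z = ≈-refl
  ++-congʳ (≈-sym e)        z = ≈-sym (++-congʳ e z)
  ++-congʳ (≈-trans e f)    z = ≈-trans (++-congʳ e z) (++-congʳ f z)
  ++-congʳ (≈-cons a i e)   z = ≈-cons a i (++-congʳ e z)
  ++-congʳ (≈-swap s t x)   z = ≈-swap s t (x List.++ z)
  ++-congʳ (≈-merge a b M x) z = ≈-merge a b M (x List.++ z)
  ++-congʳ (≈-zero M x)     z = ≈-zero M (x List.++ z)

  ++-cong : ∀ {x x′ y y′} → x ∼ x′ → y ∼ y′ → x List.++ y ∼ x′ List.++ y′
  ++-cong {x′ = x′} {y} e f = ≈-trans (++-congʳ e y) (++-congˡ x′ f)

  ↭⇒∼ : ∀ {x y} → x ↭ y → x ∼ y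
  ↭⇒∼ Perm.refl         = ≈-refl
  ↭⇒∼ (Perm.prep _ p)   = ≈-cons ≈ᴷ-refl ≅-refl (↭⇒∼ p)
  ↭⇒∼ (Perm.swap s t p) = ≈-trans (≈-swap s t _) (≈-cons ≈ᴷ-refl ≅-refl (≈-cons ≈ᴷ-refl ≅-refl (↭⇒∼ p)))
  ↭⇒∼ (Perm.trans p q)  = ≈-trans (↭⇒∼ p) (↭⇒∼ q)

  map-cong : ∀ {a} {A : Set a} {f g : A → Carrier × 𝓦} (xs : List A) →
             (∀ {x} → x ∈ˡ xs → proj₁ (f x) ≈ᴷ proj₁ (g x) × proj₂ (proj₂ (f x)) ≅ proj₂ (proj₂ (g x))) →
             List.map f xs ∼ List.map g xs
  map-cong []       h = ≈-refl
  map-cong (x ∷ xs) h = ≈-cons (proj₁ (h (here refl))) (proj₂ (h (here refl))) (map-cong xs (h ∘ there))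

  neg : H K → H K
  neg = List.map λ (a , M) → -ᴷ a , M

  neg-cong : ∀ {x y} → x ∼ y → neg x ∼ neg y
  neg-cong ≈-refl           = ≈-refl
  neg-cong (≈-sym e)        = ≈-sym (neg-cong e)
  neg-cong (≈-trans e f)    = ≈-trans (neg-cong e) (neg-cong f)
  neg-cong (≈-cons a i e)   = ≈-cons (-‿cong a) i (neg-cong e)
  neg-cong (≈-swap s t x)   = ≈-swap _ _ (neg x)
  neg-cong (≈-merge a b M x) = ≈-trans (≈-merge (-ᴷ a) (-ᴷ b) M (neg x)) (≈-cons (-‿+-comm a b) ≅-refl ≈-refl)
  neg-cong (≈-zero M x)     = ≈-trans (≈-cons -0#≈0# ≅-refl ≈-refl) (≈-zero M (neg x))

  cancel : ∀ a M x → (a , M) ∷ (-ᴷ a , M) ∷ x ∼ x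
  cancel a M x = ≈-trans (≈-merge a (-ᴷ a) M x) (≈-trans (≈-cons (-‿inverseʳ a) ≅-refl ≈-refl) (≈-zero M x))

  neg-inverse : ∀ x → x List.++ neg x ∼ []
  neg-inverse []            = ≈-refl
  neg-inverse ((a , M) ∷ x) = ≈-trans (≈-cons ≈ᴷ-refl ≅-refl (↭⇒∼ (Perm.shift (-ᴷ a , M) x (neg x))))
    (≈-trans (cancel a M (x List.++ neg x)) (neg-inverse x))

  φ-++ : ∀ x y → φ K (x List.++ y) ≡ φ K x List.++ φ K y
  φ-++ = List.concatMap-++ _

  φ-neg : ∀ x → φ K (neg x) ≡ neg (φ K x)
  φ-neg []                = refl
  φ-neg ((a , n , M) ∷ x) = trans (cong₂ List._++_ (List.map-∘ (IC M)) (φ-neg x)) (sym (List.map-++ _ (List.map _ (IC M)) (φ K x)))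

  image-terms : ∀ {n} → Carrier → (M : Matroid n) → List (List (Subset n)) → H K
  image-terms {n} a M = List.map λ D → a , n , chainProduct M D

  image-terms-image : ∀ {m n a b} {σ : m ⇌ n} {M : Matroid m} {N : Matroid n} → a ≈ᴷ b → RankIso σ M N →
                      ∀ Ds → (∀ {D} → D ∈ˡ Ds → IsChain (ground M) D) →
                      image-terms a M Ds ∼ image-terms b N (List.map (List.map (image σ)) Ds)
  image-terms-image e r []       h = ≈-refl
  image-terms-image {σ = σ} {M} {N} e r (D ∷ Ds) h = ≈-cons e
    (iso⇒≅ {M = chainProduct M D} {chainProduct N (List.map (image σ) D)} (σ , rankIso-product r (h (here refl))))
    (image-terms-image e r Ds (h ∘ there))

  image-terms-cong : ∀ {m n a b} {M : Matroid m} {N : Matroid n} → a ≈ᴷ b → Iso M N →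
                     image-terms a M (IC M) ∼ image-terms b N (IC N)
  image-terms-cong {n = n} {a} {b} {M} {N} e (σ , r) = ≈-trans
    (image-terms-image {σ = σ} {M} {N} e r (IC M) (λ {D} h → chain⇒isChain {M = M} {D} (∈IC⁻ M h)))
    (↭⇒∼ (Perm.map⁺ (λ D → b , n , chainProduct N D) (IC-image r)))

  image-terms-+ : ∀ {n} a b (M : Matroid n) Ds → image-terms a M Ds List.++ image-terms b M Ds ∼ image-terms (a +ᴷ b) M Ds
  image-terms-+ a b M []       = ≈-refl
  image-terms-+ a b M (D ∷ Ds) = ≈-trans
    (≈-cons ≈ᴷ-refl ≅-refl (↭⇒∼ (Perm.shift _ (image-terms a M Ds) (image-terms b M Ds))))
    (≈-trans (≈-merge a b _ _) (≈-cons ≈ᴷ-refl ≅-refl (image-terms-+ a b M Ds)))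

  image-terms-0 : ∀ {n a} → a ≈ᴷ 0# → (M : Matroid n) → ∀ Ds → image-terms a M Ds ∼ []
  image-terms-0 e M []       = ≈-refl
  image-terms-0 e M (D ∷ Ds) = ≈-trans (≈-cons e ≅-refl (image-terms-0 e M Ds)) (≈-zero _ _)

  -- Only `≈-cons` replaces a matroid: isomorphic matroids have corresponding irreducible chains
  -- with isomorphic products. The other generators amount to linearity in the coefficients and
  -- reordering.
  φ-cong : ∀ {x y} → x ∼ y → φ K x ∼ φ K y
  φ-cong ≈-refl           = ≈-refl
  φ-cong (≈-sym e)        = ≈-sym (φ-cong e)
  φ-cong (≈-trans e f)    = ≈-trans (φ-cong e) (φ-cong f)
  φ-cong (≈-cons a i e)   = ++-cong (image-terms-cong a (≅⇒iso i)) (φ-cong e)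
  φ-cong (≈-swap (a , _ , M) (b , _ , N) x) = ↭⇒∼ (Perm.↭-trans
    (Perm.↭-reflexive (sym (List.++-assoc s t (φ K x))))
    (Perm.↭-trans (Perm.++⁺ʳ (φ K x) (Perm.++-comm s t)) (Perm.↭-reflexive (List.++-assoc t s (φ K x)))))
    where
    s = image-terms a M (IC M)
    t = image-terms b N (IC N)
  φ-cong (≈-merge a b (_ , M) x) = ≈-trans
    (↭⇒∼ (Perm.↭-reflexive (sym (List.++-assoc (image-terms a M (IC M)) (image-terms b M (IC M)) (φ K x)))))
    (++-congʳ (image-terms-+ a b M (IC M)) (φ K x))
  φ-cong (≈-zero (_ , M) x) = ++-congʳ (image-terms-0 ≈ᴷ-refl M (IC M)) (φ K x)

  whenᴷ : ∀ {p} {P : Set p} → Dec P → Carrier → Carrier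
  whenᴷ (yes _) a = a
  whenᴷ (no _)  a = 0#

  whenᴷ-cong : ∀ {p q} {P : Set p} {Q : Set q} (P? : Dec P) (Q? : Dec Q) → (P → Q) → (Q → P) →
               ∀ {a b} → a ≈ᴷ b → whenᴷ P? a ≈ᴷ whenᴷ Q? b
  whenᴷ-cong (yes p) (yes q) f g e = e
  whenᴷ-cong (yes p) (no ¬q) f g e = contradiction (f p) ¬q
  whenᴷ-cong (no ¬p) (yes q) f g e = contradiction (g q) ¬p
  whenᴷ-cong (no ¬p) (no ¬q) f g e = ≈ᴷ-refl

  whenᴷ-+ : ∀ {p} {P : Set p} (P? : Dec P) a b → whenᴷ P? a +ᴷ whenᴷ P? b ≈ᴷ whenᴷ P? (a +ᴷ b)
  whenᴷ-+ (yes _) a b = ≈ᴷ-refl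
  whenᴷ-+ (no _)  a b = +-identityˡ 0#

  whenᴷ-0 : ∀ {p} {P : Set p} (P? : Dec P) → whenᴷ P? 0# ≈ᴷ 0#
  whenᴷ-0 (yes _) = ≈ᴷ-refl
  whenᴷ-0 (no _)  = ≈ᴷ-refl

  +-exchange : ∀ a b x → a +ᴷ (b +ᴷ x) ≈ᴷ b +ᴷ (a +ᴷ x)
  +-exchange a b x = begin
    a +ᴷ (b +ᴷ x) ≈⟨ +-assoc a b x ⟨
    (a +ᴷ b) +ᴷ x ≈⟨ +-cong (+-comm a b) ≈ᴷ-refl ⟩
    (b +ᴷ a) +ᴷ x ≈⟨ +-assoc b a x ⟩
    b +ᴷ (a +ᴷ x) ∎

  module _ {l} (L : Matroid l) where

    -- An equation in K can be drawn from an equality of formal sums only through a functional that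
    -- respects all generators of that equality; testing for isomorphism with L gives one.
    coefficient : H K → Carrier
    coefficient []                = 0#
    coefficient ((a , _ , N) ∷ x) = whenᴷ (≅-dec N L) a +ᴷ coefficient x

    coefficient-cong : ∀ {x y} → x ∼ y → coefficient x ≈ᴷ coefficient y
    coefficient-cong ≈-refl         = ≈ᴷ-refl
    coefficient-cong (≈-sym e)      = ≈ᴷ-sym (coefficient-cong e)
    coefficient-cong (≈-trans e f)  = ≈ᴷ-trans (coefficient-cong e) (coefficient-cong f)
    coefficient-cong (≈-cons {M = M} {N} a i e) = +-cong
      (whenᴷ-cong (≅-dec M L) (≅-dec N L) (≅-trans (≅-sym i)) (≅-trans i) a) (coefficient-cong e)
    coefficient-cong (≈-swap (a , _ , M) (b , _ , N) x) =
      +-exchange (whenᴷ (≅-dec M L) a) (whenᴷ (≅-dec N L) b) (coefficient x)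
    coefficient-cong (≈-merge a b (_ , M) x) = ≈ᴷ-trans (≈ᴷ-sym (+-assoc _ _ _))
      (+-cong (whenᴷ-+ (≅-dec M L) a b) ≈ᴷ-refl)
    coefficient-cong (≈-zero (_ , M) x) = ≈ᴷ-trans (+-cong (whenᴷ-0 (≅-dec M L)) ≈ᴷ-refl) (+-identityˡ _)

    coefficient-++ : ∀ x y → coefficient (x List.++ y) ≈ᴷ coefficient x +ᴷ coefficient y
    coefficient-++ []                y = ≈ᴷ-sym (+-identityˡ _)
    coefficient-++ ((a , _ , N) ∷ x) y = ≈ᴷ-trans (+-cong ≈ᴷ-refl (coefficient-++ x y)) (≈ᴷ-sym (+-assoc _ _ _))

    isoTo? : Decidable (λ (t : Carrier × 𝓦) → proj₂ (proj₂ t) ≅ L)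
    isoTo? (_ , _ , N) = ≅-dec N L

    others : H K → H K
    others = List.filter (∁? isoTo?)

    gather : ∀ x → x ∼ (coefficient x , l , L) ∷ others x
    gather []                = ≈-sym (≈-zero (l , L) [])
    gather ((a , n , N) ∷ x) with ≅-dec N L
    ... | yes i = ≈-trans (≈-cons ≈ᴷ-refl i (gather x)) (≈-merge a (coefficient x) (l , L) (others x))
    ... | no _  = ≈-trans (≈-cons ≈ᴷ-refl ≅-refl (gather x)) (≈-trans (≈-swap _ _ _)
                    (≈-cons (≈ᴷ-sym (+-identityˡ _)) ≅-refl ≈-refl))

    multiplicity : ∀ {n} → Matroid n → List (List (Subset n)) → ℕ
    multiplicity M Ds = List.length (List.filter (λ D → ≅-dec (chainProduct M D) L) Ds)

    coefficient-image-terms : ∀ {n} a (M : Matroid n) Ds →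
                              coefficient (image-terms a M Ds) ≈ᴷ multiplicity M Ds · a
    coefficient-image-terms a M []       = ≈ᴷ-refl
    coefficient-image-terms a M (D ∷ Ds) with ≅-dec (chainProduct M D) L
    ... | yes _ = +-cong ≈ᴷ-refl (coefficient-image-terms a M Ds)
    ... | no _  = ≈ᴷ-trans (+-identityˡ _) (coefficient-image-terms a M Ds)

    -- If N(D) were isomorphic to L, then N ≤ N(D) while N(D) has no more bases than N. This forces
    -- N ≋ N(D), and N itself would be isomorphic to L.
    coefficient-image-others : ∀ x → All (λ (_ , _ , N) → ¬ N ≅ L × #bases L ≤ #bases N) x → coefficient (φ K x) ≈ᴷ 0#
    coefficient-image-others []                []             = ≈ᴷ-refl
    coefficient-image-others ((a , n , N) ∷ x) ((¬i , le) ∷ h) = begin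
      coefficient (image-terms a N (IC N) List.++ φ K x)
        ≈⟨ coefficient-++ (image-terms a N (IC N)) (φ K x) ⟩
      coefficient (image-terms a N (IC N)) +ᴷ coefficient (φ K x)
        ≈⟨ +-cong (none (IC N) (λ h → ∈IC⁻ N h)) (coefficient-image-others x h) ⟩
      0# +ᴷ 0#
        ≈⟨ +-identityˡ 0# ⟩
      0# ∎
      where
      absurd : ∀ {D} → IsIrreducibleChain N D → ¬ chainProduct N D ≅ L
      absurd {D} ic i = ¬i (≅-trans (≋⇒≅ {M = N} {P} (≤ʷ-#bases {M = N} {P} N≤P
          (ℕ.≤-trans (ℕ.≤-reflexive (#bases-iso (≅⇒iso i))) le))) i)
        where
        P = chainProduct N D
        N≤P : N ≤ʷ P
        N≤P = chainProduct-extensive N (chain⇒isChain {M = N} ic)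
      none : ∀ Ds → (∀ {D} → D ∈ˡ Ds → IsIrreducibleChain N D) → coefficient (image-terms a N Ds) ≈ᴷ 0#
      none []       h = ≈ᴷ-refl
      none (D ∷ Ds) h with ≅-dec (chainProduct N D) L
      ... | yes i = contradiction i (absurd (h (here refl)))
      ... | no _  = ≈ᴷ-trans (+-identityˡ _) (none Ds (h ∘ there))

  module _ (char0 : CharacteristicZero K) where

    -- Equality in K comes without a decision procedure, but by tightness it is enough to refute a #
    -- 0. That apartness makes a - 0 invertible, whence the extra summand, and multiplying by the
    -- inverse would give (k + 1) · 1 = 0.
    ·-cancel : ∀ k {a} → suc k · a ≈ᴷ 0# → a ≈ᴷ 0#
    ·-cancel k {a} e = proj₁ (tight a 0#) λ a#0 →
      let b , _ , ab≈1 = #⇒invertible a#0 in char0 k (begin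
        suc k · 1#                       ≈⟨ *-identityʳ _ ⟨
        (suc k · 1#) *ᴷ 1#               ≈⟨ *-cong ≈ᴷ-refl ab≈1 ⟨
        (suc k · 1#) *ᴷ ((a +ᴷ -ᴷ 0#) *ᴷ b) ≈⟨ *-assoc _ _ _ ⟨
        ((suc k · 1#) *ᴷ (a +ᴷ -ᴷ 0#)) *ᴷ b ≈⟨ *-congʳ (*-cong ≈ᴷ-refl (≈ᴷ-trans (+-cong ≈ᴷ-refl -0#≈0#) (+-identityʳ a))) ⟩
        ((suc k · 1#) *ᴷ a) *ᴷ b         ≈⟨ *-congʳ (×-assoc-* (suc k) 1# a) ⟩
        (suc k · (1# *ᴷ a)) *ᴷ b         ≈⟨ *-congʳ (×-congʳ (suc k) (*-identityˡ a)) ⟩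
        (suc k · a) *ᴷ b                 ≈⟨ *-congʳ e ⟩
        0# *ᴷ b                          ≈⟨ zeroˡ b ⟩
        0#                               ∎)

    minimalEntry : ∀ t (x : H K) → ∃ λ u → u ∈ˡ t ∷ x ×
                   All (λ s → #bases (proj₂ (proj₂ u)) ≤ #bases (proj₂ (proj₂ s))) (t ∷ x)
    minimalEntry t []      = t , here refl , ℕ.≤-refl ∷ []
    minimalEntry t (s ∷ x) with minimalEntry s x
    ... | u , u∈ , h with ℕ.≤-total (#bases (proj₂ (proj₂ t))) (#bases (proj₂ (proj₂ u)))
    ...   | inj₁ le = t , here refl , ℕ.≤-refl ∷ All.map (ℕ.≤-trans le) h
    ...   | inj₂ ge = u , there u∈ , ge ∷ h

    multiplicity-positive : ∀ {l} (L : Matroid l) → ∃ λ k → multiplicity L L (IC L) ≡ suc k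
    multiplicity-positive L = let D , ic , e = factorization L in
      positive (∈-filter⁺ (λ D → ≅-dec (chainProduct L D) L) (∈IC⁺ L ic) (≋⇒≅ {M = chainProduct L D} {L} e))
      where
      positive : ∀ {a} {A : Set a} {x : A} {xs} → x ∈ˡ xs → ∃ λ k → List.length xs ≡ suc k
      positive {xs = _ ∷ xs} _ = List.length xs , refl

    ·-cancel′ : ∀ {k j a b} → b ≈ᴷ k · a → k ≡ suc j → b ≈ᴷ 0# → a ≈ᴷ 0#
    ·-cancel′ {j = j} e refl f = ·-cancel j (≈ᴷ-trans (≈ᴷ-sym e) f)

    -- At a class with the fewest bases, only that class itself contributes to the coefficient of φ.
    minimal-coefficient : ∀ z {l} (L : Matroid l) → All (λ (_ , _ , N) → #bases L ≤ #bases N) z →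
                          φ K z ∼ [] → coefficient L z ≈ᴷ 0#
    minimal-coefficient z {l} L minimal e =
      ·-cancel′ (coefficient-image-terms L κ L (IC L)) (proj₂ (multiplicity-positive L)) (begin
        coefficient L (image-terms κ L (IC L))
          ≈⟨ +-identityʳ _ ⟨
        coefficient L (image-terms κ L (IC L)) +ᴷ 0#
          ≈⟨ +-cong ≈ᴷ-refl (coefficient-image-others L o h) ⟨
        coefficient L (image-terms κ L (IC L)) +ᴷ coefficient L (φ K o)
          ≈⟨ coefficient-++ L (image-terms κ L (IC L)) (φ K o) ⟨
        coefficient L (φ K ((κ , l , L) ∷ o))
          ≈⟨ coefficient-cong L (φ-cong (gather L z)) ⟨
        coefficient L (φ K z)
          ≈⟨ coefficient-cong L e ⟩
        0# ∎)
      where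
      o = others L z
      κ = coefficient L z
      h : All (λ (_ , _ , N) → ¬ N ≅ L × #bases L ≤ #bases N) o
      h = All.zip (All.all-filter (∁? (isoTo? L)) z , All.filter⁺ (∁? (isoTo? L)) minimal)

    φ-injective : ∀ x → φ K x ∼ [] → x ∼ []
    φ-injective x = go (List.length x) x ℕ.≤-refl
      where
      go : ∀ k x → List.length x ≤ k → φ K x ∼ [] → x ∼ []
      step : ∀ k t x → List.length x ≤ k → φ K (t ∷ x) ∼ [] →
             (∃ λ u → u ∈ˡ t ∷ x × All (λ s → #bases (proj₂ (proj₂ u)) ≤ #bases (proj₂ (proj₂ s))) (t ∷ x)) →
             t ∷ x ∼ []
      go k       []      _        e = ≈-refl
      go (suc k) (t ∷ x) (s≤s le) e = step k t x le e (minimalEntry t x)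
      step k t x le e ((a , l , L) , u∈ , minimal) = ≈-trans z∼o (go k o shorter (≈-trans (φ-cong (≈-sym z∼o)) e))
        where
        z = t ∷ x
        o = others L z
        shorter : List.length o ≤ k
        shorter = ℕ.s≤s⁻¹ (ℕ.≤-trans (List.filter-notAll (∁? (isoTo? L)) z
          (Any.map (λ { refl ¬i → ¬i ≅-refl }) u∈)) (s≤s le))
        z∼o : z ∼ o
        z∼o = ≈-trans (gather L z)
          (≈-trans (≈-cons (minimal-coefficient z L minimal e) ≅-refl ≈-refl) (≈-zero (l , L) o))

    -- Additively, y = y + (-x + x) = (y - x) + x, and y - x lies in the kernel of φ.
    preimage-unique : ∀ {x y z} → φ K x ∼ z → φ K y ∼ z → y ∼ x
    preimage-unique {x} {y} {z} ex ey = ≈-trans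
      (≈-sym (subst (y List.++ (neg x List.++ x) ∼_) (List.++-identityʳ y)
        (++-congˡ y (≈-trans (↭⇒∼ (Perm.++-comm (neg x) x)) (neg-inverse x)))))
      (≈-trans (↭⇒∼ (Perm.↭-reflexive (sym (List.++-assoc y (neg x) x))))
        (++-congʳ (φ-injective (y List.++ neg x) (subst (_∼ [])
          (sym (trans (φ-++ y (neg x)) (cong (φ K y List.++_) (φ-neg x))))
          (≈-trans (++-cong ey (neg-cong ex)) (neg-inverse z)))) x))

-- The enumeration of the poset 𝓡_M

mapMaybe-pairs : ∀ {a b r} {A : Set a} {B : Set b} {R : Rel B r} (f : A → Maybe B) {xs} →
  AllPairs (λ x y → ∀ u v → f x ≡ just u → f y ≡ just v → R u v) xs → AllPairs R (List.mapMaybe f xs)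
mapMaybe-pairs f []                  = []
mapMaybe-pairs {R = R} f {x ∷ xs} (h ∷ hs) with f x
... | nothing = mapMaybe-pairs f hs
... | just u  = images (All.map (λ g v → g u v refl) h) ∷ mapMaybe-pairs f hs
  where
  images : ∀ {ys} → All (λ y → ∀ v → f y ≡ just v → R u v) ys → All (R u) (List.mapMaybe f ys)
  images []                = []
  images {y ∷ ys} (g ∷ gs) with f y
  ... | nothing = images gs
  ... | just v  = g v refl ∷ images gs

families-distinct : ∀ n → AllPairs (λ F G → ¬ (∀ p → F p ≡ G p)) (families n)
families-distinct zero    = ((λ h → false≢true (h [])) ∷ []) ∷ [] ∷ []
  where
  false≢true : ¬ false ≡ true
  false≢true ()
families-distinct (suc n) = UniqueSetoid.cartesianProductWith⁺ (fam n) (fam n) (fam (suc n)) caseFamily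
  (λ h → (λ p → h (outside ∷ p)) , (λ p → h (inside ∷ p))) (families-distinct n) (families-distinct n)
  where
  fam = λ n → Subset n ≡.→-setoid Bool

matroidOf-spec : ∀ {n} {S : Subset n} {F N} → matroidOf (S , F) ≡ just N → ground N ≡ S × (∀ B → Basis N B ⇔ True (F B))
matroidOf-spec {S = S} {F} e with isMatroid? S (λ p → Bool.T? (F p))
matroidOf-spec refl | yes _ = refl , λ _ → mk⇔ id id

True-injective : ∀ {a b} → (True a ⇔ True b) → a ≡ b
True-injective {true}  {true}  e = refl
True-injective {true}  {false} e = ⊥-elim (Equivalence.to e tt)
True-injective {false} {true}  e = ⊥-elim (Equivalence.from e tt)
True-injective {false} {false} e = refl

matroids-distinct : ∀ n → AllPairs (λ M N → ¬ M ≋ N) (matroids n)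
matroids-distinct n = mapMaybe-pairs matroidOf (AllPairs.map separate
  (UniqueSetoid.cartesianProduct⁺ (≡.setoid (Subset n)) (Subset n ≡.→-setoid Bool) (subsets-unique n) (families-distinct n)))
  where
  separate : ∀ {SF TG : Subset n × Family n} → ¬ (proj₁ SF ≡ proj₁ TG × (∀ p → proj₂ SF p ≡ proj₂ TG p)) →
             ∀ M N → matroidOf SF ≡ just M → matroidOf TG ≡ just N → ¬ M ≋ N
  separate {S , F} {T , G} ne M N eM eN (g , b) =
    let gM , bM = matroidOf-spec {S = S} {F} eM
        gN , bN = matroidOf-spec {S = T} {G} eN
    in ne (trans (sym gM) (trans g gN) , λ p → True-injective (mk⇔
         (Equivalence.to (bN p) ∘ Equivalence.to (b p) ∘ Equivalence.from (bM p))
         (Equivalence.to (bM p) ∘ Equivalence.from (b p) ∘ Equivalence.from (bN p))))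

lookup-distinct : ∀ {a r} {A : Set a} {R : Rel A r} → (∀ {x y} → R x y → R y x) → ∀ {xs} → AllPairs (λ x y → ¬ R x y) xs →
                  ∀ i j → R (List.lookup xs i) (List.lookup xs j) → i ≡ j
lookup-distinct sym′ (h ∷ hs) zero    zero    r = refl
lookup-distinct sym′ {x ∷ xs} (h ∷ hs) zero    (suc j) r = contradiction r (All.lookup h (∈-lookup j))
lookup-distinct sym′ {x ∷ xs} (h ∷ hs) (suc i) zero    r = contradiction (sym′ r) (All.lookup h (∈-lookup i))
lookup-distinct sym′ (h ∷ hs) (suc i) (suc j) r = cong suc (lookup-distinct sym′ hs i j r)

module _ {n} (M : Matroid n) where

  𝓡-distinct : ∀ i j → List.lookup (𝓡 M) i ≋ List.lookup (𝓡 M) j → i ≡ j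
  𝓡-distinct = lookup-distinct {R = _≋_} (λ {M} {N} → ≋-sym {M = M} {N})
    (All.map (proj₂ ∘ proj₂) (All.all-filter (above? M) (matroids n)) ∷ AllPairs.filter⁺ (above? M) (matroids-distinct n))

  𝓡-above : ∀ i → M ≤ʷ List.lookup (𝓡 M) i
  𝓡-above zero    = refl , λ _ → id
  𝓡-above (suc i) = proj₁ (All.lookup (All.all-filter (above? M) (matroids n)) (∈-lookup i))

  𝓡-reducible : ∀ i → Reducible (List.lookup (𝓡 M) (suc i))
  𝓡-reducible i = proj₁ (proj₂ (All.lookup (All.all-filter (above? M) (matroids n)) (∈-lookup i)))

  𝓡-complete : Irreducible M → ∀ L → M ≤ʷ L → Reducible L → ∃ λ i → List.lookup (𝓡 M) i ≋ L
  𝓡-complete irr L M≤L red = index (find (matroids-complete L))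
    where
    index : (∃ λ N → N ∈ˡ matroids n × L ≋ N) → ∃ λ i → List.lookup (𝓡 M) i ≋ L
    index (N , N∈ , L≋N) = suc (Any.index N∈′) , subst (_≋ L) (Any.lookup-index N∈′) (≋-sym {M = L} {N} L≋N)
      where
      redN : Reducible N
      redN i = red (irreducible-≋ {M = N} {L} (≋-sym {M = L} {N} L≋N) i)
      N∈′ : N ∈ˡ List.filter (above? M) (matroids n)
      N∈′ = ∈-filter⁺ (above? M) N∈
        ( (trans (proj₁ M≤L) (proj₁ L≋N) , λ B b → Equivalence.to (proj₂ L≋N B) (proj₂ M≤L B b))
        -- A reducible N cannot equal the irreducible M, so the last filter condition holds.
        , redN , λ e → redN (irreducible-≋ {M = M} {N} e irr))

-- Expansion of φ on the Möbius sum

module Existence {c ℓ₁ ℓ₂} (K : HeytingField c ℓ₁ ℓ₂) where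
  open FormalSums K
  open CommutativeMonoidSum +-commutativeMonoid using () renaming (sum to sumᴷ; sum-cong-≋ to sumᴷ-cong; sum-replicate-zero to sumᴷ-0)
  open import Relation.Binary.Reasoning.Setoid setoid

  +-cancel-one : ∀ a b → a +ᴷ -ᴷ b ≈ᴷ (1# +ᴷ a) +ᴷ -ᴷ (1# +ᴷ b)
  +-cancel-one a b = ≈ᴷ-sym (begin
    (1# +ᴷ a) +ᴷ -ᴷ (1# +ᴷ b)       ≈⟨ +-cong (+-comm 1# a) (≈ᴷ-sym (-‿+-comm 1# b)) ⟩
    (a +ᴷ 1#) +ᴷ (-ᴷ 1# +ᴷ -ᴷ b)    ≈⟨ +-assoc a 1# _ ⟩
    a +ᴷ (1# +ᴷ (-ᴷ 1# +ᴷ -ᴷ b))    ≈⟨ +-cong ≈ᴷ-refl (≈ᴷ-sym (+-assoc 1# (-ᴷ 1#) (-ᴷ b))) ⟩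
    a +ᴷ ((1# +ᴷ -ᴷ 1#) +ᴷ -ᴷ b)    ≈⟨ +-cong ≈ᴷ-refl (+-cong (-‿inverseʳ 1#) ≈ᴷ-refl) ⟩
    a +ᴷ (0# +ᴷ -ᴷ b)               ≈⟨ +-cong ≈ᴷ-refl (+-identityˡ _) ⟩
    a +ᴷ -ᴷ b                       ∎)

  fromℤ-⊖ : ∀ k l → fromℤ K (k ℤ.⊖ l) ≈ᴷ (k · 1#) +ᴷ -ᴷ (l · 1#)
  fromℤ-⊖ k       zero    = ≈ᴷ-sym (≈ᴷ-trans (+-cong ≈ᴷ-refl -0#≈0#) (+-identityʳ _))
  fromℤ-⊖ zero    (suc l) = ≈ᴷ-sym (+-identityˡ _)
  fromℤ-⊖ (suc k) (suc l) = subst (λ i → fromℤ K i ≈ᴷ (suc k · 1#) +ᴷ -ᴷ (suc l · 1#)) (sym (ℤ.[1+m]⊖[1+n]≡m⊖n k l))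
    (≈ᴷ-trans (fromℤ-⊖ k l) (+-cancel-one (k · 1#) (l · 1#)))

  fromℤ-+ : ∀ i j → fromℤ K (i ℤ.+ j) ≈ᴷ fromℤ K i +ᴷ fromℤ K j
  fromℤ-+ (ℤ.+ k)    (ℤ.+ l)    = ×-homo-+ 1# k l
  fromℤ-+ (ℤ.+ k)    ℤ.-[1+ l ] = fromℤ-⊖ k (suc l)
  fromℤ-+ ℤ.-[1+ k ] (ℤ.+ l)    = ≈ᴷ-trans (fromℤ-⊖ l (suc k)) (+-comm _ _)
  fromℤ-+ ℤ.-[1+ k ] ℤ.-[1+ l ] = ≈ᴷ-trans
    (-‿cong (subst (λ i → suc (suc (k + l)) · 1# ≈ᴷ i · 1#) (cong suc (sym (ℕ.+-suc k l))) ≈ᴷ-refl))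
    (≈ᴷ-trans (-‿cong (×-homo-+ 1# (suc k) (suc l))) (≈ᴷ-sym (-‿+-comm (suc k · 1#) (suc l · 1#))))

  fromℤ-sum : ∀ {m} (f : Fin m → ℤ) → fromℤ K (sum f) ≈ᴷ sumᴷ (fromℤ K ∘ f)
  fromℤ-sum {zero}  f = ≈ᴷ-refl
  fromℤ-sum {suc m} f = ≈ᴷ-trans (fromℤ-+ (f zero) (sum (f ∘ suc))) (+-cong ≈ᴷ-refl (fromℤ-sum (f ∘ suc)))

  fromℤ-when : ∀ {p} {P : Set p} (P? : Dec P) a → fromℤ K (when P? a) ≡ whenᴷ P? (fromℤ K a)
  fromℤ-when (yes _) a = refl
  fromℤ-when (no _)  a = refl

  sumᴷ-zero : ∀ {m} {f : Fin m → Carrier} → (∀ i → f i ≈ᴷ 0#) → sumᴷ f ≈ᴷ 0#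
  sumᴷ-zero {m} h = ≈ᴷ-trans (sumᴷ-cong h) (sumᴷ-0 m)

  combination : ∀ {m n} → (Fin m → Carrier) → (Fin m → Matroid n) → H K
  combination {n = n} a N = List.tabulate λ i → a i , n , N i

  combination-cong : ∀ {m n} {a b : Fin m → Carrier} (N : Fin m → Matroid n) → (∀ i → a i ≈ᴷ b i) →
                     combination a N ∼ combination b N
  combination-cong {zero}  N h = ≈-refl
  combination-cong {suc m} N h = ≈-cons (h zero) ≅-refl (combination-cong (N ∘ suc) (h ∘ suc))

  combination-0 : ∀ {m n} {a : Fin m → Carrier} (N : Fin m → Matroid n) → (∀ i → a i ≈ᴷ 0#) → combination a N ∼ []
  combination-0 {zero}  N h = ≈-refl
  combination-0 {suc m} N h = ≈-trans (≈-cons (h zero) ≅-refl (combination-0 (N ∘ suc) (h ∘ suc))) (≈-zero _ [])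

  insert : ∀ {m n} k a (b : Fin m → Carrier) (N : Fin m → Matroid n) →
           (a , n , N k) ∷ combination b N ∼ combination (λ j → whenᴷ (k Fin.≟ j) a +ᴷ b j) N
  insert zero    a b N = ≈-trans (≈-merge a (b zero) _ _)
    (≈-cons ≈ᴷ-refl ≅-refl (combination-cong (N ∘ suc) λ j → ≈ᴷ-sym (+-identityˡ _)))
  insert (suc k) a b N = ≈-trans (≈-swap _ _ _) (≈-cons (≈ᴷ-sym (+-identityˡ _)) ≅-refl
    (≈-trans (insert k a (b ∘ suc) (N ∘ suc)) (combination-cong (N ∘ suc) λ j → +-cong
      (whenᴷ-cong (k Fin.≟ j) (suc k Fin.≟ suc j) (cong suc) Fin.suc-injective ≈ᴷ-refl) ≈ᴷ-refl)))

  -- Entries with the same value of f carry the same matroid and merge. The result is a sum over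
  -- each fibre of f, the shape to which the closure lemma applies.
  pushforward : ∀ {l m n} (f : Fin l → Fin m) (a : Fin l → Carrier) (N : Fin m → Matroid n) →
                combination a (N ∘ f) ∼ combination (λ j → sumᴷ λ i → whenᴷ (f i Fin.≟ j) (a i)) N
  pushforward {zero}  f a N = ≈-sym (combination-0 N λ _ → ≈ᴷ-refl)
  pushforward {suc l} f a N = ≈-trans (≈-cons ≈ᴷ-refl ≅-refl (pushforward (f ∘ suc) (a ∘ suc) N))
    (insert (f zero) (a zero) _ N)

  select : ∀ {p} {P : Set p} → Dec P → Carrier × 𝓦 → H K
  select (yes _) t = t ∷ []
  select (no _)  t = []

  select-yes : ∀ {p} {P : Set p} (P? : Dec P) → P → ∀ {t} → select P? t ≡ t ∷ []
  select-yes (yes _) p = refl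
  select-yes (no ¬p) p = contradiction p ¬p

  select-no : ∀ {p} {P : Set p} (P? : Dec P) → ¬ P → ∀ {t} → select P? t ≡ []
  select-no (yes p) ¬p = contradiction p ¬p
  select-no (no _)  ¬p = refl

  select-when : ∀ {p} {P : Set p} (P? : Dec P) {a n} {L N : Matroid n} → L ≅ N →
                select P? (a , n , L) ∼ (whenᴷ P? a , n , N) ∷ []
  select-when (yes _) i = ≈-cons ≈ᴷ-refl i ≈-refl
  select-when (no _)  i = ≈-sym (≈-zero _ [])

  map-filter : ∀ {a p} {A : Set a} {P : Pred A p} (P? : Decidable P) (f : A → Carrier × 𝓦) xs →
               List.map f (List.filter P? xs) ≡ List.concatMap (λ x → select (P? x) (f x)) xs
  map-filter P? f []       = refl
  map-filter P? f (x ∷ xs) with P? x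
  ... | yes _ = cong (f x ∷_) (map-filter P? f xs)
  ... | no _  = map-filter P? f xs

  concatMap-distrib : ∀ {a} {A : Set a} (f g : A → H K) xs →
    List.concatMap f xs List.++ List.concatMap g xs ∼ List.concatMap (λ x → f x List.++ g x) xs
  concatMap-distrib f g []       = ≈-refl
  concatMap-distrib f g (x ∷ xs) = ≈-trans (↭⇒∼ (Perm.↭-trans
      (Perm.↭-reflexive (List.++-assoc (f x) (List.concatMap f xs) _))
      (Perm.↭-trans (Perm.++⁺ˡ (f x) (Perm.shifts (List.concatMap f xs) (g x)))
        (Perm.↭-reflexive (sym (List.++-assoc (f x) (g x) _))))))
    (++-congˡ (f x List.++ g x) (concatMap-distrib f g xs))

  concatMap-[] : ∀ {a} {A : Set a} {f : A → H K} xs → (∀ {x} → x ∈ˡ xs → f x ∼ []) → List.concatMap f xs ∼ []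
  concatMap-[] []       h = ≈-refl
  concatMap-[] (x ∷ xs) h = ++-cong (h (here refl)) (concatMap-[] xs (h ∘ there))

  concatMap-single : ∀ {a} {A : Set a} {f : A → H K} {xs y} → Unique xs → y ∈ˡ xs →
                     (∀ x → ¬ x ≡ y → f x ∼ []) → List.concatMap f xs ∼ f y
  concatMap-single {f = f} {x ∷ xs} (x∉ ∷ u) (here refl) h = subst (f x List.++ List.concatMap f xs ∼_) (List.++-identityʳ (f x))
    (++-congˡ (f x) (concatMap-[] xs λ {z} z∈ → h z λ { refl → All.lookup x∉ z∈ refl }))
  concatMap-single {f = f} {x ∷ xs} (x∉ ∷ u) (there y∈) h =
    ++-cong (h x λ { refl → All.lookup x∉ y∈ refl }) (concatMap-single u y∈ h)

  concat-tabulate : ∀ {m} {g : Fin m → H K} {t} → (∀ i → g i ∼ t i ∷ []) → List.concat (List.tabulate g) ∼ List.tabulate t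
  concat-tabulate {zero}  h = ≈-refl
  concat-tabulate {suc m} h = ++-cong (h zero) (concat-tabulate (h ∘ suc))

  concat-tabulate-[] : ∀ {m} {g : Fin m → H K} → (∀ i → g i ≡ []) → List.concat (List.tabulate g) ≡ []
  concat-tabulate-[] {zero}  h = refl
  concat-tabulate-[] {suc m} h = cong₂ List._++_ (h zero) (concat-tabulate-[] (h ∘ suc))

  cell : ∀ {n} → Carrier → Matroid n → List (Subset n) → H K
  cell {n} a N D = select (isIrreducibleChain? N D) (a , n , chainProduct N D)

  cell-yes : ∀ {n} a (N : Matroid n) {D} → IsIrreducibleChain N D → cell a N D ≡ (a , n , chainProduct N D) ∷ []
  cell-yes a N {D} ic = select-yes (isIrreducibleChain? N D) ic

  cell-no : ∀ {n} a (N : Matroid n) {D} → ¬ IsIrreducibleChain N D → cell a N D ≡ []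
  cell-no a N {D} ¬ic = select-no (isIrreducibleChain? N D) ¬ic

  -- The terms of φ (combination a N) that come from the chain D.
  column : ∀ {m n} → (Fin m → Carrier) → (Fin m → Matroid n) → List (Subset n) → H K
  column a N D = List.concat (List.tabulate λ i → cell (a i) (N i) D)

  -- Each `IC (N i)` filters one list of sequences that does not depend on i. With an empty cell for
  -- a sequence that fails the test, the table becomes rectangular, and summation by rows can be
  -- exchanged for summation by columns.
  columns : ∀ {m n} (a : Fin m → Carrier) (N : Fin m → Matroid n) →
            φ K (combination a N) ∼ List.concatMap (column a N) (sequences (suc n) (subsets n))
  columns {zero}  {n} a N = ≈-sym (concatMap-[] (sequences (suc n) (subsets n)) λ _ → ≈-refl)
  columns {suc m} {n} a N = ≈-trans
    (++-cong (subst (image-terms (a zero) (N zero) (IC (N zero)) ∼_)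
        (map-filter (isIrreducibleChain? (N zero)) (λ D → a zero , n , chainProduct (N zero) D) (sequences (suc n) (subsets n)))
        ≈-refl)
      (columns (a ∘ suc) (N ∘ suc)))
    (concatMap-distrib (cell (a zero) (N zero)) (column (a ∘ suc) (N ∘ suc)) (sequences (suc n) (subsets n)))

≤ʷ-trans : {L M N : Matroid n} → L ≤ʷ M → M ≤ʷ N → L ≤ʷ N
≤ʷ-trans (e , f) (e′ , g) = trans e e′ , λ B → g B ∘ f B

chain-≋ : {M N : Matroid n} → M ≋ N → ∀ {D} → IsIrreducibleChain M D → IsIrreducibleChain N D
chain-≋ {M = M} {N} e {D} ic = subst (IsIrreducibleChain N)
  (trans (List.map-cong image-identity D) (List.map-id D)) (rankIso-chain (proj₂ (≋⇒iso {M = M} {N} e)) ic)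

chain-shape : ∀ {S : Subset n} {D} → Nonempty S → IsChain S D → ¬ D ≡ ⊥ ∷ S ∷ [] →
              ∃ λ A → ∃ λ B → ∃ λ C → ∃ λ E → D ≡ A ∷ B ∷ C ∷ E
chain-shape {D = []}            ne (() , _) ¬D₀
chain-shape {D = _ ∷ []}        (x , x∈S) (refl , e , _) ¬D₀ =
  contradiction (subst (x ∈_) (sym (Maybe.just-injective e)) x∈S) ∉⊥
chain-shape {D = _ ∷ _ ∷ []}    ne (refl , refl , _) ¬D₀ = contradiction refl ¬D₀
chain-shape {D = A ∷ B ∷ C ∷ E} ne _ ¬D₀ = A , B , C , E , refl

-- The poset enters only through an enumeration `N` with these properties, which keeps the argument
-- independent of how `𝓡 M` is computed.
module _ {n} (M : Matroid n) (irr : Irreducible M) {m} (N : Fin (suc m) → Matroid n) (N₀≋M : N zero ≋ M)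
         (above : ∀ i → M ≤ʷ N i) (reducible : ∀ i → Reducible (N (suc i)))
         (distinct : ∀ i j → N i ≋ N j → i ≡ j)
         (complete : ∀ L → M ≤ʷ L → Reducible L → ∃ λ i → N i ≋ L) where
  private
    S = ground M
    isDPO = On.isDecPartialOrder N (≤ʷ-isDecPartialOrder n)
    module Closure = ClosureSum isDPO (λ {i} {j} → distinct i j)
    μ₀ = Möbius.μ isDPO zero

  module _ {D : List (Subset n)} (ch : IsChain S D)
           (product : ∀ P → IsChain (ground P) D → ProperFreeProduct (chainProduct P D)) where
    private
      L : Fin (suc m) → Matroid n
      L i = chainProduct (N i) D

    chᵢ : ∀ i → IsChain (ground (N i)) D
    chᵢ i = subst (λ S → IsChain S D) (proj₁ (above i)) ch

    L-reducible : ∀ i → Reducible (L i)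
    L-reducible i h = proj₂ h (product (N i) (chᵢ i))

    -- The matroid N(D) is again in the poset: it lies above M because it lies above N, and it is
    -- reducible by `product`. So the closure can be defined on indices.
    closed : ∀ i → ∃ λ j → N j ≋ L i
    closed i = complete (L i) (≤ʷ-trans {L = M} {N i} {L i} (above i) (chainProduct-extensive (N i) (chᵢ i))) (L-reducible i)

    closure : Fin (suc m) → Fin (suc m)
    closure i = proj₁ (closed i)

    closure-≋ : ∀ i → N (closure i) ≋ L i
    closure-≋ i = proj₂ (closed i)

    closure-≥ : ∀ i → L i ≤ʷ N (closure i)
    closure-≥ i = ≋⇒≤ʷ {M = L i} {N (closure i)} (≋-sym {M = N (closure i)} {L i} (closure-≋ i))

    closure-≤ : ∀ i → N (closure i) ≤ʷ L i
    closure-≤ i = ≋⇒≤ʷ {M = N (closure i)} {L i} (closure-≋ i)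

    closure-extensive : ∀ i → N i ≤ʷ N (closure i)
    closure-extensive i = ≤ʷ-trans {L = N i} {L i} {N (closure i)} (chainProduct-extensive (N i) (chᵢ i)) (closure-≥ i)

    L-monotone : ∀ {i j} → N i ≤ʷ N j → L i ≤ʷ L j
    L-monotone {i} {j} le = chainProduct-monotone {M = N i} {N j} le {D} (chᵢ i)

    closure-monotone : ∀ {i j} → N i ≤ʷ N j → N (closure i) ≤ʷ N (closure j)
    closure-monotone {i} {j} le = ≤ʷ-trans {L = N (closure i)} {L i} {N (closure j)} (closure-≤ i)
      (≤ʷ-trans {L = L i} {L j} {N (closure j)} (L-monotone le) (closure-≥ j))

    closure-idempotent : ∀ i → closure (closure i) ≡ closure i
    closure-idempotent i = distinct _ _ (≤ʷ-antisym {M = N (closure (closure i))} {N (closure i)}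
      (≤ʷ-trans {L = N (closure (closure i))} {L (closure i)} {N (closure i)} (closure-≤ (closure i))
        (≤ʷ-trans {L = L (closure i)} {chainProduct (L i) D} {N (closure i)}
          (chainProduct-monotone {M = N (closure i)} {L i} (closure-≤ i) {D} (chᵢ (closure i)))
          (≤ʷ-trans {L = chainProduct (L i) D} {L i} {N (closure i)} (chainProduct-idempotent (N i) (chᵢ i)) (closure-≥ i))))
      (closure-extensive (closure i)))

    -- All closures are reducible, while index zero stands for M. This is where the irreducibility
    -- of M makes the fibre sums vanish.
    closure≢zero : ∀ i → ¬ closure i ≡ zero
    closure≢zero i e = L-reducible i (irreducible-≋ {M = M} {L i}
      (≋-trans {L = M} {N zero} {L i} (≋-sym {M = N zero} {M} N₀≋M)
        (subst (λ j → N j ≋ L i) e (closure-≋ i))) irr)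

    closure-chain⁺ : ∀ i → IsIrreducibleChain (N i) D → IsIrreducibleChain (N (closure i)) D
    closure-chain⁺ i ic = chain-≋ {M = L i} {N (closure i)} (≋-sym {M = N (closure i)} {L i} (closure-≋ i))
      (chainProduct-chain⁺ (N i) (chᵢ i) ic)

    closure-chain⁻ : ∀ i → IsIrreducibleChain (N (closure i)) D → IsIrreducibleChain (N i) D
    closure-chain⁻ i ic = chainProduct-chain⁻ (N i) (chᵢ i)
      (chain-≋ {M = N (closure i)} {L i} (closure-≋ i) ic)

    μ-closure-sum : ∀ j → sum (λ i → when (closure i Fin.≟ j) (μ₀ i)) ≡ 0ℤ
    μ-closure-sum = Closure.closure-sum zero
      (λ i → ≤ʷ-trans {L = N zero} {M} {N i} (≋⇒≤ʷ {M = N zero} {M} N₀≋M) (above i))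
      closure closure-extensive (λ {i} {j} → closure-monotone {i} {j}) closure-idempotent closure≢zero

  module _ {c ℓ₁ ℓ₂} (K : HeytingField c ℓ₁ ℓ₂) where
    open FormalSums K
    open Existence K
    private
      D₀ : List (Subset n)
      D₀ = ⊥ ∷ S ∷ []
      w : Fin (suc m) → Carrier
      w = fromℤ K ∘ μ₀
      sumᴷ = CommutativeMonoidSum.sum +-commutativeMonoid

    minor-S : ∀ i → minor (N i) ⊥ S ≋ N i
    minor-S i = subst (λ U → minor (N i) ⊥ U ≋ N i) (sym (proj₁ (above i))) (minor-whole (N i))

    D₀-chain : IsIrreducibleChain (N zero) D₀
    D₀-chain = refl , cong just (proj₁ (above zero)) ,
      (((λ h → contradiction h ∉⊥) , proj₁ (proj₁ irr) , proj₂ (proj₁ irr) , ∉⊥) ,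
        irreducible-≋ {M = M} {minor (N zero) ⊥ S}
          (≋-trans {L = M} {N zero} {minor (N zero) ⊥ S} (≋-sym {M = N zero} {M} N₀≋M)
            (≋-sym {M = minor (N zero) ⊥ S} {N zero} (minor-S zero))) irr) ∷ [-]

    D₀-not-chain : ∀ i → ¬ IsIrreducibleChain (N (suc i)) D₀
    D₀-not-chain i (_ , _ , (_ , h) ∷ [-]) =
      reducible i (irreducible-≋ {M = minor (N (suc i)) ⊥ S} {N (suc i)} (minor-S (suc i)) h)

    column-D₀ : column w N D₀ ∼ e K M
    column-D₀ = subst₂ (λ x y → x List.++ y ∼ e K M)
      (sym (cell-yes (w zero) (N zero) {D₀} D₀-chain))
      (sym (concat-tabulate-[] {g = λ i → cell (w (suc i)) (N (suc i)) D₀} λ i → cell-no (w (suc i)) (N (suc i)) {D₀} (D₀-not-chain i)))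
      (≈-cons (subst (λ a → fromℤ K a ≈ᴷ 1#) (sym (Closure.μ-diag zero)) (+-identityʳ 1#))
        (≋⇒≅ {M = minor (N zero) ⊥ S} {M} (≋-trans {L = minor (N zero) ⊥ S} {N zero} {M} (minor-S zero) N₀≋M)) ≈-refl)

    column-long : ∀ D → IsChain S D → (∀ P → IsChain (ground P) D → ProperFreeProduct (chainProduct P D)) →
                  column w N D ∼ []
    column-long D ch product = ≈-trans
      (concat-tabulate {g = λ i → cell (w i) (N i) D} {t = λ i → whenᴷ (chain? i) (w i) , n , N (f i)} λ i →
        select-when (chain? i) {w i} {n} {chainProduct (N i) D} {N (f i)} (≋⇒≅ {M = chainProduct (N i) D} {N (f i)}
        (≋-sym {M = N (f i)} {chainProduct (N i) D} (closure-≋ ch product i))))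
      (≈-trans (pushforward f (λ i → whenᴷ (chain? i) (w i)) N)
        (combination-0 N λ j → vanish j (chain? j)))
      where
      f = closure ch product
      chain? : ∀ i → Dec (IsIrreducibleChain (N i) D)
      chain? i = isIrreducibleChain? (N i) D
      total : ∀ j → sumᴷ (λ i → whenᴷ (f i Fin.≟ j) (w i)) ≈ᴷ 0#
      total j = ≈ᴷ-trans (≈ᴷ-sym (≈ᴷ-trans (fromℤ-sum (λ i → when (f i Fin.≟ j) (μ₀ i)))
          (CommutativeMonoidSum.sum-cong-≋ +-commutativeMonoid λ i → ≡⇒≈ (fromℤ-when (f i Fin.≟ j) (μ₀ i)))))
        (≡⇒≈ (cong (fromℤ K) (μ-closure-sum ch product j)))
        where
        ≡⇒≈ : ∀ {a b} → a ≡ b → a ≈ᴷ b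
        ≡⇒≈ refl = ≈ᴷ-refl
      -- All i in the fibre over j agree with j on whether D is an irreducible chain. So either the
      -- whole fibre contributes, with sum zero, or none of it does.
      vanish : ∀ j → Dec (IsIrreducibleChain (N j) D) →
               sumᴷ (λ i → whenᴷ (f i Fin.≟ j) (whenᴷ (chain? i) (w i))) ≈ᴷ 0#
      vanish j (yes ic) = ≈ᴷ-trans (CommutativeMonoidSum.sum-cong-≋ +-commutativeMonoid λ i →
          go i (f i Fin.≟ j) (chain? i)) (total j)
        where
        go : ∀ i (d : Dec (f i ≡ j)) (d′ : Dec (IsIrreducibleChain (N i) D)) → whenᴷ d (whenᴷ d′ (w i)) ≈ᴷ whenᴷ d (w i)
        go i (no _)     d′       = ≈ᴷ-refl
        go i (yes _)    (yes _)  = ≈ᴷ-refl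
        go i (yes refl) (no ¬ic) = contradiction (closure-chain⁻ ch product i ic) ¬ic
      vanish j (no ¬ic) = sumᴷ-zero λ i → go i (f i Fin.≟ j) (chain? i)
        where
        go : ∀ i (d : Dec (f i ≡ j)) (d′ : Dec (IsIrreducibleChain (N i) D)) → whenᴷ d (whenᴷ d′ (w i)) ≈ᴷ 0#
        go i (no _)     d′       = ≈ᴷ-refl
        go i (yes _)    (no _)   = ≈ᴷ-refl
        go i (yes refl) (yes ic) = contradiction (closure-chain⁺ ch product i ic) ¬ic

    column-other : ∀ D → ¬ D ≡ D₀ → column w N D ∼ []
    -- D ranges over arbitrary sequences of subsets; a single N i that has D as an irreducible chain
    -- shows that D increases from ∅ to S.
    column-other D ¬D₀ = decide (any? λ i → isIrreducibleChain? (N i) D)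
      where
      long : (∃ λ A → ∃ λ B → ∃ λ C → ∃ λ E → D ≡ A ∷ B ∷ C ∷ E) → IsChain S D → column w N D ∼ []
      long (_ , _ , _ , _ , refl) ch = column-long D ch λ P → chainProduct-reducible P
      decide : Dec (∃ λ i → IsIrreducibleChain (N i) D) → column w N D ∼ []
      decide (no none) = subst (_∼ []) (sym (concat-tabulate-[] {g = λ i → cell (w i) (N i) D} λ i →
        cell-no (w i) (N i) {D} (λ ic → none (i , ic)))) ≈-refl
      decide (yes (i , ic)) = long (chain-shape (proj₁ irr) ch ¬D₀) ch
        where
        ch : IsChain S D
        ch = subst (λ U → IsChain U D) (sym (proj₁ (above i))) (chain⇒isChain {M = N i} ic)

    φ-combination : φ K (combination w N) ∼ e K M
    φ-combination = ≈-trans (columns w N) (≈-trans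
      (concatMap-single (sequences-unique (suc n) (subsets-unique n))
        (linked∈sequences (Linked.map proj₁ (proj₂ (proj₂ D₀-chain)))) column-other)
      column-D₀)

theorem7 : ∀ {c ℓ₁ ℓ₂} (K : HeytingField c ℓ₁ ℓ₂) → CharacteristicZero K →
    ∀ {n} (M : Matroid n) → Irreducible M → Is-p K M (möbiusSum K M)
theorem7 K char0 {n} M irr = image≈ , λ x φx≈ → FormalSums.preimage-unique K char0 image≈ φx≈
  where
  image≈ : _≈ᴴ_ K (φ K (möbiusSum K M)) (e K M)
  image≈ = φ-combination M irr (List.lookup (𝓡 M)) (refl , λ _ → mk⇔ id id) (𝓡-above M) (𝓡-reducible M)
    (𝓡-distinct M) (𝓡-complete M irr) K
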